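{- Let $G$ be the hexagonal lattice with parameter $m$, and let $N=N(m)$ be its number of vertices. Then \[ \lim_{N\to\infty}\frac{\sup_{p\in(0,1)}\mathbb{E}[C_p]}{N}\in(0.16738,\,0.17144), \] where the limit is taken along $N=N(m)$, $m\to\infty$.
   Context: The hexagonal lattice with parameter $m\ge1$ is the following finite piece of the infinite hexagonal (honeycomb) lattice: take the regular hexagons of side length $1$ with two horizontal sides, centred at the points $\left(\tfrac{3}{2}j,\ \sqrt{3}\,\bigl(i+\tfrac{1}{2}(j \bmod 2)\bigr)\right)$ for $0\le j\le m-1$, where $0\le i\le m-1$ if $j$ is even and $0\le i\le m-2$ if $j$ is odd (so there are $m$ columns of hexagons, alternately with $m$ and $m-1$ hexagons). The vertices of the graph are the corners of these hexagons and the edges are their sides. For a graph $G$ and $p\in[0,1]$, each vertex of $G$ is declared open with probability $p$ and closed with probability $1-p$, independently of the other vertices; $G_p$ is the subgraph of $G$ induced by the open vertices, and $C_p$ is the number of connected components of $G_p$. -}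

module Defs where

open import Data.Fin.Base using (Fin)
open import Data.Fin.Properties using () renaming (_≟_ to _≟ꟳ_)
open import Data.Fin.Subset using (Subset; inside; outside; _∈_)
open import Data.Fin.Subset.Properties using (_∈?_)
open import Data.Integer.Base using (+_)
open import Data.List.Base
  using (List; []; _∷_; _++_; map; concatMap; filter; foldr; length; lookup; upTo; allFin; deduplicate)
open import Data.List.Membership.Propositional using () renaming (_∈_ to _∈ᴸ_)
import Data.List.Membership.DecPropositional as DecMembership
open import Data.List.Membership.Propositional.Properties using (∈-concatMap⁻; ∈-allFin)
open import Data.List.Relation.Unary.Any using (Any; here; there)
open import Data.Nat.Base as ℕ using (ℕ; zero; suc; NonZero; _⊔_; _∸_; _%_)
import Data.Nat.Properties as ℕ
open import Data.Product.Base using (_×_; _,_; proj₁; proj₂; ∃-syntax)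
open import Data.Product.Properties using (≡-dec; ,-injectiveˡ)
open import Data.Rational.Base as ℚ using (ℚ; 0ℚ; 1ℚ)
import Data.Rational.Properties as ℚ
open import Data.Rational.Solver using (module +-*-Solver)
open import Data.Sum.Base using (_⊎_; inj₁; inj₂; swap)
open import Data.Vec.Base using ([]; _∷_)
open import Function.Base using (_∘_)
open import Relation.Binary.Construct.Closure.ReflexiveTransitive using (Star; ε; _◅_; _◅◅_)
open import Relation.Binary.Definitions using (Decidable; Symmetric; Irreflexive)
open import Relation.Binary.PropositionalEquality using (_≡_; refl; sym; trans; cong; cong₂; subst)
open import Relation.Nullary using (¬_; Dec; yes; no)
open import Relation.Nullary.Decidable using (_×-dec_; _⊎-dec_; map′)

-- A real is a Cauchy sequence of rationals; two reals x, y denote the same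
-- number when x ≤ y and y ≤ x.

IsCauchy : (ℕ → ℚ) → Set
IsCauchy a = ∀ δ → 0ℚ ℚ.< δ →
  ∃[ M ] ∀ m n → M ℕ.≤ m → M ℕ.≤ n → ℚ.∣ a m ℚ.- a n ∣ ℚ.< δ

record ℝ : Set where
  constructor mkℝ
  field
    seq    : ℕ → ℚ
    cauchy : IsCauchy seq

open ℝ public

infix 4 _<_ _≤_

_<_ : ℝ → ℝ → Set
x < y = ∃[ δ ] 0ℚ ℚ.< δ × ∃[ M ] ∀ n → M ℕ.≤ n → seq x n ℚ.+ δ ℚ.≤ seq y n

_≤_ : ℝ → ℝ → Set
x ≤ y = ¬ (y < x)

fromℚ : ℚ → ℝ
fromℚ q = mkℝ (λ _ → q) λ δ 0<δ → 0 , λ _ _ _ _ →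
  subst (λ r → ℚ.∣ r ∣ ℚ.< δ) (sym (ℚ.+-inverseʳ q)) 0<δ

fromℕ : ℕ → ℝ
fromℕ n = fromℚ (+ n ℚ./ 1)

0ℝ 1ℝ : ℝ
0ℝ = fromℚ 0ℚ
1ℝ = fromℚ 1ℚ

private
  open +-*-Solver using (solve; _:=_; _:+_; _:*_; _:-_; :-_)

  split : ∀ δ → 0ℚ ℚ.< δ → (K : ℚ) → 0ℚ ℚ.< K → ∃[ η ] 0ℚ ℚ.< η × K ℚ.* η ≡ δ
  split δ 0<δ K 0<K = (ℚ.1/ K) ℚ.* δ , 0<η , eq
    where
    instance
      posK : ℚ.Positive K
      posK = ℚ.positive 0<K
      nzK : ℚ.NonZero K
      nzK = ℚ.pos⇒nonZero K
      posδ : ℚ.Positive δ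
      posδ = ℚ.positive 0<δ
      pos1/K : ℚ.Positive (ℚ.1/ K)
      pos1/K = ℚ.1/pos⇒pos K
    0<η = ℚ.positive⁻¹ _ {{ℚ.pos*pos⇒pos (ℚ.1/ K) δ}}
    eq : K ℚ.* ((ℚ.1/ K) ℚ.* δ) ≡ δ
    eq = trans (sym (ℚ.*-assoc K (ℚ.1/ K) δ))
        (trans (cong (ℚ._* δ) (ℚ.*-inverseʳ K)) (ℚ.*-identityˡ δ))

  eventuallyBounded : ∀ (x : ℝ) →
    ∃[ B ] 0ℚ ℚ.< B × ∃[ M ] ∀ n → M ℕ.≤ n → ℚ.∣ seq x n ∣ ℚ.≤ B
  eventuallyBounded x =
    1ℚ ℚ.+ ℚ.∣ a ∣ , ℚ.+-mono-<-≤ (ℚ.positive⁻¹ 1ℚ) (ℚ.0≤∣p∣ a) , M , bound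
    where
    M = proj₁ (cauchy x 1ℚ (ℚ.positive⁻¹ 1ℚ))
    close = proj₂ (cauchy x 1ℚ (ℚ.positive⁻¹ 1ℚ))
    a = seq x M
    bound : ∀ n → M ℕ.≤ n → ℚ.∣ seq x n ∣ ℚ.≤ 1ℚ ℚ.+ ℚ.∣ a ∣
    bound n M≤n = begin
      ℚ.∣ seq x n ∣                      ≡⟨ cong ℚ.∣_∣ (solve 2 (λ u v → u := (u :- v) :+ v) refl (seq x n) a) ⟩
      ℚ.∣ (seq x n ℚ.- a) ℚ.+ a ∣        ≤⟨ ℚ.∣p+q∣≤∣p∣+∣q∣ (seq x n ℚ.- a) a ⟩
      ℚ.∣ seq x n ℚ.- a ∣ ℚ.+ ℚ.∣ a ∣    ≤⟨ ℚ.+-monoˡ-≤ ℚ.∣ a ∣ (ℚ.<⇒≤ (close n M M≤n ℕ.≤-refl)) ⟩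
      1ℚ ℚ.+ ℚ.∣ a ∣                     ∎
      where open ℚ.≤-Reasoning

infixl 6 _+_ _-_
infixl 7 _*_ _÷_
infix 8 -_

_+_ : ℝ → ℝ → ℝ
x + y = mkℝ (λ n → seq x n ℚ.+ seq y n) isCauchy
  where
  2ℚ = 1ℚ ℚ.+ 1ℚ
  isCauchy : IsCauchy (λ n → seq x n ℚ.+ seq y n)
  isCauchy δ 0<δ =
    let η , 0<η , 2η≡δ = split δ 0<δ 2ℚ (ℚ.positive⁻¹ 2ℚ)
        M₁ , c₁ = cauchy x η 0<η
        M₂ , c₂ = cauchy y η 0<η
    in M₁ ⊔ M₂ , λ m n M≤m M≤n → begin-strict
    ℚ.∣ (seq x m ℚ.+ seq y m) ℚ.- (seq x n ℚ.+ seq y n) ∣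
      ≡⟨ cong ℚ.∣_∣ (solve 4 (λ a b c d → (a :+ b) :- (c :+ d) := (a :- c) :+ (b :- d)) refl
           (seq x m) (seq y m) (seq x n) (seq y n)) ⟩
    ℚ.∣ (seq x m ℚ.- seq x n) ℚ.+ (seq y m ℚ.- seq y n) ∣
      ≤⟨ ℚ.∣p+q∣≤∣p∣+∣q∣ (seq x m ℚ.- seq x n) (seq y m ℚ.- seq y n) ⟩
    ℚ.∣ seq x m ℚ.- seq x n ∣ ℚ.+ ℚ.∣ seq y m ℚ.- seq y n ∣
      <⟨ ℚ.+-mono-< (c₁ m n (ℕ.m⊔n≤o⇒m≤o M₁ M₂ M≤m) (ℕ.m⊔n≤o⇒m≤o M₁ M₂ M≤n))
                    (c₂ m n (ℕ.m⊔n≤o⇒n≤o M₁ M₂ M≤m) (ℕ.m⊔n≤o⇒n≤o M₁ M₂ M≤n)) ⟩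
    η ℚ.+ η
      ≡⟨ cong₂ ℚ._+_ (ℚ.*-identityˡ η) (ℚ.*-identityˡ η) ⟨
    1ℚ ℚ.* η ℚ.+ 1ℚ ℚ.* η
      ≡⟨ ℚ.*-distribʳ-+ η 1ℚ 1ℚ ⟨
    2ℚ ℚ.* η
      ≡⟨ 2η≡δ ⟩
    δ ∎
    where open ℚ.≤-Reasoning

-_ : ℝ → ℝ
- x = mkℝ (λ n → ℚ.- seq x n) isCauchy
  where
  isCauchy : IsCauchy (λ n → ℚ.- seq x n)
  isCauchy δ 0<δ = let M , c = cauchy x δ 0<δ in M , λ m n M≤m M≤n →
    subst (ℚ._< δ)
      (cong ℚ.∣_∣ (solve 2 (λ a b → b :- a := (:- a) :- (:- b)) refl (seq x m) (seq x n)))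
      (c n m M≤n M≤m)

_-_ : ℝ → ℝ → ℝ
x - y = x + (- y)

_*_ : ℝ → ℝ → ℝ
x * y = mkℝ (λ n → seq x n ℚ.* seq y n) isCauchy
  where
  isCauchy : IsCauchy (λ n → seq x n ℚ.* seq y n)
  isCauchy δ 0<δ =
    let B , 0<B , M₁ , b₁ = eventuallyBounded x
        C , 0<C , M₂ , b₂ = eventuallyBounded y
        η , 0<η , eq      = split δ 0<δ (B ℚ.+ C) (ℚ.+-mono-< 0<B 0<C)
        M₃ , c₃           = cauchy x η 0<η
        M₄ , c₄           = cauchy y η 0<η
    in (M₁ ⊔ M₂) ⊔ (M₃ ⊔ M₄) , close 0<B 0<C b₁ b₂ eq c₃ c₄
    where
    close : ∀ {B C η M₁ M₂ M₃ M₄} → 0ℚ ℚ.< B → 0ℚ ℚ.< C →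
            (∀ n → M₁ ℕ.≤ n → ℚ.∣ seq x n ∣ ℚ.≤ B) →
            (∀ n → M₂ ℕ.≤ n → ℚ.∣ seq y n ∣ ℚ.≤ C) →
            (B ℚ.+ C) ℚ.* η ≡ δ →
            (∀ m n → M₃ ℕ.≤ m → M₃ ℕ.≤ n → ℚ.∣ seq x m ℚ.- seq x n ∣ ℚ.< η) →
            (∀ m n → M₄ ℕ.≤ m → M₄ ℕ.≤ n → ℚ.∣ seq y m ℚ.- seq y n ∣ ℚ.< η) →
            ∀ m n → (M₁ ⊔ M₂) ⊔ (M₃ ⊔ M₄) ℕ.≤ m → (M₁ ⊔ M₂) ⊔ (M₃ ⊔ M₄) ℕ.≤ n →
            ℚ.∣ seq x m ℚ.* seq y m ℚ.- seq x n ℚ.* seq y n ∣ ℚ.< δ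
    close {B} {C} {η} {M₁} {M₂} {M₃} {M₄} 0<B 0<C b₁ b₂ eq c₃ c₄ m n M≤m M≤n = begin-strict
      ℚ.∣ xm ℚ.* ym ℚ.- xn ℚ.* yn ∣
        ≡⟨ cong ℚ.∣_∣ (solve 4 (λ a b c d → a :* b :- c :* d := a :* (b :- d) :+ d :* (a :- c)) refl
             xm ym xn yn) ⟩
      ℚ.∣ xm ℚ.* (ym ℚ.- yn) ℚ.+ yn ℚ.* (xm ℚ.- xn) ∣
        ≤⟨ ℚ.∣p+q∣≤∣p∣+∣q∣ (xm ℚ.* (ym ℚ.- yn)) (yn ℚ.* (xm ℚ.- xn)) ⟩
      ℚ.∣ xm ℚ.* (ym ℚ.- yn) ∣ ℚ.+ ℚ.∣ yn ℚ.* (xm ℚ.- xn) ∣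
        <⟨ ℚ.+-mono-< (bound {xm} {B} {ym ℚ.- yn} 0<B (b₁ m (ℕ.m⊔n≤o⇒m≤o M₁ M₂ (l M≤m)))
                         (c₄ m n (ℕ.m⊔n≤o⇒n≤o M₃ M₄ (r M≤m)) (ℕ.m⊔n≤o⇒n≤o M₃ M₄ (r M≤n))))
                      (bound {yn} {C} {xm ℚ.- xn} 0<C (b₂ n (ℕ.m⊔n≤o⇒n≤o M₁ M₂ (l M≤n)))
                         (c₃ m n (ℕ.m⊔n≤o⇒m≤o M₃ M₄ (r M≤m)) (ℕ.m⊔n≤o⇒m≤o M₃ M₄ (r M≤n)))) ⟩
      B ℚ.* η ℚ.+ C ℚ.* η
        ≡⟨ ℚ.*-distribʳ-+ η B C ⟨
      (B ℚ.+ C) ℚ.* η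
        ≡⟨ eq ⟩
      δ ∎
      where
      open ℚ.≤-Reasoning
      xm = seq x m
      ym = seq y m
      xn = seq x n
      yn = seq y n
      l : ∀ {k} → (M₁ ⊔ M₂) ⊔ (M₃ ⊔ M₄) ℕ.≤ k → M₁ ⊔ M₂ ℕ.≤ k
      l = ℕ.m⊔n≤o⇒m≤o (M₁ ⊔ M₂) (M₃ ⊔ M₄)
      r : ∀ {k} → (M₁ ⊔ M₂) ⊔ (M₃ ⊔ M₄) ℕ.≤ k → M₃ ⊔ M₄ ℕ.≤ k
      r = ℕ.m⊔n≤o⇒n≤o (M₁ ⊔ M₂) (M₃ ⊔ M₄)
      bound : ∀ {u K v} → 0ℚ ℚ.< K → ℚ.∣ u ∣ ℚ.≤ K → ℚ.∣ v ∣ ℚ.< η → ℚ.∣ u ℚ.* v ∣ ℚ.< K ℚ.* η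
      bound {u} {K} {v} 0<K u≤K v<η = begin-strict
        ℚ.∣ u ℚ.* v ∣          ≡⟨ ℚ.∣p*q∣≡∣p∣*∣q∣ u v ⟩
        ℚ.∣ u ∣ ℚ.* ℚ.∣ v ∣    ≤⟨ ℚ.*-monoʳ-≤-nonNeg ℚ.∣ v ∣ {{ℚ.nonNegative (ℚ.0≤∣p∣ v)}} u≤K ⟩
        K ℚ.* ℚ.∣ v ∣          <⟨ ℚ.*-monoʳ-<-pos K {{ℚ.positive 0<K}} v<η ⟩
        K ℚ.* η                ∎

_÷_ : ℝ → (n : ℕ) .{{_ : NonZero n}} → ℝ
x ÷ n = x * fromℚ (+ 1 ℚ./ n)

sum : List ℝ → ℝ
sum = foldr _+_ 0ℝ

infix 4 _⟶_

_⟶_ : (ℕ → ℝ) → ℝ → Set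
a ⟶ L = ∀ δ → 0ℝ < δ → ∃[ M ] ∀ n → M ℕ.≤ n → L - δ < a n × a n < L + δ

-- s = sup { f p ∣ P p }, with the least-upper-bound clause in the form
-- "no s - δ with δ > 0 is an upper bound, as shown by some f p above it".
IsSupremum : (ℝ → Set) → (ℝ → ℝ) → ℝ → Set
IsSupremum P f s =
  (∀ p → P p → f p ≤ s) ×
  (∀ δ → 0ℝ < δ → ∃[ p ] P p × s - δ < f p)

⟨0,1⟩ : ℝ → Set
⟨0,1⟩ p = 0ℝ < p × p < 1ℝ

private
  module Reach {n : ℕ} (R : Fin n → Fin n → Set) (R? : Decidable R) where

    -- Walks of length at most one, or whose inner vertices lie in the list.
    Via : List (Fin n) → Fin n → Fin n → Set
    Via []       u v = u ≡ v ⊎ R u v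
    Via (w ∷ ws) u v = Via ws u v ⊎ (Via ws u w × Via ws w v)

    via? : ∀ ws u v → Dec (Via ws u v)
    via? []       u v = (u ≟ꟳ v) ⊎-dec R? u v
    via? (w ∷ ws) u v = via? ws u v ⊎-dec (via? ws u w ×-dec via? ws w v)

    sound : ∀ ws {u v} → Via ws u v → Star R u v
    sound []       (inj₁ refl)    = ε
    sound []       (inj₂ r)       = r ◅ ε
    sound (w ∷ ws) (inj₁ p)       = sound ws p
    sound (w ∷ ws) (inj₂ (p , q)) = sound ws p ◅◅ sound ws q

    base : ∀ ws {u v} → u ≡ v ⊎ R u v → Via ws u v
    base []       b = b
    base (w ∷ ws) b = inj₁ (base ws b)

    join : ∀ {ws x} → x ∈ᴸ ws → ∀ {u v} → Via ws u x → Via ws x v → Via ws u v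
    join (here refl) p q = inj₂ (toHead p , fromHead q)
      where
      toHead : ∀ {w ws u} → Via (w ∷ ws) u w → Via ws u w
      toHead (inj₁ p)       = p
      toHead (inj₂ (p , _)) = p
      fromHead : ∀ {w ws v} → Via (w ∷ ws) w v → Via ws w v
      fromHead (inj₁ q)       = q
      fromHead (inj₂ (_ , q)) = q
    join (there x∈) (inj₁ p)       (inj₁ q)       = inj₁ (join x∈ p q)
    join (there x∈) (inj₁ p)       (inj₂ (q , r)) = inj₂ (join x∈ p q , r)
    join (there x∈) (inj₂ (p , q)) (inj₁ r)       = inj₂ (p , join x∈ q r)
    join (there x∈) (inj₂ (p , _)) (inj₂ (_ , r)) = inj₂ (p , r)

    complete : ∀ {u v} → Star R u v → Via (allFin n) u v
    complete ε        = base (allFin n) (inj₁ refl)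
    complete (_◅_ {j = x} r rs) = join (∈-allFin x) (base (allFin n) (inj₂ r)) (complete rs)

star? : ∀ {n} {R : Fin n → Fin n → Set} → Decidable R → Decidable (Star R)
star? {n} {R} R? u v = map′ (sound (allFin n)) complete (via? (allFin n) u v)
  where open Reach R R?

record Graph : Set₁ where
  field
    order      : ℕ
    Adj        : Fin order → Fin order → Set
    adj?       : Decidable Adj
    adj-sym    : Symmetric Adj
    adj-irrefl : Irreflexive _≡_ Adj

open Graph public

-- Adjacency in the subgraph induced by the set ω of open vertices.
InducedAdj : (G : Graph) → Subset (order G) → Fin (order G) → Fin (order G) → Set
InducedAdj G ω u v = u ∈ ω × v ∈ ω × Adj G u v

Connected : (G : Graph) → Subset (order G) → Fin (order G) → Fin (order G) → Set
Connected G ω = Star (InducedAdj G ω)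

connected? : (G : Graph) (ω : Subset (order G)) → Decidable (Connected G ω)
connected? G ω = star? λ u v → (u ∈? ω) ×-dec ((v ∈? ω) ×-dec adj? G u v)

-- Discarding every open vertex connected to an earlier one leaves exactly one
-- vertex in each connected component.
components : (G : Graph) → Subset (order G) → ℕ
components G ω = length (deduplicate (connected? G ω) (filter (_∈? ω) (allFin (order G))))

subsets : ∀ n → List (Subset n)
subsets zero    = [] ∷ []
subsets (suc n) = map (inside ∷_) (subsets n) ++ map (outside ∷_) (subsets n)

probability : ∀ {n} → ℝ → Subset n → ℝ
probability p []            = 1ℝ
probability p (inside ∷ ω)  = p * probability p ω
probability p (outside ∷ ω) = (1ℝ - p) * probability p ω

expectation : ∀ {n} → ℝ → (Subset n → ℕ) → ℝ
expectation {n} p X = sum (map (λ ω → probability p ω * fromℕ (X ω)) (subsets n))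

𝔼[C] : Graph → ℝ → ℝ
𝔼[C] G p = expectation p (components G)

-- (a , b) stands for the point ((a - 2) / 2 , √3 (b - 1) / 2), which makes all
-- corners of the hexagons natural: the hexagon centred at
-- (3j/2 , √3 (i + (j mod 2)/2)) has its centre at (3j + 2 , 2i + j mod 2 + 1).
Point : Set
Point = ℕ × ℕ

_≟ₚ_ : Decidable {A = Point} _≡_
_≟ₚ_ = ≡-dec ℕ._≟_ ℕ._≟_

open DecMembership (≡-dec _≟ₚ_ _≟ₚ_) using () renaming (_∈?_ to _∈ₛ?_)

hexagons : ℕ → List (ℕ × ℕ)
hexagons m = concatMap (λ j → map (λ i → (i , j)) (upTo (m ∸ j % 2))) (upTo m)

module Hexagon (i j : ℕ) where
  a = 3 ℕ.* j
  b = 2 ℕ.* i ℕ.+ j % 2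

  c₀ c₁ c₂ c₃ c₄ c₅ : Point
  c₀ = a ℕ.+ 4 , b ℕ.+ 1
  c₁ = a ℕ.+ 3 , b ℕ.+ 2
  c₂ = a ℕ.+ 1 , b ℕ.+ 2
  c₃ = a       , b ℕ.+ 1
  c₄ = a ℕ.+ 1 , b
  c₅ = a ℕ.+ 3 , b

corners : ℕ × ℕ → List Point
corners (i , j) = c₀ ∷ c₁ ∷ c₂ ∷ c₃ ∷ c₄ ∷ c₅ ∷ []
  where open Hexagon i j

sides : ℕ × ℕ → List (Point × Point)
sides (i , j) =
  (c₀ , c₁) ∷ (c₁ , c₂) ∷ (c₂ , c₃) ∷ (c₃ , c₄) ∷ (c₄ , c₅) ∷ (c₅ , c₀) ∷ []
  where open Hexagon i j

vertexList : ℕ → List Point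
vertexList m = deduplicate _≟ₚ_ (concatMap corners (hexagons m))

edgeList : ℕ → List (Point × Point)
edgeList m = concatMap sides (hexagons m)

private
  side-nontrivial : ∀ h {x} → ¬ ((x , x) ∈ᴸ sides h)
  side-nontrivial (i , j) = go
    where
    open Hexagon i j
    differ : ∀ {y z : Point} {x} → ¬ (y ≡ z) → ¬ ((x , x) ≡ (y , z))
    differ y≢z refl = y≢z refl
    +-differ : ∀ k {p q} → ¬ (p ≡ q) → ¬ (k ℕ.+ p ≡ k ℕ.+ q)
    +-differ k p≢q e = p≢q (ℕ.+-cancelˡ-≡ k _ _ e)
    +-differ₀ : ∀ k {p} → ¬ (k ℕ.+ suc p ≡ k)
    +-differ₀ k e = ℕ.m+1+n≢m k e
    go : ∀ {x} → ¬ ((x , x) ∈ᴸ sides (i , j))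
    go (here e)                                         = differ (+-differ a (λ ()) ∘ ,-injectiveˡ) e
    go (there (here e))                                 = differ (+-differ a (λ ()) ∘ ,-injectiveˡ) e
    go (there (there (here e)))                         = differ (+-differ₀ a ∘ ,-injectiveˡ) e
    go (there (there (there (here e))))                 = differ (+-differ₀ a ∘ sym ∘ ,-injectiveˡ) e
    go (there (there (there (there (here e)))))         = differ (+-differ a (λ ()) ∘ ,-injectiveˡ) e
    go (there (there (there (there (there (here e)))))) = differ (+-differ a (λ ()) ∘ ,-injectiveˡ) e

  edge-nontrivial : ∀ m {x} → ¬ ((x , x) ∈ᴸ edgeList m)
  edge-nontrivial m x∈ = go (hexagons m) (∈-concatMap⁻ sides {xs = hexagons m} x∈)
    where
    go : ∀ hs {x} → ¬ Any (λ h → (x , x) ∈ᴸ sides h) hs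
    go (h ∷ hs) (here p)  = side-nontrivial h p
    go (h ∷ hs) (there p) = go hs p

hexagonalLattice : ℕ → Graph
hexagonalLattice m = record
  { order      = length (vertexList m)
  ; Adj        = λ u v → (point u , point v) ∈ᴸ edgeList m ⊎ (point v , point u) ∈ᴸ edgeList m
  ; adj?       = λ u v → ((point u , point v) ∈ₛ? edgeList m) ⊎-dec ((point v , point u) ∈ₛ? edgeList m)
  ; adj-sym    = swap
  ; adj-irrefl = λ { refl (inj₁ e) → edge-nontrivial m e
                   ; refl (inj₂ e) → edge-nontrivial m e }
  }
  where
  point : Fin (length (vertexList m)) → Point
  point = lookup (vertexList m)

N : ℕ → ℕ
N m = order (hexagonalLattice m)

instance
  N-nonZero : ∀ {m} .{{_ : NonZero m}} → NonZero (N m)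
  N-nonZero {suc _} = _

{-# OPTIONS --safe #-}
-- The number of components is the number of open vertices minus the rank of
-- the open edges, the number of edges that join two different components when
-- the edges are added one at a time.  Cut the honeycomb lattice into cells of
-- four vertices and six edges.  The mean rank of a k × l rectangle of cells is
-- additive in k and in l up to a boundary term, uniformly in p; comparing the
-- k × 2k, the k′ × 2k′ and the kk′ × 2kk′ rectangles shows that it is
-- Cauchy after division by k², at rate 1 / k, and hence that so is the number of
-- components per vertex.
--
-- Add the cells of a rectangle from the last column to the first, and from top
-- to bottom within a column.  Only two of the six edges of a cell can then
-- close a cycle.  Such an edge does so if it completes an open hexagon, or an
-- open 12-cycle around a closed vertex; it can do so only if open edges lead
-- on from both of its ends.  These local events bound the density of components
-- below by p - 3p²/2 + p⁶/2 + p¹²(1 - p)/2, which exceeds 0.16738 at p = 27/80,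
-- and above by p - 3p²/2 + p⁵ - p⁶/2, which is at most 0.1714 on [0 , 1].
--
-- The operations on reals act term by term, so all of this is needed for
-- rational p only, and suprema are limits of maxima over finite grids.

module Submission where

open import Defs
open import Data.Bool.Base using (Bool; true; false; T; _∧_; if_then_else_)
import Data.Bool.Properties as Bool
open import Data.Empty using (⊥; ⊥-elim)
open import Data.Fin.Base using (Fin; zero; suc)
import Data.Fin.Properties as Fin
open import Data.Fin.Subset using (Subset; inside; outside) renaming (_∈_ to _∈ˢ_)
open import Data.Fin.Subset.Properties using (_∈?_)
open import Data.Integer.Base as ℤ using (+_)
import Data.Integer.Properties as ℤ
open import Data.List.Base using (List; []; _∷_; _++_; map; concatMap; length; foldr; filter; lookup; deduplicate; allFin; upTo; cartesianProduct)
open import Data.List.Membership.Propositional using (_∈_; _∉_; find; lose)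
open import Data.List.Membership.Propositional.Properties
  using (∈-++⁺ˡ; ∈-++⁺ʳ; ∈-++⁻; ∈-map⁺; ∈-map⁻; ∈-filter⁺; ∈-filter⁻; ∈-allFin; ∈-lookup; ∈-deduplicate⁺; ∈-deduplicate⁻;
         ∈-∃++; ∈-concatMap⁺; ∈-concatMap⁻; ∈-upTo⁺; ∈-upTo⁻; ∈-cartesianProduct⁺; ∈-cartesianProduct⁻)
import Data.List.Properties as List
open import Data.List.Relation.Binary.Permutation.Propositional
  using (_↭_; prep; swap; ↭-reflexive; ↭-sym; module PermutationReasoning) renaming (refl to ↭-refl; trans to ↭-trans)
open import Data.List.Relation.Binary.Permutation.Propositional.Properties using (++-comm; ++⁺; ++⁺ˡ; shifts; map⁺; ∈-resp-↭)
open import Data.List.Relation.Unary.All using (All; []; _∷_)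
import Data.List.Relation.Unary.All as All
import Data.List.Relation.Unary.All.Properties as All
open import Data.List.Relation.Unary.AllPairs using (AllPairs; []; _∷_)
import Data.List.Relation.Unary.AllPairs as AllPairs
import Data.List.Relation.Unary.AllPairs.Properties as AllPairs
open import Data.List.Relation.Unary.Any using (here; there; index)
import Data.List.Relation.Unary.Any as Any
import Data.List.Relation.Unary.Any.Properties as Any
import Data.List.Relation.Unary.Unique.DecPropositional as DecUnique
import Data.List.Relation.Unary.Unique.DecPropositional.Properties as DecUniqueₚ
import Data.List.Relation.Unary.Unique.DecSetoid.Properties as DecSetoidUnique
open import Data.List.Relation.Unary.Unique.Propositional using (Unique)
import Data.List.Relation.Unary.Unique.Propositional.Properties as Unique
open import Data.Nat.Base as ℕ using (ℕ; zero; suc; z≤n; s≤s; NonZero; _∸_; _%_; _⊔_; ⌊_/2⌋)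
import Data.Nat.DivMod as ℕ
import Data.Nat.Properties as ℕ
import Data.Nat.Solver
open import Data.Product.Base using (_×_; _,_; proj₁; proj₂; ∃-syntax; Σ-syntax)
open import Data.Product.Properties using (≡-dec)
open import Data.Rational.Base as ℚ using (ℚ; 0ℚ; 1ℚ; ½; _/_)
import Data.Rational.Properties as ℚ
open import Data.Rational.Solver using (module +-*-Solver)
import Data.Rational.Unnormalised.Base as ℚᵘ
import Data.Rational.Unnormalised.Properties as ℚᵘ
open import Data.Sum.Base as Sum using (_⊎_; inj₁; inj₂; [_,_]′)
open import Data.Unit.Base using (tt)
open import Data.Vec.Base as Vec using ([]; _∷_; tabulate)
import Data.Vec.Properties as Vec
open import Function.Base using (_∘_)
open import Relation.Binary.Bundles using (DecSetoid)
open import Relation.Binary.Construct.Closure.ReflexiveTransitive using (ε; _◅_; _◅◅_)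
import Relation.Binary.Construct.Closure.ReflexiveTransitive as Star
open import Relation.Binary.Definitions using (DecidableEquality)
open import Relation.Binary.PropositionalEquality
open import Relation.Nullary using (¬_; Dec; yes; no; contradiction)
open import Relation.Nullary.Decidable using (toWitness; ¬?)

open +-*-Solver using (solve; _:=_; _:+_; _:*_; _:-_; :-_; con)
module N = Data.Nat.Solver.+-*-Solver

-- The rank is what can be cut and pasted: it is monotone and subadditive in the list of edges,
-- additive across a gap and blind to the order of the list, and unlike the number of components it
-- does not refer to a vertex set. A cell spans two columns of hexagons, so the lattice with
-- parameter m looks like m/2 columns of m cells; hence the rectangles k × 2k, with 8k² sites.
--
-- With four sites and six edges per cell, p - 6p²/4 would be the density if no edge closed a cycle;
-- each of the two critical edges of a cell corrects it by a quarter of the probability that it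
-- closes one. The closed vertex inside the 12-cycle makes that event disjoint from the open hexagon
-- at the same edge, so that their probabilities add. The 12-cycles are indispensable at p = 27/80:
-- the hexagons alone give 0.1673796 there, and the total exceeds 0.16738 by only 3 in the seventh
-- decimal place.
--
-- Means have to be compared across lattices of different size and across two systems of
-- coordinates. They are therefore iterated averages over any list of sites that contains those on
-- which the observable depends.

pattern first  = here refl
pattern second = there first
pattern third  = there second
pattern fourth = there third
pattern fifth  = there fourth
pattern sixth  = there fifth

-- Rank of a list of edges

-- The rank of a list of edges is computed by merging labels one edge at a
-- time; an edge counts when it joins two different classes.
module Rank {V : Set} (_≟_ : DecidableEquality V) where

  Edge : Set
  Edge = V × V

  merge : V → V → V → V
  merge a b x with x ≟ a
  ... | yes _ = b
  ... | no  _ = x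

  rep : List Edge → V → V
  rep []            x = x
  rep ((u , v) ∷ E) x = merge (rep E u) (rep E v) (rep E x)

  distinct : V → V → ℕ
  distinct a b with a ≟ b
  ... | yes _ = 0
  ... | no  _ = 1

  rank : List Edge → ℕ
  rank []            = 0
  rank ((u , v) ∷ E) = distinct (rep E u) (rep E v) ℕ.+ rank E

  -- Equality of labels, wrapped in a record so that `E`, `x` and `y` can be read off from the type,
  -- which the bare equation would not allow.
  record Conn (E : List Edge) (x y : V) : Set where
    constructor conn
    field rep≡ : rep E x ≡ rep E y

  open Conn public

  conn-sym : ∀ {E x y} → Conn E x y → Conn E y x
  conn-sym (conn e) = conn (sym e)

  conn-trans : ∀ {E x y z} → Conn E x y → Conn E y z → Conn E x z
  conn-trans (conn e) (conn f) = conn (trans e f)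

  merge-self : ∀ a x → merge a a x ≡ x
  merge-self a x with x ≟ a
  ... | yes refl = refl
  ... | no  _    = refl

  merge-from : ∀ a b → merge a b a ≡ b
  merge-from a b with a ≟ a
  ... | yes _ = refl
  ... | no  n = contradiction refl n

  merge-to : ∀ a b → merge a b b ≡ b
  merge-to a b with b ≟ a
  ... | yes _ = refl
  ... | no  _ = refl

  merge-other : ∀ {a x} b → x ≢ a → merge a b x ≡ x
  merge-other {a} {x} b x≢a with x ≟ a
  ... | yes e = contradiction e x≢a
  ... | no  _ = refl

  distinct-≡ : ∀ {a b} → a ≡ b → distinct a b ≡ 0
  distinct-≡ {a} {b} e with a ≟ b
  ... | yes _ = refl
  ... | no  n = contradiction e n

  distinct-≢ : ∀ {a b} → a ≢ b → distinct a b ≡ 1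
  distinct-≢ {a} {b} n with a ≟ b
  ... | yes e = contradiction e n
  ... | no  _ = refl

  distinct≤1 : ∀ a b → distinct a b ℕ.≤ 1
  distinct≤1 a b with a ≟ b
  ... | yes _ = z≤n
  ... | no  _ = ℕ.≤-refl

  distinct-mono : ∀ {a b c d} → (c ≡ d → a ≡ b) → distinct a b ℕ.≤ distinct c d
  distinct-mono {a} {b} {c} {d} f with a ≟ b | c ≟ d
  ... | yes _ | _     = z≤n
  ... | no  n | yes e = contradiction (f e) n
  ... | no  _ | no  _ = ℕ.≤-refl

  conn-∷ : ∀ e {E x y} → Conn E x y → Conn (e ∷ E) x y
  conn-∷ (u , v) {E} (conn e) = conn (cong (merge (rep E u) (rep E v)) e)

  conn-++ : ∀ A {B x y} → Conn B x y → Conn (A ++ B) x y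
  conn-++ []      c = c
  conn-++ (e ∷ A) c = conn-∷ e (conn-++ A c)

  conn-∈ : ∀ {E u v} → (u , v) ∈ E → Conn E u v
  conn-∈ {(u , v) ∷ E} first =
    conn (trans (merge-from (rep E u) (rep E v)) (sym (merge-to (rep E u) (rep E v))))
  conn-∈ {e ∷ E} (there i) = conn-∷ e (conn-∈ i)

  -- Merging never relabels a vertex outside its class. If the label of `x` is replaced, it equals
  -- that of `u`, and the chain `rep E v ≈ v ≈ u ≈ rep E u ≈ x` closes the induction. Hence `Conn E`
  -- is the least equivalence relation containing the edges, whatever the order in which they were
  -- merged.
  rep-least : (_≈_ : V → V → Set) → (∀ {x} → x ≈ x) → (∀ {x y} → x ≈ y → y ≈ x) →
              (∀ {x y z} → x ≈ y → y ≈ z → x ≈ z) →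
              ∀ E → (∀ {u v} → (u , v) ∈ E → u ≈ v) → ∀ x → rep E x ≈ x
  rep-least _≈_ r s t []            h x = r
  rep-least _≈_ r s t ((u , v) ∷ E) h x with rep E x ≟ rep E u
  ... | no  _ = rep-least _≈_ r s t E (λ i → h (there i)) x
  ... | yes e = t (ih v) (t (s (h first)) (t (s (ih u)) (subst (_≈ x) e (ih x))))
    where
    ih : ∀ y → rep E y ≈ y
    ih = rep-least _≈_ r s t E (λ i → h (there i))

  conn-least : (_≈_ : V → V → Set) → (∀ {x} → x ≈ x) → (∀ {x y} → x ≈ y → y ≈ x) →
               (∀ {x y z} → x ≈ y → y ≈ z → x ≈ z) →
               ∀ E → (∀ {u v} → (u , v) ∈ E → u ≈ v) → ∀ {x y} → Conn E x y → x ≈ y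
  conn-least _≈_ r s t E h {x} {y} (conn e) =
    t (s (rep-least _≈_ r s t E h x)) (subst (_≈ y) (sym e) (rep-least _≈_ r s t E h y))

  -- Minimality applied to the equivalence "both or neither in `Q`". All later proofs that two sites
  -- are not connected exhibit such a set `Q`.
  conn-cut : (Q : V → Set) → ∀ E → (∀ {u v} → (u , v) ∈ E → (Q u → Q v) × (Q v → Q u)) →
             ∀ {x y} → Conn E x y → Q x → Q y
  conn-cut Q E h c =
    proj₁ (conn-least (λ x y → (Q x → Q y) × (Q y → Q x))
      ((λ q → q) , (λ q → q)) (λ (f , g) → g , f)
      (λ (f , g) (f′ , g′) → (λ q → f′ (f q)) , (λ q → g (g′ q))) E h c)

  conn-⊆ : ∀ A B → (∀ {u v} → (u , v) ∈ A → Conn B u v) → ∀ {x y} → Conn A x y → Conn B x y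
  conn-⊆ A B h = conn-least (Conn B) (conn refl) conn-sym conn-trans A h

  distinct-conn : ∀ {A B u v} → (Conn A u v → Conn B u v) →
                  distinct (rep B u) (rep B v) ℕ.≤ distinct (rep A u) (rep A v)
  distinct-conn f = distinct-mono (λ e → rep≡ (f (conn e)))

  private
    Same : V → V → V → V → Set
    Same a b c d = (a ≡ c × b ≡ d) ⊎ (a ≡ d × b ≡ c)

    same⇒ : ∀ {a b c d} → Same a b c d → merge c d a ≡ merge c d b
    same⇒ {a} {b} (inj₁ (refl , refl)) = trans (merge-from a b) (sym (merge-to a b))
    same⇒ {a} {b} (inj₂ (refl , refl)) = trans (merge-to b a) (sym (merge-from b a))

    ⇒same : ∀ {a b c d} → a ≢ b → merge c d a ≡ merge c d b → Same a b c d
    ⇒same {a} {b} {c} {d} a≢b e with a ≟ c | b ≟ c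
    ... | yes p | yes q = contradiction (trans p (sym q)) a≢b
    ... | yes p | no  _ = inj₁ (p , sym e)
    ... | no  _ | yes q = inj₂ (e , q)
    ... | no  _ | no  _ = contradiction e a≢b

    flip-same : ∀ {a b c d} → Same a b c d → Same c d a b
    flip-same (inj₁ (p , q)) = inj₁ (sym p , sym q)
    flip-same (inj₂ (p , q)) = inj₂ (sym q , sym p)

  -- The exchange property behind the independence of the order. When both pairs of labels are
  -- distinct, merging one pair makes the other trivial exactly if the two unordered pairs coincide,
  -- which is a symmetric condition.
  distinct-swap : ∀ a b c d →
    distinct (merge c d a) (merge c d b) ℕ.+ distinct c d ≡
    distinct (merge a b c) (merge a b d) ℕ.+ distinct a b
  distinct-swap a b c d with a ≟ b | c ≟ d
  ... | yes refl | yes refl = trans (cong (ℕ._+ 0) (distinct-≡ refl)) (sym (cong (ℕ._+ 0) (distinct-≡ refl)))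
  ... | yes refl | no c≢d = trans (cong (ℕ._+ 1) (distinct-≡ refl))
          (sym (cong (ℕ._+ 0) (trans (cong₂ distinct (merge-self a c) (merge-self a d)) (distinct-≢ c≢d))))
  ... | no a≢b | yes refl = trans (cong (ℕ._+ 0) (trans (cong₂ distinct (merge-self c a) (merge-self c b)) (distinct-≢ a≢b)))
          (sym (cong (ℕ._+ 1) (distinct-≡ refl)))
  ... | no a≢b | no c≢d = cong (ℕ._+ 1) (ℕ.≤-antisym
          (distinct-mono (λ e → same⇒ (flip-same (⇒same c≢d e))))
          (distinct-mono (λ e → same⇒ (flip-same (⇒same a≢b e)))))

  rank-swap : ∀ e f E → rank (e ∷ f ∷ E) ≡ rank (f ∷ e ∷ E)
  rank-swap (u , v) (u′ , v′) E = begin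
    distinct (merge c d a) (merge c d b) ℕ.+ (distinct c d ℕ.+ rank E)
      ≡⟨ ℕ.+-assoc (distinct (merge c d a) (merge c d b)) (distinct c d) (rank E) ⟨
    distinct (merge c d a) (merge c d b) ℕ.+ distinct c d ℕ.+ rank E
      ≡⟨ cong (ℕ._+ rank E) (distinct-swap a b c d) ⟩
    distinct (merge a b c) (merge a b d) ℕ.+ distinct a b ℕ.+ rank E
      ≡⟨ ℕ.+-assoc (distinct (merge a b c) (merge a b d)) (distinct a b) (rank E) ⟩
    distinct (merge a b c) (merge a b d) ℕ.+ (distinct a b ℕ.+ rank E) ∎
    where
    open ≡-Reasoning
    a = rep E u
    b = rep E v
    c = rep E u′
    d = rep E v′

  conn-↭ : ∀ {A B x y} → A ↭ B → Conn A x y → Conn B x y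
  conn-↭ {A} {B} A↭B = conn-⊆ A B (λ i → conn-∈ (∈-resp-↭ A↭B i))

  rank-∷-cong : ∀ e {A B} → A ↭ B → rank A ≡ rank B → rank (e ∷ A) ≡ rank (e ∷ B)
  rank-∷-cong (u , v) A↭B eq = cong₂ ℕ._+_
    (ℕ.≤-antisym (distinct-conn (conn-↭ (↭-sym A↭B))) (distinct-conn (conn-↭ A↭B))) eq

  rank-↭ : ∀ {A B} → A ↭ B → rank A ≡ rank B
  rank-↭ ↭-refl        = refl
  rank-↭ (prep e p)    = rank-∷-cong e p (rank-↭ p)
  rank-↭ (swap {ys = ys} e f p) = trans (rank-∷-cong e (prep f p) (rank-∷-cong f p (rank-↭ p))) (rank-swap e f ys)
  rank-↭ (↭-trans p q) = trans (rank-↭ p) (rank-↭ q)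

  rank-∷≤ : ∀ e E → rank (e ∷ E) ℕ.≤ suc (rank E)
  rank-∷≤ (u , v) E = ℕ.+-monoˡ-≤ (rank E) (distinct≤1 _ _)

  rank≤length : ∀ E → rank E ℕ.≤ length E
  rank≤length []      = z≤n
  rank≤length (e ∷ E) = ℕ.≤-trans (rank-∷≤ e E) (s≤s (rank≤length E))

  -- An edge that joins two classes of `A ++ B` also joins two classes of `A`, whose classes are
  -- finer; so it counts at most as often on the left as on the right.
  rank-++-≤ : ∀ A B → rank (A ++ B) ℕ.≤ rank A ℕ.+ rank B
  rank-++-≤ []            B = ℕ.≤-refl
  rank-++-≤ ((u , v) ∷ A) B = ℕ.≤-trans
    (ℕ.+-mono-≤ (distinct-conn (conn-⊆ A (A ++ B) (λ i → conn-∈ (left i)))) (rank-++-≤ A B))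
    (ℕ.≤-reflexive (sym (ℕ.+-assoc (distinct (rep A u) (rep A v)) (rank A) (rank B))))
    where
    left : ∀ {e} → e ∈ A → e ∈ A ++ B
    left = ∈-++⁺ˡ

  rank-≤-++ : ∀ A B → rank B ℕ.≤ rank (A ++ B)
  rank-≤-++ []            B = ℕ.≤-refl
  rank-≤-++ ((u , v) ∷ A) B = ℕ.≤-trans (rank-≤-++ A B) (ℕ.m≤n+m _ _)

  rank-spanned : ∀ A B → (∀ {u v} → (u , v) ∈ A → Conn B u v) → rank (A ++ B) ≡ rank B
  rank-spanned []            B h = refl
  rank-spanned ((u , v) ∷ A) B h =
    cong₂ ℕ._+_ (distinct-≡ (rep≡ (conn-++ A {B} (h first)))) (rank-spanned A B (λ i → h (there i)))

  -- `A` contributes nothing on top of `B`, so `B ++ A`, whose rank is at least that of `A`, has the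
  -- rank of `B`.
  rank-mono : ∀ A B → (∀ {u v} → (u , v) ∈ A → Conn B u v) → rank A ℕ.≤ rank B
  rank-mono A B h = ℕ.≤-trans (rank-≤-++ B A)
    (ℕ.≤-reflexive (trans (rank-↭ (++-comm B A)) (rank-spanned A B h)))

  rank-disjoint : (Q : V → Set) → (∀ x → Dec (Q x)) → ∀ A B →
                  (∀ {u v} → (u , v) ∈ A → Q u × Q v) → (∀ {u v} → (u , v) ∈ B → ¬ Q u × ¬ Q v) →
                  rank A ℕ.+ rank B ℕ.≤ rank (A ++ B)
  rank-disjoint Q Q? []            B hA hB = ℕ.≤-refl
  rank-disjoint Q Q? ((u , v) ∷ A) B hA hB = ℕ.≤-trans
    (ℕ.≤-reflexive (ℕ.+-assoc (distinct (rep A u) (rep A v)) (rank A) (rank B)))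
    (ℕ.+-mono-≤ (distinct-conn restrict) (rank-disjoint Q Q? A B (λ i → hA (there i)) hB))
    where
    -- Collapsing everything outside `Q` to a single class absorbs the edges of `B`. The result is
    -- an equivalence containing all of `A ++ B` that agrees with `Conn A` inside `Q`, so `B` cannot
    -- help to connect the ends of an edge of `A`.
    _≈_ : V → V → Set
    x ≈ y = (Q x × Q y × Conn A x y) ⊎ (¬ Q x × ¬ Q y)
    ≈-refl : ∀ {x} → x ≈ x
    ≈-refl {x} with Q? x
    ... | yes q = inj₁ (q , q , conn refl)
    ... | no  q = inj₂ (q , q)
    ≈-sym : ∀ {x y} → x ≈ y → y ≈ x
    ≈-sym (inj₁ (p , q , c)) = inj₁ (q , p , conn-sym c)
    ≈-sym (inj₂ (p , q))     = inj₂ (q , p)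
    ≈-trans : ∀ {x y z} → x ≈ y → y ≈ z → x ≈ z
    ≈-trans (inj₁ (p , q , c)) (inj₁ (_ , r , d)) = inj₁ (p , r , conn-trans c d)
    ≈-trans (inj₁ (_ , q , _)) (inj₂ (n , _))     = contradiction q n
    ≈-trans (inj₂ (_ , n))     (inj₁ (q , _))     = contradiction q n
    ≈-trans (inj₂ (n , _))     (inj₂ (_ , m))     = inj₂ (n , m)
    edge : ∀ {x y} → (x , y) ∈ A ++ B → x ≈ y
    edge i with ∈-++⁻ A i
    ... | inj₁ j = inj₁ (proj₁ (hA (there j)) , proj₂ (hA (there j)) , conn-∈ j)
    ... | inj₂ j = inj₂ (hB j)
    restrict : Conn (A ++ B) u v → Conn A u v
    restrict c with conn-least _≈_ ≈-refl ≈-sym ≈-trans (A ++ B) edge c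
    ... | inj₁ (_ , _ , d) = d
    ... | inj₂ (n , _)     = contradiction (proj₁ (hA first)) n

  rank-∷-conn : ∀ {u v E} → Conn E u v → rank ((u , v) ∷ E) ≡ rank E
  rank-∷-conn {E = E} c = cong (ℕ._+ rank E) (distinct-≡ (rep≡ c))

  step-≤ : ∀ {u v E n} → (Conn E u v → 1 ℕ.≤ n) → suc (rank E) ℕ.≤ n ℕ.+ rank ((u , v) ∷ E)
  step-≤ {u} {v} {E} {n} h with rep E u ≟ rep E v
  ... | yes e = ℕ.+-monoˡ-≤ (rank E) (h (conn e))
  ... | no  _ = ℕ.m≤n+m _ n

-- Rank under injective relabelling

module RankMap {V W : Set} (_≟V_ : DecidableEquality V) (_≟W_ : DecidableEquality W)
               (τ : V → W) (τ-inj : ∀ {x y} → τ x ≡ τ y → x ≡ y) where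

  private
    module V = Rank _≟V_
    module W = Rank _≟W_

  τ² : V × V → W × W
  τ² (u , v) = τ u , τ v

  merge-map : ∀ a b x → W.merge (τ a) (τ b) (τ x) ≡ τ (V.merge a b x)
  merge-map a b x with x ≟V a | τ x ≟W τ a
  ... | yes _ | yes _ = refl
  ... | no  _ | no  _ = refl
  ... | yes e | no  n = contradiction (cong τ e) n
  ... | no  n | yes e = contradiction (τ-inj e) n

  rep-map : ∀ E x → W.rep (map τ² E) (τ x) ≡ τ (V.rep E x)
  rep-map []            x = refl
  rep-map ((u , v) ∷ E) x
    rewrite rep-map E u | rep-map E v | rep-map E x = merge-map _ _ _

  rank-map : ∀ E → W.rank (map τ² E) ≡ V.rank E
  rank-map []            = refl
  rank-map ((u , v) ∷ E) = cong₂ ℕ._+_ same (rank-map E)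
    where
    same : W.distinct (W.rep (map τ² E) (τ u)) (W.rep (map τ² E) (τ v)) ≡ V.distinct (V.rep E u) (V.rep E v)
    same rewrite rep-map E u | rep-map E v with V.rep E u ≟V V.rep E v
    ... | yes e = W.distinct-≡ (cong τ e)
    ... | no  n = W.distinct-≢ (λ e → n (τ-inj e))

-- Rational arithmetic

ι : ℕ → ℚ
ι n = + n ℚ./ 1

private
  toℚᵘ-ι : ∀ n → ℚ.toℚᵘ (ι n) ℚᵘ.≃ ℚᵘ.mkℚᵘ (+ n) 0
  toℚᵘ-ι n = ℚ.toℚᵘ-fromℚᵘ (ℚᵘ.mkℚᵘ (+ n) 0)

ι-+ : ∀ m n → ι (m ℕ.+ n) ≡ ι m ℚ.+ ι n
ι-+ m n = ℚ.toℚᵘ-injective (begin-equality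
  ℚ.toℚᵘ (ι (m ℕ.+ n))               ≃⟨ toℚᵘ-ι (m ℕ.+ n) ⟩
  ℚᵘ.mkℚᵘ (+ (m ℕ.+ n)) 0            ≃⟨ ℚᵘ.*≡* (cong₂ ℤ._*_ (cong₂ ℤ._+_ (sym (ℤ.*-identityʳ (+ m))) (sym (ℤ.*-identityʳ (+ n)))) refl) ⟩
  ℚᵘ.mkℚᵘ (+ m) 0 ℚᵘ.+ ℚᵘ.mkℚᵘ (+ n) 0 ≃⟨ ℚᵘ.+-cong (toℚᵘ-ι m) (toℚᵘ-ι n) ⟨
  ℚ.toℚᵘ (ι m) ℚᵘ.+ ℚ.toℚᵘ (ι n)     ≃⟨ ℚ.toℚᵘ-homo-+ (ι m) (ι n) ⟨
  ℚ.toℚᵘ (ι m ℚ.+ ι n)               ∎)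
  where open ℚᵘ.≤-Reasoning

ι-* : ∀ m n → ι (m ℕ.* n) ≡ ι m ℚ.* ι n
ι-* m n = ℚ.toℚᵘ-injective (begin-equality
  ℚ.toℚᵘ (ι (m ℕ.* n))               ≃⟨ toℚᵘ-ι (m ℕ.* n) ⟩
  ℚᵘ.mkℚᵘ (+ (m ℕ.* n)) 0            ≃⟨ ℚᵘ.*≡* (cong₂ ℤ._*_ (ℤ.pos-* m n) refl) ⟩
  ℚᵘ.mkℚᵘ (+ m) 0 ℚᵘ.* ℚᵘ.mkℚᵘ (+ n) 0 ≃⟨ ℚᵘ.*-cong (toℚᵘ-ι m) (toℚᵘ-ι n) ⟨
  ℚ.toℚᵘ (ι m) ℚᵘ.* ℚ.toℚᵘ (ι n)     ≃⟨ ℚ.toℚᵘ-homo-* (ι m) (ι n) ⟨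
  ℚ.toℚᵘ (ι m ℚ.* ι n)               ∎)
  where open ℚᵘ.≤-Reasoning

ι-mono : ∀ {m n} → m ℕ.≤ n → ι m ℚ.≤ ι n
ι-mono {m} {n} m≤n = ℚ.toℚᵘ-cancel-≤ (begin
  ℚ.toℚᵘ (ι m)      ≃⟨ toℚᵘ-ι m ⟩
  ℚᵘ.mkℚᵘ (+ m) 0   ≤⟨ ℚᵘ.*≤* (ℤ.*-monoʳ-≤-nonNeg (+ 1) (ℤ.+≤+ m≤n)) ⟩
  ℚᵘ.mkℚᵘ (+ n) 0   ≃⟨ toℚᵘ-ι n ⟨
  ℚ.toℚᵘ (ι n)      ∎)
  where open ℚᵘ.≤-Reasoning

0≤ι : ∀ n → 0ℚ ℚ.≤ ι n
0≤ι n = ι-mono {0} {n} ℕ.z≤n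

ι-inverse : ∀ n .{{_ : NonZero n}} → ι n ℚ.* (+ 1 ℚ./ n) ≡ 1ℚ
ι-inverse (suc n) = ℚ.toℚᵘ-injective (begin-equality
  ℚ.toℚᵘ (ι (suc n) ℚ.* (+ 1 ℚ./ suc n)) ≃⟨ ℚ.toℚᵘ-homo-* (ι (suc n)) (+ 1 ℚ./ suc n) ⟩
  ℚ.toℚᵘ (ι (suc n)) ℚᵘ.* ℚ.toℚᵘ (+ 1 ℚ./ suc n)
    ≃⟨ ℚᵘ.*-cong (toℚᵘ-ι (suc n)) (ℚ.toℚᵘ-fromℚᵘ (ℚᵘ.mkℚᵘ (+ 1) n)) ⟩
  ℚᵘ.mkℚᵘ (+ suc n) 0 ℚᵘ.* ℚᵘ.mkℚᵘ (+ 1) n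
    ≃⟨ ℚᵘ.*≡* (trans (ℤ.*-identityʳ (+ suc n ℤ.* + 1)) (trans (ℤ.*-identityʳ (+ suc n)) (sym (trans (ℤ.*-identityˡ (+ suc (n ℕ.+ 0))) (cong (λ k → + suc k) (ℕ.+-identityʳ n)))))) ⟩
  ℚᵘ.mkℚᵘ (+ 1) 0 ∎)
  where open ℚᵘ.≤-Reasoning

0≤1/ : ∀ n .{{_ : NonZero n}} → 0ℚ ℚ.≤ + 1 ℚ./ n
0≤1/ (suc n) = ℚ.nonNegative⁻¹ _ {{ℚ.normalize-nonNeg 1 (suc n)}}

*-monoʳ : ∀ {c a b} → 0ℚ ℚ.≤ c → a ℚ.≤ b → a ℚ.* c ℚ.≤ b ℚ.* c
*-monoʳ {c} 0≤c = ℚ.*-monoʳ-≤-nonNeg c {{ℚ.nonNegative 0≤c}}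

*-monoˡ : ∀ {c a b} → 0ℚ ℚ.≤ c → a ℚ.≤ b → c ℚ.* a ℚ.≤ c ℚ.* b
*-monoˡ {c} 0≤c = ℚ.*-monoˡ-≤-nonNeg c {{ℚ.nonNegative 0≤c}}

0≤* : ∀ {a b} → 0ℚ ℚ.≤ a → 0ℚ ℚ.≤ b → 0ℚ ℚ.≤ a ℚ.* b
0≤* {a} {b} 0≤a 0≤b = subst (ℚ._≤ a ℚ.* b) (ℚ.*-zeroʳ a) (*-monoˡ 0≤a 0≤b)

0≤+ : ∀ {a b} → 0ℚ ℚ.≤ a → 0ℚ ℚ.≤ b → 0ℚ ℚ.≤ a ℚ.+ b
0≤+ 0≤a 0≤b = ℚ.+-mono-≤ 0≤a 0≤b

≤⇒0≤- : ∀ {a b} → a ℚ.≤ b → 0ℚ ℚ.≤ b ℚ.- a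
≤⇒0≤- {a} {b} a≤b = subst (ℚ._≤ b ℚ.- a) (ℚ.+-inverseʳ a) (ℚ.+-monoˡ-≤ (ℚ.- a) a≤b)

≤-by : ∀ {a b} d → 0ℚ ℚ.≤ d → b ≡ a ℚ.+ d → a ℚ.≤ b
≤-by {a} d 0≤d refl = ℚ.≤-trans (ℚ.≤-reflexive (sym (ℚ.+-identityʳ a))) (ℚ.+-monoʳ-≤ a 0≤d)

∣∣≤ : ∀ {a b} → a ℚ.≤ b → ℚ.- a ℚ.≤ b → ℚ.∣ a ∣ ℚ.≤ b
∣∣≤ {a} a≤b -a≤b with ℚ.∣p∣≡p∨∣p∣≡-p a
... | inj₁ e = subst (ℚ._≤ _) (sym e) a≤b
... | inj₂ e = subst (ℚ._≤ _) (sym e) -a≤b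

≤∣∣ : ∀ a → a ℚ.≤ ℚ.∣ a ∣
≤∣∣ a with ℚ.≤-total 0ℚ a
... | inj₁ 0≤a = ℚ.≤-reflexive (sym (ℚ.0≤p⇒∣p∣≡p 0≤a))
... | inj₂ a≤0 = ℚ.≤-trans a≤0 (ℚ.0≤∣p∣ a)

Unit : ℚ → Set
Unit p = 0ℚ ℚ.≤ p × p ℚ.≤ 1ℚ

1-Unit : ∀ {p} → Unit p → 0ℚ ℚ.≤ 1ℚ ℚ.- p
1-Unit (_ , p≤1) = ≤⇒0≤- p≤1

archimedean : ∀ δ → 0ℚ ℚ.< δ → ∃[ d ] 1ℚ ℚ.≤ ι d ℚ.* δ
archimedean δ 0<δ = go δ (ℚ.positive 0<δ)
  where
  go : ∀ δ → ℚ.Positive δ → ∃[ d ] 1ℚ ℚ.≤ ι d ℚ.* δ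
  -- The denominator of `δ` will do, because the numerator is at least 1.
  go δ@(ℚ.mkℚ (+ suc n) d _) _ = suc d , ℚ.toℚᵘ-cancel-≤ (begin
    ℚᵘ.mkℚᵘ (+ 1) 0
      ≤⟨ ℚᵘ.*≤* (ℤ.≤-trans (ℤ.≤-reflexive (ℤ.*-identityˡ _))
           (ℤ.≤-trans (ℤ.+≤+ (ℕ.m≤m*n (1 ℕ.* suc d) (suc n)))
             (ℤ.≤-reflexive (trans (ℤ.pos-* (1 ℕ.* suc d) (suc n)) (trans (cong (λ k → + k ℤ.* + suc n) (ℕ.*-identityˡ (suc d))) (sym (ℤ.*-identityʳ _))))))) ⟩
    ℚᵘ.mkℚᵘ (+ suc d) 0 ℚᵘ.* ℚ.toℚᵘ δ  ≃⟨ ℚᵘ.*-congʳ {ℚ.toℚᵘ δ} (toℚᵘ-ι (suc d)) ⟨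
    ℚ.toℚᵘ (ι (suc d)) ℚᵘ.* ℚ.toℚᵘ δ   ≃⟨ ℚ.toℚᵘ-homo-* (ι (suc d)) δ ⟨
    ℚ.toℚᵘ (ι (suc d) ℚ.* δ)           ∎)
    where open ℚᵘ.≤-Reasoning

-- Expectation of observables of finitely many sites

avg : ℚ → ℚ → ℚ → ℚ
avg p a b = p ℚ.* a ℚ.+ (1ℚ ℚ.- p) ℚ.* b

avg-mono : ∀ {p a b c d} → Unit p → a ℚ.≤ c → b ℚ.≤ d → avg p a b ℚ.≤ avg p c d
avg-mono u a≤c b≤d = ℚ.+-mono-≤ (*-monoˡ (proj₁ u) a≤c) (*-monoˡ (1-Unit u) b≤d)

avg-const : ∀ p c → avg p c c ≡ c
avg-const = solve 2 (λ p c → p :* c :+ (con 1ℚ :- p) :* c := c) refl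

avg-+ : ∀ p a b c d → avg p (a ℚ.+ b) (c ℚ.+ d) ≡ avg p a c ℚ.+ avg p b d
avg-+ = solve 5 (λ p a b c d → p :* (a :+ b) :+ (con 1ℚ :- p) :* (c :+ d) :=
  (p :* a :+ (con 1ℚ :- p) :* c) :+ (p :* b :+ (con 1ℚ :- p) :* d)) refl

avg-* : ∀ p c a b → avg p (c ℚ.* a) (c ℚ.* b) ≡ c ℚ.* avg p a b
avg-* = solve 4 (λ p c a b → p :* (c :* a) :+ (con 1ℚ :- p) :* (c :* b) :=
  c :* (p :* a :+ (con 1ℚ :- p) :* b)) refl

avg-swap : ∀ p a b c d → avg p (avg p a b) (avg p c d) ≡ avg p (avg p a c) (avg p b d)
avg-swap = solve 5 (λ p a b c d →
  p :* (p :* a :+ (con 1ℚ :- p) :* b) :+ (con 1ℚ :- p) :* (p :* c :+ (con 1ℚ :- p) :* d) :=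
  p :* (p :* a :+ (con 1ℚ :- p) :* c) :+ (con 1ℚ :- p) :* (p :* b :+ (con 1ℚ :- p) :* d)) refl

weight : ℚ → Bool → ℚ
weight p true  = p
weight p false = 1ℚ ℚ.- p

module Expectation {V : Set} (_≟_ : DecidableEquality V) where

  Config : Set
  Config = V → Bool

  infix 8 _[_↦_]
  _[_↦_] : Config → V → Bool → Config
  (σ [ x ↦ b ]) y with y ≟ x
  ... | yes _ = b
  ... | no  _ = σ y

  update-at : ∀ σ x b → (σ [ x ↦ b ]) x ≡ b
  update-at σ x b with x ≟ x
  ... | yes _ = refl
  ... | no  n = contradiction refl n

  update-off : ∀ σ {x} b {y} → y ≢ x → (σ [ x ↦ b ]) y ≡ σ y
  update-off σ {x} b {y} y≢x with y ≟ x
  ... | yes e = contradiction e y≢x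
  ... | no  _ = refl

  update-cong : ∀ {σ τ} x b y → (y ≢ x → σ y ≡ τ y) → (σ [ x ↦ b ]) y ≡ (τ [ x ↦ b ]) y
  update-cong x b y e with y ≟ x
  ... | yes _ = refl
  ... | no  n = e n

  update-swap : ∀ σ {x y} b c → x ≢ y → ∀ z → (σ [ x ↦ b ] [ y ↦ c ]) z ≡ (σ [ y ↦ c ] [ x ↦ b ]) z
  update-swap σ {x} {y} b c x≢y z with z ≟ y | z ≟ x
  ... | yes z≡y | yes z≡x = contradiction (trans (sym z≡x) z≡y) x≢y
  ... | yes z≡y | no  _   = sym (trans (cong (λ w → (σ [ y ↦ c ]) w) z≡y) (update-at σ y c))
  ... | no  z≢y | yes z≡x = trans (cong (λ w → (σ [ x ↦ b ]) w) z≡x) (update-at σ x b)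
  ... | no  z≢y | no  z≢x = trans (update-off σ b z≢x) (sym (update-off σ c z≢y))

  Local : List V → (Config → ℚ) → Set
  Local xs X = ∀ {σ τ} → (∀ {y} → y ∈ xs → σ y ≡ τ y) → X σ ≡ X τ

  Ext : (Config → ℚ) → Set
  Ext X = ∀ {σ τ} → (∀ y → σ y ≡ τ y) → X σ ≡ X τ

  -- The listed sites are resampled one after another and `σ` supplies the states of all others.
  -- Repetitions in the list are harmless, since the inner update overwrites the outer one;
  -- concatenated supports can thus be used as they are.
  E : ℚ → List V → (Config → ℚ) → Config → ℚ
  E p []       X σ = X σ
  E p (x ∷ xs) X σ = avg p (E p xs X (σ [ x ↦ true ])) (E p xs X (σ [ x ↦ false ]))

  E-cong : ∀ p xs {X Y} → (∀ σ → X σ ≡ Y σ) → ∀ σ → E p xs X σ ≡ E p xs Y σ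
  E-cong p []       h σ = h σ
  E-cong p (x ∷ xs) h σ = cong₂ (avg p) (E-cong p xs h _) (E-cong p xs h _)

  E-mono : ∀ {p} → Unit p → ∀ xs {X Y} → (∀ σ → X σ ℚ.≤ Y σ) → ∀ σ → E p xs X σ ℚ.≤ E p xs Y σ
  E-mono u []       h σ = h σ
  E-mono u (x ∷ xs) h σ = avg-mono u (E-mono u xs h _) (E-mono u xs h _)

  E-+ : ∀ p xs X Y σ → E p xs (λ σ → X σ ℚ.+ Y σ) σ ≡ E p xs X σ ℚ.+ E p xs Y σ
  E-+ p []       X Y σ = refl
  E-+ p (x ∷ xs) X Y σ = trans (cong₂ (avg p) (E-+ p xs X Y _) (E-+ p xs X Y _))
    (avg-+ p (E p xs X (σ [ x ↦ true ])) (E p xs Y (σ [ x ↦ true ])) (E p xs X (σ [ x ↦ false ])) (E p xs Y (σ [ x ↦ false ])))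

  E-const : ∀ p xs c σ → E p xs (λ _ → c) σ ≡ c
  E-const p []       c σ = refl
  E-const p (x ∷ xs) c σ = trans (cong₂ (avg p) (E-const p xs c _) (E-const p xs c _)) (avg-const p c)

  E-local : ∀ p xs {ws zs X} → (∀ {y} → y ∈ zs → y ∈ xs ⊎ y ∈ ws) → Local zs X → Local ws (E p xs X)
  E-local p [] zs⊆ loc eq = loc λ i → eq (right (zs⊆ i))
    where
    right : ∀ {y ws} → y ∈ [] ⊎ y ∈ ws → y ∈ ws
    right (inj₂ i) = i
  E-local p (x ∷ xs) {ws} {zs} zs⊆ loc {σ} {τ} eq = cong₂ (avg p) (go true) (go false)
    where
    split : ∀ {y} → y ∈ zs → y ∈ xs ⊎ y ∈ x ∷ ws
    split i with zs⊆ i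
    ... | inj₁ (here e)  = inj₂ (here e)
    ... | inj₁ (there j) = inj₁ j
    ... | inj₂ j         = inj₂ (there j)
    agree : ∀ b {y} → y ∈ x ∷ ws → (σ [ x ↦ b ]) y ≡ (τ [ x ↦ b ]) y
    agree b first   = trans (update-at σ x b) (sym (update-at τ x b))
    agree b {y} (there i) = update-cong x b y (λ _ → eq i)
    go : ∀ b → E p xs _ (σ [ x ↦ b ]) ≡ E p xs _ (τ [ x ↦ b ])
    go b = E-local p xs split loc (agree b)

  avg-comm : ∀ p x y {X} → Ext X → ∀ σ → E p (x ∷ y ∷ []) X σ ≡ E p (y ∷ x ∷ []) X σ
  avg-comm p x y {X} ext σ with x ≟ y
  ... | yes refl = refl
  ... | no  x≢y = trans
    (avg-swap p (X (σ [ x ↦ true ] [ y ↦ true ])) _ (X (σ [ x ↦ false ] [ y ↦ true ])) _)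
    (cong₂ (avg p) (cong₂ (avg p) (go true true) (go false true)) (cong₂ (avg p) (go true false) (go false false)))
    where
    go : ∀ b c → X (σ [ x ↦ b ] [ y ↦ c ]) ≡ X (σ [ y ↦ c ] [ x ↦ b ])
    go b c = ext (update-swap σ b c x≢y)

  E-ext : ∀ p xs {X} → Ext X → Ext (E p xs X)
  E-ext p []       ext eq = ext eq
  E-ext p (x ∷ xs) ext eq = cong₂ (avg p) (E-ext p xs ext (λ y → update-cong x true y (λ _ → eq y)))
                                          (E-ext p xs ext (λ y → update-cong x false y (λ _ → eq y)))

  E-comm₁ : ∀ p x ys {X} → Ext X → ∀ σ → E p (x ∷ []) (E p ys X) σ ≡ E p ys (E p (x ∷ []) X) σ
  E-comm₁ p x []       ext σ = refl
  E-comm₁ p x (y ∷ ys) ext σ = trans (avg-comm p x y (E-ext p ys ext) σ)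
    (cong₂ (avg p) (E-comm₁ p x ys ext _) (E-comm₁ p x ys ext _))

  E-comm : ∀ p xs ys {X} → Ext X → ∀ σ → E p xs (E p ys X) σ ≡ E p ys (E p xs X) σ
  E-comm p []       ys ext σ = refl
  E-comm p (x ∷ xs) ys ext σ = trans
    (cong₂ (avg p) (E-comm p xs ys ext _) (E-comm p xs ys ext _))
    (E-comm₁ p x ys (E-ext p xs ext) σ)

  -- Both sides equal the iterated average over xs and ys, in either order.
  E-independent : ∀ p xs ys {X} → Local xs X → Local ys X → ∀ σ τ → E p xs X σ ≡ E p ys X τ
  E-independent p xs ys {X} locx locy σ τ = begin
    E p xs X σ             ≡⟨ E-const p ys (E p xs X σ) τ ⟨
    E p ys (λ _ → E p xs X σ) τ ≡⟨ E-cong p ys (λ ρ → E-local p xs {[]} inj₁ locx {σ} {ρ} (λ ())) τ ⟩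
    E p ys (E p xs X) τ    ≡⟨ E-comm p ys xs (λ eq → locx (λ {y} _ → eq y)) τ ⟩
    E p xs (E p ys X) τ    ≡⟨ E-cong p xs (λ ρ → E-local p ys {[]} inj₁ locy {ρ} {τ} (λ ())) τ ⟩
    E p xs (λ _ → E p ys X τ) τ ≡⟨ E-const p xs (E p ys X τ) τ ⟩
    E p ys X τ             ∎
    where open ≡-Reasoning

  E-* : ∀ p xs c X σ → E p xs (λ σ → c ℚ.* X σ) σ ≡ c ℚ.* E p xs X σ
  E-* p []       c X σ = refl
  E-* p (x ∷ xs) c X σ = trans (cong₂ (avg p) (E-* p xs c X _) (E-* p xs c X _))
    (avg-* p c (E p xs X (σ [ x ↦ true ])) (E p xs X (σ [ x ↦ false ])))

  E-fix : ∀ p ys x (Z : Bool → Config → ℚ) σ → x ∉ ys →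
          E p ys (λ σ → Z (σ x) σ) σ ≡ E p ys (Z (σ x)) σ
  E-fix p []       x Z σ _  = refl
  E-fix p (y ∷ ys) x Z σ x∉ = cong₂ (avg p) (go true) (go false)
    where
    go : ∀ b → E p ys (λ σ → Z (σ x) σ) (σ [ y ↦ b ]) ≡ E p ys (Z (σ x)) (σ [ y ↦ b ])
    go b = trans (E-fix p ys x Z _ (λ i → x∉ (there i)))
      (cong (λ c → E p ys (Z c) (σ [ y ↦ b ])) (update-off σ b (λ e → x∉ (here e))))

  E-bounds : ∀ {p B} → Unit p → ∀ xs {X} → (∀ σ → 0ℚ ℚ.≤ X σ × X σ ℚ.≤ B) → ∀ σ → 0ℚ ℚ.≤ E p xs X σ × E p xs X σ ℚ.≤ B
  E-bounds {p} {B} u xs h σ =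
    ℚ.≤-trans (ℚ.≤-reflexive (sym (E-const p xs 0ℚ σ))) (E-mono u xs (proj₁ ∘ h) σ) ,
    ℚ.≤-trans (E-mono u xs (proj₂ ∘ h) σ) (ℚ.≤-reflexive (E-const p xs B σ))

  -- Replacing `p` by `q` at one site changes the average by `p - q` times the difference of the two
  -- branches, which is at most `B`; the remaining sites are handled by induction, so each listed
  -- site costs one such term.
  E-lipschitz : ∀ {p q B} → Unit p → Unit q → ∀ xs {X} → (∀ σ → 0ℚ ℚ.≤ X σ × X σ ℚ.≤ B) → ∀ σ →
                ℚ.∣ E p xs X σ ℚ.- E q xs X σ ∣ ℚ.≤ ι (length xs) ℚ.* (B ℚ.* ℚ.∣ p ℚ.- q ∣)
  E-lipschitz {p} {q} {B} u v [] {X} h σ = ℚ.≤-reflexive (trans (cong ℚ.∣_∣ (ℚ.+-inverseʳ (X σ)))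
    (sym (ℚ.*-zeroˡ (B ℚ.* ℚ.∣ p ℚ.- q ∣))))
  E-lipschitz {p} {q} {B} u v (x ∷ xs) {X} h σ = begin
    ℚ.∣ avg p a₁ a₀ ℚ.- avg q b₁ b₀ ∣
      ≡⟨ cong ℚ.∣_∣ (solve 6 (λ p q a₁ a₀ b₁ b₀ →
           (p :* a₁ :+ (con 1ℚ :- p) :* a₀) :- (q :* b₁ :+ (con 1ℚ :- q) :* b₀) :=
           (p :* (a₁ :- b₁) :+ (con 1ℚ :- p) :* (a₀ :- b₀)) :+ (b₁ :- b₀) :* (p :- q)) refl p q a₁ a₀ b₁ b₀) ⟩
    ℚ.∣ (p ℚ.* (a₁ ℚ.- b₁) ℚ.+ (1ℚ ℚ.- p) ℚ.* (a₀ ℚ.- b₀)) ℚ.+ (b₁ ℚ.- b₀) ℚ.* (p ℚ.- q) ∣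
      ≤⟨ ℚ.∣p+q∣≤∣p∣+∣q∣ (p ℚ.* (a₁ ℚ.- b₁) ℚ.+ (1ℚ ℚ.- p) ℚ.* (a₀ ℚ.- b₀)) _ ⟩
    ℚ.∣ p ℚ.* (a₁ ℚ.- b₁) ℚ.+ (1ℚ ℚ.- p) ℚ.* (a₀ ℚ.- b₀) ∣ ℚ.+ ℚ.∣ (b₁ ℚ.- b₀) ℚ.* (p ℚ.- q) ∣
      ≤⟨ ℚ.+-mono-≤ (ℚ.∣p+q∣≤∣p∣+∣q∣ (p ℚ.* (a₁ ℚ.- b₁)) _) (ℚ.≤-reflexive (ℚ.∣p*q∣≡∣p∣*∣q∣ (b₁ ℚ.- b₀) _)) ⟩
    ℚ.∣ p ℚ.* (a₁ ℚ.- b₁) ∣ ℚ.+ ℚ.∣ (1ℚ ℚ.- p) ℚ.* (a₀ ℚ.- b₀) ∣ ℚ.+ ℚ.∣ b₁ ℚ.- b₀ ∣ ℚ.* D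
      ≡⟨ cong (ℚ._+ ℚ.∣ b₁ ℚ.- b₀ ∣ ℚ.* D) (cong₂ ℚ._+_ (scale (proj₁ u)) (scale (1-Unit u))) ⟩
    avg p ℚ.∣ a₁ ℚ.- b₁ ∣ ℚ.∣ a₀ ℚ.- b₀ ∣ ℚ.+ ℚ.∣ b₁ ℚ.- b₀ ∣ ℚ.* D
      ≤⟨ ℚ.+-mono-≤ (avg-mono u (E-lipschitz u v xs h _) (E-lipschitz u v xs h _)) (*-monoʳ (ℚ.0≤∣p∣ _) spread) ⟩
    avg p (K ℚ.* (B ℚ.* D)) (K ℚ.* (B ℚ.* D)) ℚ.+ B ℚ.* D
      ≡⟨ cong (ℚ._+ B ℚ.* D) (avg-const p _) ⟩
    K ℚ.* (B ℚ.* D) ℚ.+ B ℚ.* D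
      ≡⟨ solve 2 (λ K Z → K :* Z :+ Z := (con 1ℚ :+ K) :* Z) refl K (B ℚ.* D) ⟩
    (1ℚ ℚ.+ K) ℚ.* (B ℚ.* D)
      ≡⟨ cong (ℚ._* (B ℚ.* D)) (ι-+ 1 (length xs)) ⟨
    ι (length (x ∷ xs)) ℚ.* (B ℚ.* D) ∎
    where
    open ℚ.≤-Reasoning
    D = ℚ.∣ p ℚ.- q ∣
    K = ι (length xs)
    a₁ = E p xs X (σ [ x ↦ true ])
    a₀ = E p xs X (σ [ x ↦ false ])
    b₁ = E q xs X (σ [ x ↦ true ])
    b₀ = E q xs X (σ [ x ↦ false ])
    scale : ∀ {c d} → 0ℚ ℚ.≤ c → ℚ.∣ c ℚ.* d ∣ ≡ c ℚ.* ℚ.∣ d ∣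
    scale {c} {d} 0≤c = trans (ℚ.∣p*q∣≡∣p∣*∣q∣ c d) (cong (ℚ._* ℚ.∣ d ∣) (ℚ.0≤p⇒∣p∣≡p 0≤c))
    difference : ∀ {a b} → a ℚ.≤ B → 0ℚ ℚ.≤ b → a ℚ.- b ℚ.≤ B
    difference {a} {b} a≤B 0≤b = ℚ.≤-trans (ℚ.+-mono-≤ a≤B (ℚ.neg-antimono-≤ 0≤b)) (ℚ.≤-reflexive (ℚ.+-identityʳ B))
    spread : ℚ.∣ b₁ ℚ.- b₀ ∣ ℚ.≤ B
    spread = let 0≤b₁ , b₁≤B = E-bounds v xs h (σ [ x ↦ true ])
                 0≤b₀ , b₀≤B = E-bounds v xs h (σ [ x ↦ false ])
             in ∣∣≤ (difference b₁≤B 0≤b₀)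
                    (subst (ℚ._≤ B) (solve 2 (λ a b → a :- b := :- (b :- a)) refl b₀ b₁) (difference b₀≤B 0≤b₁))

  record Observable : Set where
    field
      value   : Config → ℕ
      support : List V
      local   : ∀ {σ τ} → (∀ {y} → y ∈ support → σ y ≡ τ y) → value σ ≡ value τ

  open Observable public

  infixl 6 _⊕_
  _⊕_ : Observable → Observable → Observable
  X ⊕ Y = record
    { value   = λ σ → value X σ ℕ.+ value Y σ
    ; support = support X ++ support Y
    ; local   = λ eq → cong₂ ℕ._+_ (local X (eq ∘ ∈-++⁺ˡ)) (local Y (eq ∘ ∈-++⁺ʳ (support X)))
    }

  constant : ℕ → Observable
  constant n = record { value = λ _ → n ; support = [] ; local = λ _ → refl }

  opaque

    𝔼 : ℚ → Observable → ℚ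
    -- The all-closed configuration is an arbitrary default: every site that can affect the value is
    -- averaged over.
    𝔼 p X = E p (support X) (ι ∘ value X) (λ _ → false)

    -- Brings observables with different supports onto a common list of sites; linearity and
    -- monotonicity of the mean are then those of `E`.
    𝔼-over : ∀ p X {xs} σ → (∀ {y} → y ∈ support X → y ∈ xs) → 𝔼 p X ≡ E p xs (ι ∘ value X) σ
    𝔼-over p X {xs} σ ⊆xs =
      E-independent p (support X) xs (λ eq → cong ι (local X eq)) (λ eq → cong ι (local X (eq ∘ ⊆xs))) _ σ

  𝔼-constant : ∀ p n → 𝔼 p (constant n) ≡ ι n
  𝔼-constant p n = 𝔼-over p (constant n) {[]} (λ _ → false) (λ i → i)

  𝔼-mono : ∀ {p} → Unit p → ∀ X Y → (∀ σ → value X σ ℕ.≤ value Y σ) → 𝔼 p X ℚ.≤ 𝔼 p Y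
  𝔼-mono {p} u X Y h = begin
    𝔼 p X                                                   ≡⟨ 𝔼-over p X (λ _ → false) ∈-++⁺ˡ ⟩
    E p (support X ++ support Y) (ι ∘ value X) (λ _ → false) ≤⟨ E-mono u (support X ++ support Y) (λ σ → ι-mono (h σ)) _ ⟩
    E p (support X ++ support Y) (ι ∘ value Y) (λ _ → false) ≡⟨ 𝔼-over p Y (λ _ → false) (∈-++⁺ʳ (support X)) ⟨
    𝔼 p Y                                                   ∎
    where open ℚ.≤-Reasoning

  𝔼-⊕ : ∀ p X Y → 𝔼 p (X ⊕ Y) ≡ 𝔼 p X ℚ.+ 𝔼 p Y
  𝔼-⊕ p X Y = begin
    𝔼 p (X ⊕ Y)
      ≡⟨ 𝔼-over p (X ⊕ Y) (λ _ → false) (λ i → i) ⟩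
    E p S (λ σ → ι (value X σ ℕ.+ value Y σ)) (λ _ → false)
      ≡⟨ E-cong p S (λ σ → ι-+ (value X σ) (value Y σ)) _ ⟩
    E p S (λ σ → ι (value X σ) ℚ.+ ι (value Y σ)) (λ _ → false)
      ≡⟨ E-+ p S (ι ∘ value X) (ι ∘ value Y) _ ⟩
    E p S (ι ∘ value X) (λ _ → false) ℚ.+ E p S (ι ∘ value Y) (λ _ → false)
      ≡⟨ cong₂ ℚ._+_ (𝔼-over p X _ ∈-++⁺ˡ) (𝔼-over p Y _ (∈-++⁺ʳ (support X))) ⟨
    𝔼 p X ℚ.+ 𝔼 p Y ∎
    where
    open ≡-Reasoning
    S = support X ++ support Y

  𝔼-≤-⊕ : ∀ {p} → Unit p → ∀ X Y Z → (∀ σ → value X σ ℕ.≤ value Y σ ℕ.+ value Z σ) → 𝔼 p X ℚ.≤ 𝔼 p Y ℚ.+ 𝔼 p Z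
  𝔼-≤-⊕ u X Y Z h = ℚ.≤-trans (𝔼-mono u X (Y ⊕ Z) h) (ℚ.≤-reflexive (𝔼-⊕ _ Y Z))

  ⨁ : {I : Set} → List I → (I → Observable) → Observable
  ⨁ is X = foldr (λ i Y → X i ⊕ Y) (constant 0) is

  𝔼-cong : ∀ p X Y → (∀ σ → value X σ ≡ value Y σ) → 𝔼 p X ≡ 𝔼 p Y
  𝔼-cong p X Y h = begin
    𝔼 p X                                  ≡⟨ 𝔼-over p X (λ _ → false) ∈-++⁺ˡ ⟩
    E p S (ι ∘ value X) (λ _ → false)      ≡⟨ E-cong p S (λ σ → cong ι (h σ)) _ ⟩
    E p S (ι ∘ value Y) (λ _ → false)      ≡⟨ 𝔼-over p Y (λ _ → false) (∈-++⁺ʳ (support X)) ⟨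
    𝔼 p Y                                  ∎
    where
    open ≡-Reasoning
    S = support X ++ support Y

  𝔼-⨁ : ∀ {I : Set} p (is : List I) X {c} → (∀ {i} → i ∈ is → 𝔼 p (X i) ≡ c) → 𝔼 p (⨁ is X) ≡ ι (length is) ℚ.* c
  𝔼-⨁ p []       X {c} h = trans (𝔼-constant p 0) (sym (ℚ.*-zeroˡ c))
  𝔼-⨁ p (i ∷ is) X {c} h = begin
    𝔼 p (X i ⊕ ⨁ is X)                ≡⟨ 𝔼-⊕ p (X i) (⨁ is X) ⟩
    𝔼 p (X i) ℚ.+ 𝔼 p (⨁ is X)        ≡⟨ cong₂ ℚ._+_ (h first) (𝔼-⨁ p is X (h ∘ there)) ⟩
    c ℚ.+ ι (length is) ℚ.* c         ≡⟨ cong (ℚ._+ ι (length is) ℚ.* c) (ℚ.*-identityˡ c) ⟨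
    1ℚ ℚ.* c ℚ.+ ι (length is) ℚ.* c  ≡⟨ ℚ.*-distribʳ-+ c 1ℚ (ι (length is)) ⟨
    (1ℚ ℚ.+ ι (length is)) ℚ.* c      ≡⟨ cong (ℚ._* c) (ι-+ 1 (length is)) ⟨
    ι (length (i ∷ is)) ℚ.* c         ∎
    where open ≡-Reasoning

  ⨁-++ : ∀ {I : Set} (is js : List I) X σ → value (⨁ (is ++ js) X) σ ≡ value (⨁ is X) σ ℕ.+ value (⨁ js X) σ
  ⨁-++ []       js X σ = refl
  ⨁-++ (i ∷ is) js X σ = trans (cong (value (X i) σ ℕ.+_) (⨁-++ is js X σ)) (sym (ℕ.+-assoc (value (X i) σ) _ _))

  -- Cylinder events and their probabilities

  Cylinder : Set
  Cylinder = List (V × Bool)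

  indicator : Bool → Bool → ℕ
  indicator true  true  = 1
  indicator false false = 1
  indicator _     _     = 0

  cyl : Cylinder → Observable
  cyl []             = constant 1
  cyl ((x , b) ∷ ks) = record
    { value   = λ σ → indicator b (σ x) ℕ.* value (cyl ks) σ
    ; support = x ∷ support (cyl ks)
    ; local   = λ eq → cong₂ ℕ._*_ (cong (indicator b) (eq first)) (local (cyl ks) (eq ∘ there))
    }

  sites : Cylinder → List V
  sites = map proj₁

  cyl-sites : ∀ ks → support (cyl ks) ≡ sites ks
  cyl-sites []       = refl
  cyl-sites (k ∷ ks) = cong (proj₁ k ∷_) (cyl-sites ks)

  prob : ℚ → Cylinder → ℚ
  prob p []             = 1ℚ
  prob p ((x , b) ∷ ks) = weight p b ℚ.* prob p ks

  -- Distinct sites are independent: the factor at the first site is frozen while the others are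
  -- averaged (`E-fix`), and comes out as a constant.
  𝔼-cyl : ∀ p ks → Unique (sites ks) → 𝔼 p (cyl ks) ≡ prob p ks
  𝔼-cyl p ks u = trans (𝔼-over p (cyl ks) (λ _ → false) (λ i → i)) (go ks u (λ _ → false))
    where
    open ≡-Reasoning
    single : ∀ b → avg p (ι (indicator b true)) (ι (indicator b false)) ≡ weight p b
    single true  = solve 1 (λ p → p :* con 1ℚ :+ (con 1ℚ :- p) :* con 0ℚ := p) refl p
    single false = solve 1 (λ p → p :* con 0ℚ :+ (con 1ℚ :- p) :* con 1ℚ := con 1ℚ :- p) refl p
    go : ∀ ks → Unique (sites ks) → ∀ σ → E p (support (cyl ks)) (ι ∘ value (cyl ks)) σ ≡ prob p ks
    go []             u       σ = refl
    go ((x , b) ∷ ks) (n ∷ u) σ₀ = begin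
      avg p (side true) (side false)
        ≡⟨ cong₂ (avg p) (at true) (at false) ⟩
      avg p (P ℚ.* ι (indicator b true)) (P ℚ.* ι (indicator b false))
        ≡⟨ avg-* p P _ _ ⟩
      P ℚ.* avg p (ι (indicator b true)) (ι (indicator b false))
        ≡⟨ cong (P ℚ.*_) (single b) ⟩
      P ℚ.* weight p b
        ≡⟨ ℚ.*-comm P (weight p b) ⟩
      weight p b ℚ.* P ∎
      where
      P = prob p ks
      S = support (cyl ks)
      x∉ : x ∉ S
      x∉ i = All.lookup n (subst (x ∈_) (cyl-sites ks) i) refl
      side : Bool → ℚ
      side c = E p S (λ σ → ι (indicator b (σ x) ℕ.* value (cyl ks) σ)) (σ₀ [ x ↦ c ])
      at : ∀ c → side c ≡ P ℚ.* ι (indicator b c)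
      at c = begin
        side c
          ≡⟨ E-cong p S (λ σ → ι-* (indicator b (σ x)) (value (cyl ks) σ)) _ ⟩
        E p S (λ σ → ι (indicator b (σ x)) ℚ.* ι (value (cyl ks) σ)) (σ₀ [ x ↦ c ])
          ≡⟨ E-fix p S x (λ d σ → ι (indicator b d) ℚ.* ι (value (cyl ks) σ)) _ x∉ ⟩
        E p S (λ σ → ι (indicator b ((σ₀ [ x ↦ c ]) x)) ℚ.* ι (value (cyl ks) σ)) (σ₀ [ x ↦ c ])
          ≡⟨ E-* p S (ι (indicator b ((σ₀ [ x ↦ c ]) x))) (ι ∘ value (cyl ks)) _ ⟩
        ι (indicator b ((σ₀ [ x ↦ c ]) x)) ℚ.* E p S (ι ∘ value (cyl ks)) (σ₀ [ x ↦ c ])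
          ≡⟨ cong₂ ℚ._*_ (cong (λ d → ι (indicator b d)) (update-at σ₀ x c)) (go ks u _) ⟩
        ι (indicator b c) ℚ.* P
          ≡⟨ ℚ.*-comm (ι (indicator b c)) P ⟩
        P ℚ.* ι (indicator b c) ∎

  cyl-cases : ∀ ks σ → value (cyl ks) σ ≡ 0 ⊎ (value (cyl ks) σ ≡ 1 × All (λ (x , b) → σ x ≡ b) ks)
  cyl-cases []             σ = inj₂ (refl , [])
  cyl-cases ((x , b) ∷ ks) σ with b | σ x in eq | cyl-cases ks σ
  ... | true  | true  | inj₁ e       = inj₁ (trans (ℕ.+-identityʳ _) e)
  ... | true  | true  | inj₂ (e , a) = inj₂ (trans (ℕ.+-identityʳ _) e , eq ∷ a)
  ... | false | false | inj₁ e       = inj₁ (trans (ℕ.+-identityʳ _) e)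
  ... | false | false | inj₂ (e , a) = inj₂ (trans (ℕ.+-identityʳ _) e , eq ∷ a)
  ... | true  | false | _            = inj₁ refl
  ... | false | true  | _            = inj₁ refl

  cyl-true : ∀ ks σ → All (λ (x , b) → σ x ≡ b) ks → value (cyl ks) σ ≡ 1
  cyl-true []                 σ []      = refl
  cyl-true ((x , true) ∷ ks)  σ (e ∷ a) rewrite e = trans (ℕ.+-identityʳ _) (cyl-true ks σ a)
  cyl-true ((x , false) ∷ ks) σ (e ∷ a) rewrite e = trans (ℕ.+-identityʳ _) (cyl-true ks σ a)

module Transport {V W : Set} (_≟V_ : DecidableEquality V) (_≟W_ : DecidableEquality W)
                 (τ : V → W) (τ-inj : ∀ {x y} → τ x ≡ τ y → x ≡ y) where

  private
    module V = Expectation _≟V_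
    module W = Expectation _≟W_

  update-∘ : ∀ σ x b y → W._[_↦_] σ (τ x) b (τ y) ≡ V._[_↦_] (σ ∘ τ) x b y
  update-∘ σ x b y with y ≟V x | τ y ≟W τ x
  ... | yes _ | yes _ = refl
  ... | no  _ | no  _ = refl
  ... | yes e | no  n = contradiction (cong τ e) n
  ... | no  n | yes e = contradiction (τ-inj e) n

  E-map : ∀ p xs {X Y} → V.Ext Y → (∀ σ → X σ ≡ Y (σ ∘ τ)) → ∀ σ → W.E p (map τ xs) X σ ≡ V.E p xs Y (σ ∘ τ)
  E-map p []       ext h σ = h σ
  E-map p (x ∷ xs) ext h σ = cong₂ (avg p) (go true) (go false)
    where
    go : ∀ b → W.E p (map τ xs) _ (W._[_↦_] σ (τ x) b) ≡ V.E p xs _ (V._[_↦_] (σ ∘ τ) x b)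
    go b = trans (E-map p xs ext h _) (V.E-ext p xs ext (update-∘ σ x b))

  -- `X` depends only on sites in the image of `τ`, so its support can be replaced by the image of
  -- that of `Y`; by injectivity an update at `τ x` is an update at `x` after pulling back.
  𝔼-map : ∀ p (X : W.Observable) (Y : V.Observable) →
          (∀ σ → W.value X σ ≡ V.value Y (σ ∘ τ)) → W.𝔼 p X ≡ V.𝔼 p Y
  𝔼-map p X Y h = begin
    W.𝔼 p X
      ≡⟨ W.𝔼-over p X (λ _ → false) (λ i → i) ⟩
    W.E p (W.support X) (ι ∘ W.value X) (λ _ → false)
      ≡⟨ W.E-independent p (W.support X) (map τ (V.support Y)) (λ eq → cong ι (W.local X eq))
           (λ {σ} {ρ} eq → cong ι (trans (h σ) (trans (V.local Y (eq ∘ ∈-map⁺ τ)) (sym (h ρ))))) _ (λ _ → false) ⟩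
    W.E p (map τ (V.support Y)) (ι ∘ W.value X) (λ _ → false)
      ≡⟨ E-map p (V.support Y) (λ eq → cong ι (V.local Y (λ {y} _ → eq y))) (λ σ → cong ι (h σ)) _ ⟩
    V.E p (V.support Y) (ι ∘ V.value Y) (λ _ → false)
      ≡⟨ V.𝔼-over p Y (λ _ → false) (λ i → i) ⟨
    V.𝔼 p Y ∎
    where open ≡-Reasoning

-- Rank of the open edges

module Percolation {V : Set} (_≟_ : DecidableEquality V) where

  open Rank _≟_ public
  open Expectation _≟_ public

  -- A closed edge is turned into a loop, which does not affect the rank.
  openEdge : Config → Edge → Edge
  openEdge σ (u , v) = u , (if σ u ∧ σ v then v else u)

  opaque

    open′ : Config → List Edge → List Edge
    open′ σ = map (openEdge σ)

  bothOpen : Edge → Observable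
  bothOpen (u , v) = cyl ((u , true) ∷ (v , true) ∷ [])

  opaque
    unfolding open′

    open-∈ : ∀ σ {E x y} → (x , y) ∈ open′ σ E → x ≡ y ⊎ ((x , y) ∈ E × σ x ≡ true × σ y ≡ true)
    open-∈ σ {(u , v) ∷ E} (there i) with open-∈ σ i
    ... | inj₁ e       = inj₁ e
    ... | inj₂ (j , e) = inj₂ (there j , e)
    open-∈ σ {(u , v) ∷ E} (here e) with σ u in eu | σ v in ev
    open-∈ σ {(u , v) ∷ E} first | true  | true  = inj₂ (here refl , eu , ev)
    open-∈ σ {(u , v) ∷ E} first | true  | false = inj₁ refl
    open-∈ σ {(u , v) ∷ E} first | false | _     = inj₁ refl

    ∈-open : ∀ σ {E u v} → (u , v) ∈ E → σ u ≡ true → σ v ≡ true → (u , v) ∈ open′ σ E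
    ∈-open σ {(u , v) ∷ E} first eu ev rewrite eu | ev = first
    ∈-open σ (there i) eu ev = there (∈-open σ i eu ev)

  opaque
    unfolding open′

    open-ends : ∀ σ {E} {P : V → Set} → (∀ {u v} → (u , v) ∈ E → P u × P v) →
                ∀ {x y} → (x , y) ∈ open′ σ E → P x × P y
    open-ends σ {(u , v) ∷ E} h (there i) = open-ends σ (λ j → h (there j)) i
    open-ends σ {(u , v) ∷ E} h (here e) with σ u ∧ σ v
    open-ends σ {(u , v) ∷ E} h first | true  = h first
    open-ends σ {(u , v) ∷ E} h first | false = proj₁ (h first) , proj₁ (h first)

  open-conn : ∀ σ E {u v} → (u , v) ∈ E → σ u ≡ true → σ v ≡ true → Conn (open′ σ E) u v
  open-conn σ E i eu ev = conn-∈ (∈-open σ i eu ev)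

  open-cut : ∀ σ (Q : V → Set) E →
             (∀ {u v} → (u , v) ∈ E → σ u ≡ true → σ v ≡ true → (Q u → Q v) × (Q v → Q u)) →
             ∀ {x y} → Conn (open′ σ E) x y → Q x → Q y
  open-cut σ Q E h = conn-cut Q (open′ σ E) edge
    where
    edge : ∀ {u v} → (u , v) ∈ open′ σ E → (Q u → Q v) × (Q v → Q u)
    edge i with open-∈ σ i
    ... | inj₁ refl          = (λ q → q) , (λ q → q)
    ... | inj₂ (j , eu , ev) = h j eu ev

  untouched : ∀ σ s E → (∀ {u v} → (u , v) ∈ E → σ u ≡ true → σ v ≡ true → u ≢ s × v ≢ s) →
              ∀ {y} → Conn (open′ σ E) s y → y ≡ s
  untouched σ s E h c = open-cut σ (_≡ s) E
    (λ i eu ev → let nu , nv = h i eu ev in (λ q → contradiction q nu) , (λ q → contradiction q nv)) c refl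

  opaque
    unfolding open′

    -- `n` makes up for the rank that is missing when the open edge closes a cycle. A closed edge
    -- contributes 0 on the left and, being a loop, nothing to the rank.
    rank-lower : ∀ σ u v E n → (σ u ≡ true → σ v ≡ true → Conn (open′ σ E) u v → 1 ℕ.≤ n) →
      value (bothOpen (u , v)) σ ℕ.+ rank (open′ σ E) ℕ.≤ n ℕ.+ rank (open′ σ ((u , v) ∷ E))
    rank-lower σ u v E n h with σ u | σ v
    ... | true  | true  = step-≤ {u} {v} {open′ σ E} (h refl refl)
    ... | true  | false = ℕ.≤-trans (rank-≤-++ ((u , u) ∷ []) (open′ σ E)) (ℕ.m≤n+m _ n)
    ... | false | _     = ℕ.≤-trans (rank-≤-++ ((u , u) ∷ []) (open′ σ E)) (ℕ.m≤n+m _ n)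

    -- The converse account: `n` may be 1 only with a witness that the edge is open and its ends are
    -- already connected, and then adding it leaves the rank unchanged.
    rank-upper : ∀ σ u v E n → n ≡ 0 ⊎ (n ≡ 1 × σ u ≡ true × σ v ≡ true × Conn (open′ σ E) u v) →
      n ℕ.+ rank (open′ σ ((u , v) ∷ E)) ℕ.≤ value (bothOpen (u , v)) σ ℕ.+ rank (open′ σ E)
    rank-upper σ u v E n (inj₁ refl) with σ u | σ v
    ... | true  | true  = rank-∷≤ (u , v) (open′ σ E)
    ... | true  | false = ℕ.≤-reflexive (rank-∷-conn {u} {u} {open′ σ E} (conn refl))
    ... | false | _     = ℕ.≤-reflexive (rank-∷-conn {u} {u} {open′ σ E} (conn refl))
    rank-upper σ u v E n (inj₂ (refl , eu , ev , c)) rewrite eu | ev =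
      s≤s (ℕ.≤-reflexive (rank-∷-conn {u} {v} {open′ σ E} c))

  opaque
    unfolding open′

    open-++ : ∀ σ E F → open′ σ (E ++ F) ≡ open′ σ E ++ open′ σ F
    open-++ σ = List.map-++ (openEdge σ)

    open-↭ : ∀ σ {E F} → E ↭ F → open′ σ E ↭ open′ σ F
    open-↭ σ = map⁺ (openEdge σ)

    length-open : ∀ σ E → length (open′ σ E) ≡ length E
    length-open σ = List.length-map (openEdge σ)

  endpoints : List Edge → List V
  endpoints = concatMap (λ (u , v) → u ∷ v ∷ [])

  opaque
    unfolding open′

    open-local : ∀ {σ τ} E → (∀ {y} → y ∈ endpoints E → σ y ≡ τ y) → open′ σ E ≡ open′ τ E
    open-local []            eq = refl
    open-local ((u , v) ∷ E) eq = cong₂ _∷_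
      (cong₂ (λ a b → u , (if a ∧ b then v else u)) (eq first) (eq second))
      (open-local E (λ i → eq (there (there i))))

  openRank : List Edge → Observable
  openRank E = record
    { value   = λ σ → rank (open′ σ E)
    ; support = endpoints E
    ; local   = λ eq → cong rank (open-local E eq)
    }

  openRank-≤ : ∀ {E} A B → E ↭ A ++ B → ∀ σ →
    value (openRank E) σ ℕ.≤ value (openRank A) σ ℕ.+ value (openRank B) σ
  openRank-≤ A B E↭ σ = ℕ.≤-trans
    (ℕ.≤-reflexive (trans (rank-↭ (open-↭ σ E↭)) (cong rank (open-++ σ A B))))
    (rank-++-≤ (open′ σ A) (open′ σ B))

  -- Either orientation is accepted because the sides of hexagons and the edges of cells may run in
  -- opposite directions.
  openRank-mono : ∀ E F → (∀ {x y} → (x , y) ∈ E → (x , y) ∈ F ⊎ (y , x) ∈ F) → ∀ σ →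
    value (openRank E) σ ℕ.≤ value (openRank F) σ
  openRank-mono E F h σ = rank-mono (open′ σ E) (open′ σ F) joined
    where
    joined : ∀ {x y} → (x , y) ∈ open′ σ E → Conn (open′ σ F) x y
    joined i with open-∈ σ i
    ... | inj₁ refl = conn refl
    ... | inj₂ (j , ex , ey) with h j
    ... | inj₁ k = open-conn σ F k ex ey
    ... | inj₂ k = conn-sym (open-conn σ F k ey ex)

  -- `G` holds the edges of the gap. Omitting them can only lower the rank, and what remains is
  -- split by `Q` into two parts without common vertices.
  openRank-gap : (Q : V → Set) → (∀ x → Dec (Q x)) → ∀ {E} G A B → E ↭ G ++ (A ++ B) →
    (∀ {u v} → (u , v) ∈ A → Q u × Q v) → (∀ {u v} → (u , v) ∈ B → ¬ Q u × ¬ Q v) → ∀ σ →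
    value (openRank A) σ ℕ.+ value (openRank B) σ ℕ.≤ value (openRank E) σ
  openRank-gap Q Q? {E} G A B E↭ hA hB σ = begin
    rank (open′ σ A) ℕ.+ rank (open′ σ B)
      ≤⟨ rank-disjoint Q Q? (open′ σ A) (open′ σ B) (open-ends σ hA) (open-ends σ hB) ⟩
    rank (open′ σ A ++ open′ σ B)
      ≡⟨ cong rank (open-++ σ A B) ⟨
    rank (open′ σ (A ++ B))
      ≤⟨ rank-≤-++ (open′ σ G) (open′ σ (A ++ B)) ⟩
    rank (open′ σ G ++ open′ σ (A ++ B))
      ≡⟨ cong rank (open-++ σ G (A ++ B)) ⟨
    rank (open′ σ (G ++ (A ++ B)))
      ≡⟨ rank-↭ (open-↭ σ E↭) ⟨
    rank (open′ σ E) ∎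
    where
    open ℕ.≤-Reasoning

  openRank-≤-length : ∀ E σ → value (openRank E) σ ℕ.≤ length E
  openRank-≤-length E σ = ℕ.≤-trans (rank≤length (open′ σ E)) (ℕ.≤-reflexive (length-open σ E))

module PercolationMap {V W : Set} (_≟V_ : DecidableEquality V) (_≟W_ : DecidableEquality W)
                      (τ : V → W) (τ-inj : ∀ {x y} → τ x ≡ τ y → x ≡ y) where

  private
    module V = Percolation _≟V_
    module W = Percolation _≟W_

  open RankMap _≟V_ _≟W_ τ τ-inj public
  open Transport _≟V_ _≟W_ τ τ-inj public

  opaque
    unfolding V.open′ W.open′

    open-map : ∀ σ E → W.open′ σ (map τ² E) ≡ map τ² (V.open′ (σ ∘ τ) E)
    open-map σ []            = refl
    open-map σ ((u , v) ∷ E) = cong₂ _∷_ (cong (τ u ,_) (target (σ (τ u) ∧ σ (τ v)))) (open-map σ E)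
      where
      target : ∀ b → (if b then τ v else τ u) ≡ τ (if b then v else u)
      target true  = refl
      target false = refl

  openRank-map : ∀ E σ → W.value (W.openRank (map τ² E)) σ ≡ V.value (V.openRank E) (σ ∘ τ)
  openRank-map E σ = trans (cong W.rank (open-map σ E)) (rank-map (V.open′ (σ ∘ τ) E))

  𝔼-openRank-map : ∀ p E → W.𝔼 p (W.openRank (map τ² E)) ≡ V.𝔼 p (V.openRank E)
  𝔼-openRank-map p E = 𝔼-map p (W.openRank (map τ² E)) (V.openRank E) (openRank-map E)

-- Components of the open subgraph

unique-⊆ : ∀ {I : Set} {xs ys : List I} → Unique xs → (∀ {x} → x ∈ xs → x ∈ ys) → length xs ℕ.≤ length ys
unique-⊆ {xs = []}     u       h = z≤n
unique-⊆ {xs = x ∷ xs} (n ∷ u) h with ∈-∃++ (h first)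
... | as , bs , refl = ℕ.≤-trans (s≤s (unique-⊆ u avoid))
    (ℕ.≤-reflexive (sym (trans (List.length-++ as) (trans (ℕ.+-suc (length as) (length bs)) (cong suc (sym (List.length-++ as)))))))
  where
  avoid : ∀ {y} → y ∈ xs → y ∈ as ++ bs
  avoid i with ∈-++⁻ as (h (there i))
  ... | inj₁ j            = ∈-++⁺ˡ j
  ... | inj₂ first  = contradiction refl (All.lookup n i)
  ... | inj₂ (there j)    = ∈-++⁺ʳ as j

lookup-injective : ∀ {I : Set} {xs : List I} → Unique xs → ∀ {i j} → lookup xs i ≡ lookup xs j → i ≡ j
lookup-injective {xs = x ∷ xs} (n ∷ u) {zero}  {zero}  e = refl
lookup-injective {xs = x ∷ xs} (n ∷ u) {zero}  {suc j} e = contradiction e (All.lookup n (∈-lookup j))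
lookup-injective {xs = x ∷ xs} (n ∷ u) {suc i} {zero}  e = contradiction (sym e) (All.lookup n (∈-lookup i))
lookup-injective {xs = x ∷ xs} (n ∷ u) {suc i} {suc j} e = cong suc (lookup-injective u e)

module Classes {V : Set} (_≟_ : DecidableEquality V) where

  open Rank _≟_

  remove : V → List V → List V
  remove a = filter (λ x → ¬? (x ≟ a))

  length-remove : ∀ {a L} → Unique L → a ∈ L → suc (length (remove a L)) ≡ length L
  length-remove {a} {x ∷ L} (n ∷ u) first = cong suc (cong length (trans
    (List.filter-reject (λ y → ¬? (y ≟ a)) {x} {L} (λ f → f refl))
    (List.filter-all (λ y → ¬? (y ≟ a)) (All.map (λ x≢ e → x≢ (sym e)) n))))
  length-remove {a} {x ∷ L} (n ∷ u) (there i) = cong suc (trans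
    (cong length (List.filter-accept (λ y → ¬? (y ≟ a)) {x} {L} (All.lookup n i)))
    (length-remove u i))

  -- The labels in use form a list with one element per class.
  Labels : List V → List Edge → List V → Set
  Labels zs E L = Unique L × length L ℕ.+ rank E ≡ length zs ×
                  (∀ {z} → z ∈ zs → rep E z ∈ L) × (∀ {x} → x ∈ L → ∃[ z ] z ∈ zs × rep E z ≡ x)

  labels : ∀ {zs} → Unique zs → ∀ E → (∀ {u v} → (u , v) ∈ E → u ≡ v ⊎ (u ∈ zs × v ∈ zs)) → ∃[ L ] Labels zs E L
  labels {zs} uz []            h = zs , uz , ℕ.+-identityʳ _ , (λ i → i) , λ {x} i → x , i , refl
  labels {zs} uz ((u , v) ∷ E) h with labels uz E (λ i → h (there i)) | rep E u ≟ rep E v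
  ... | L , uL , len , rep∈ , from | yes e =
    L , uL , len , (λ {z} i → subst (_∈ L) (sym (same z)) (rep∈ i)) ,
    λ i → let z , z∈ , q = from i in z , z∈ , trans (same z) q
    where
    same : ∀ z → rep ((u , v) ∷ E) z ≡ rep E z
    same z = trans (cong (λ b → merge (rep E u) b (rep E z)) (sym e)) (merge-self (rep E u) (rep E z))
  ... | L , uL , len , rep∈ , from | no n with h first
  ...   | inj₁ refl        = contradiction refl n
  ...   | inj₂ (u∈ , v∈) =
    remove (rep E u) L , Unique.filter⁺ (λ x → ¬? (x ≟ rep E u)) uL ,
    trans (ℕ.+-suc _ (rank E)) (trans (cong (ℕ._+ rank E) (length-remove uL (rep∈ u∈))) len) , rep′∈ , from′
    where
    rep′∈ : ∀ {z} → z ∈ zs → rep ((u , v) ∷ E) z ∈ remove (rep E u) L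
    rep′∈ {z} i with rep E z ≟ rep E u
    ... | yes _ = ∈-filter⁺ (λ x → ¬? (x ≟ rep E u)) (rep∈ v∈) (λ e → n (sym e))
    ... | no  m = ∈-filter⁺ (λ x → ¬? (x ≟ rep E u)) (rep∈ i) m
    from′ : ∀ {x} → x ∈ remove (rep E u) L → ∃[ z ] z ∈ zs × rep ((u , v) ∷ E) z ≡ x
    from′ {x} i with ∈-filter⁻ (λ x → ¬? (x ≟ rep E u)) {xs = L} i
    ... | i∈ , x≢ with from i∈
    ... | z , z∈ , refl = z , z∈ , merge-other (rep E v) x≢

-- Vertices and edges of the hexagonal lattice

module Pt = Percolation _≟ₚ_

side⇒corner : ∀ h {x y} → (x , y) ∈ sides h → x ∈ corners h × y ∈ corners h
side⇒corner h first                                         = first , second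
side⇒corner h second                                 = second , third
side⇒corner h third                         = third , fourth
side⇒corner h fourth                 = fourth , fifth
side⇒corner h fifth         = fifth , sixth
side⇒corner h sixth = sixth , first

vertexList-unique : ∀ m → Unique (vertexList m)
vertexList-unique m = DecUniqueₚ.deduplicate-! _≟ₚ_ (concatMap corners (hexagons m))

corner⇒vertex : ∀ m {h x} → h ∈ hexagons m → x ∈ corners h → x ∈ vertexList m
corner⇒vertex m h∈ x∈ = ∈-deduplicate⁺ _≟ₚ_ (∈-concatMap⁺ corners (Any.map (λ { refl → x∈ }) h∈))

vertex⇒corner : ∀ m {x} → x ∈ vertexList m → ∃[ h ] h ∈ hexagons m × x ∈ corners h
vertex⇒corner m x∈ = find (∈-concatMap⁻ corners {xs = hexagons m} (∈-deduplicate⁻ _≟ₚ_ (concatMap corners (hexagons m)) x∈))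

side⇒edge : ∀ m {h e} → h ∈ hexagons m → e ∈ sides h → e ∈ edgeList m
side⇒edge m h∈ e∈ = ∈-concatMap⁺ sides (Any.map (λ { refl → e∈ }) h∈)

edge⇒side : ∀ m {e} → e ∈ edgeList m → ∃[ h ] h ∈ hexagons m × e ∈ sides h
edge⇒side m e∈ = find (∈-concatMap⁻ sides {xs = hexagons m} e∈)

edge⇒vertex : ∀ m {x y} → (x , y) ∈ edgeList m → x ∈ vertexList m × y ∈ vertexList m
edge⇒vertex m e∈ = let h , h∈ , s∈ = edge⇒side m e∈ ; x∈ , y∈ = side⇒corner h s∈
                   in corner⇒vertex m h∈ x∈ , corner⇒vertex m h∈ y∈

subset : ∀ {I : Set} (xs : List I) → (I → Bool) → Subset (length xs)
subset xs σ = tabulate (λ i → σ (lookup xs i))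

module Components (m : ℕ) (σ : Pt.Config) where

  open Rank _≟ₚ_
  open Classes _≟ₚ_

  private
    G  = hexagonalLattice m
    xs = vertexList m
    ω  = subset xs σ
    E  = Pt.open′ σ (edgeList m)

    point : Fin (order G) → Point
    point = lookup xs

    point-injective : ∀ {u v} → point u ≡ point v → u ≡ v
    point-injective = lookup-injective (vertexList-unique m)

    ∈ω⇒ : ∀ {u} → u ∈ˢ ω → σ (point u) ≡ true
    ∈ω⇒ {u} i = trans (sym (Vec.lookup∘tabulate (σ ∘ point) u)) (Vec.[]=⇒lookup i)

    ⇒∈ω : ∀ {u} → σ (point u) ≡ true → u ∈ˢ ω
    ⇒∈ω {u} e = Vec.lookup⇒[]= u ω (trans (Vec.lookup∘tabulate (σ ∘ point) u) e)

    indexOf : ∀ {x} → x ∈ xs → ∃[ u ] point u ≡ x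
    indexOf i = index i , sym (Any.lookup-index i)

    step : ∀ {u v} → InducedAdj G ω u v → Conn E (point u) (point v)
    step (u∈ , v∈ , inj₁ e) = Pt.open-conn σ (edgeList m) e (∈ω⇒ u∈) (∈ω⇒ v∈)
    step (u∈ , v∈ , inj₂ e) = conn-sym (Pt.open-conn σ (edgeList m) e (∈ω⇒ v∈) (∈ω⇒ u∈))

    connected⇒conn : ∀ {u v} → Connected G ω u v → Conn E (point u) (point v)
    connected⇒conn ε       = conn refl
    connected⇒conn (a ◅ s) = conn-trans (step a) (connected⇒conn s)

    Connected-sym : ∀ {u v} → Connected G ω u v → Connected G ω v u
    Connected-sym = Star.reverse λ { {u} {v} (u∈ , v∈ , a) → v∈ , u∈ , Sum.swap a }

    -- Connectedness of vertices carried over to points. The equality case makes the relation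
    -- reflexive also at points that are not vertices, as `conn-least` requires.
    _≈_ : Point → Point → Set
    x ≈ y = x ≡ y ⊎ ∃[ u ] ∃[ v ] point u ≡ x × point v ≡ y × Connected G ω u v

    ≈-sym : ∀ {x y} → x ≈ y → y ≈ x
    ≈-sym (inj₁ e)                   = inj₁ (sym e)
    ≈-sym (inj₂ (u , v , p , q , c)) = inj₂ (v , u , q , p , Connected-sym c)

    ≈-trans : ∀ {x y z} → x ≈ y → y ≈ z → x ≈ z
    ≈-trans (inj₁ refl) r = r
    ≈-trans r@(inj₂ _) (inj₁ refl) = r
    ≈-trans (inj₂ (u , v , p , q , c)) (inj₂ (u′ , v′ , p′ , q′ , c′)) =
      inj₂ (u , v′ , p , q′ , c ◅◅ subst (λ w → Connected G ω w v′) (point-injective (trans p′ (sym q))) c′)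

    edge≈ : ∀ {x y} → (x , y) ∈ E → x ≈ y
    edge≈ i with Pt.open-∈ σ i
    ... | inj₁ e = inj₁ e
    ... | inj₂ (j , ex , ey) with edge⇒vertex m j
    ... | x∈ , y∈ with indexOf x∈ | indexOf y∈
    ... | u , refl | v , refl = inj₂ (u , v , refl , refl , (⇒∈ω ex , ⇒∈ω ey , inj₁ j) ◅ ε)

    conn⇒connected : ∀ {u v} → Conn E (point u) (point v) → Connected G ω u v
    conn⇒connected {u} {v} c with conn-least _≈_ (inj₁ refl) ≈-sym ≈-trans E edge≈ c
    ... | inj₁ e = subst (Connected G ω u) (point-injective e) ε
    ... | inj₂ (u′ , v′ , p , q , s) = subst₂ (Connected G ω) (point-injective p) (point-injective q) s

    opens : List (Fin (order G))
    opens = filter (_∈? ω) (allFin (order G))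

    representatives : List (Fin (order G))
    representatives = deduplicate (connected? G ω) opens

    representatives⊆ : ∀ {u} → u ∈ representatives → u ∈ˢ ω
    representatives⊆ i = proj₂ (∈-filter⁻ (_∈? ω) {xs = allFin (order G)} (Any.deduplicate⁻ (connected? G ω) i))

    connectedness : DecSetoid _ _
    connectedness = record
      { Carrier = Fin (order G) ; _≈_ = Connected G ω
      ; isDecEquivalence = record { isEquivalence = record { refl = ε ; sym = Connected-sym ; trans = _◅◅_ }
                                  ; _≟_ = connected? G ω } }

    separated : AllPairs (λ u v → ¬ Connected G ω u v) representatives
    separated = DecSetoidUnique.deduplicate-! connectedness opens

    represented : ∀ {u} → u ∈ˢ ω → ∃[ v ] v ∈ representatives × Connected G ω u v
    represented {u} u∈ = find (Any.deduplicate⁺ (connected? G ω) {P = Connected G ω u}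
      (λ r s → s ◅◅ Connected-sym r) (Any.map (λ { refl → ε }) (∈-filter⁺ (_∈? ω) (∈-allFin u) u∈)))

    openPoints : List Point
    openPoints = filter (λ x → σ x Bool.≟ true) xs

    ∈openPoints : ∀ {x} → x ∈ xs → σ x ≡ true → x ∈ openPoints
    ∈openPoints = ∈-filter⁺ (λ x → σ x Bool.≟ true) {xs = xs}

    openPoints-unique : Unique openPoints
    openPoints-unique = Unique.filter⁺ (λ x → σ x Bool.≟ true) (vertexList-unique m)

    openEdge⇒openPoints : ∀ {x y} → (x , y) ∈ E → x ≡ y ⊎ (x ∈ openPoints × y ∈ openPoints)
    openEdge⇒openPoints i with Pt.open-∈ σ i
    ... | inj₁ e = inj₁ e
    ... | inj₂ (j , ex , ey) = let x∈ , y∈ = edge⇒vertex m j in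
      inj₂ (∈openPoints x∈ ex , ∈openPoints y∈ ey)

  -- The labels of the chosen representatives are exactly the labels in use: they are distinct
  -- because no two representatives are connected, and exhaustive because every open vertex is
  -- connected to one of them.
  components-rank : components G ω ℕ.+ rank E ≡ length (filter (λ x → σ x Bool.≟ true) (vertexList m))
  components-rank with labels openPoints-unique E openEdge⇒openPoints
  ... | L , uL , len , rep∈ , from = trans (cong (ℕ._+ rank E) count) len
    where
    names : List Point
    names = map (λ u → rep E (point u)) representatives
    names-unique : Unique names
    names-unique = AllPairs.map⁺ (AllPairs.map (λ ¬c e → ¬c (conn⇒connected (conn e))) separated)
    names⊆ : ∀ {x} → x ∈ names → x ∈ L
    names⊆ i with ∈-map⁻ (λ u → rep E (point u)) i
    ... | u , u∈ , refl = rep∈ (∈openPoints (∈-lookup u) (∈ω⇒ (representatives⊆ u∈)))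
    ⊆names : ∀ {x} → x ∈ L → x ∈ names
    ⊆names i with from i
    ... | z , z∈ , refl with ∈-filter⁻ (λ x → σ x Bool.≟ true) {xs = xs} z∈
    ... | z∈xs , e with indexOf z∈xs
    ... | u , refl with represented (⇒∈ω e)
    ... | v , v∈ , c = subst (_∈ names) (sym (rep≡ (connected⇒conn c))) (∈-map⁺ (λ u → rep E (point u)) v∈)
    count : components G ω ≡ length L
    count = trans (sym (List.length-map (λ u → rep E (point u)) representatives))
                  (ℕ.≤-antisym (unique-⊆ names-unique names⊆) (unique-⊆ uL ⊆names))

-- Expectations over the subsets of the vertices

sumℚ : List ℚ → ℚ
sumℚ = foldr ℚ._+_ 0ℚ

seq-sum : ∀ {I : Set} (f : I → ℝ) is n → seq (sum (map f is)) n ≡ sumℚ (map (λ i → seq (f i) n) is)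
seq-sum f []       n = refl
seq-sum f (i ∷ is) n = cong (seq (f i) n ℚ.+_) (seq-sum f is n)

sumℚ-++ : ∀ {I : Set} (f : I → ℚ) is js → sumℚ (map f (is ++ js)) ≡ sumℚ (map f is) ℚ.+ sumℚ (map f js)
sumℚ-++ f []       js = sym (ℚ.+-identityˡ _)
sumℚ-++ f (i ∷ is) js = trans (cong (f i ℚ.+_) (sumℚ-++ f is js)) (sym (ℚ.+-assoc (f i) _ _))

sumℚ-scale : ∀ {I K : Set} (c : ℚ) (g : I → K) (f : K → ℚ) (h : I → ℚ) → (∀ i → f (g i) ≡ c ℚ.* h i) → ∀ is →
             sumℚ (map f (map g is)) ≡ c ℚ.* sumℚ (map h is)
sumℚ-scale c g f h e []       = sym (ℚ.*-zeroʳ c)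
sumℚ-scale c g f h e (i ∷ is) = trans (cong₂ ℚ._+_ (e i) (sumℚ-scale c g f h e is)) (sym (ℚ.*-distribˡ-+ c (h i) _))

expectationAt : ∀ {k} → ℝ → ℕ → (Subset k → ℕ) → ℚ
expectationAt {k} p n X = sumℚ (map (λ ω → seq (probability p ω) n ℚ.* ι (X ω)) (subsets k))

seq-expectation : ∀ {k} p (X : Subset k → ℕ) n → seq (expectation p X) n ≡ expectationAt p n X
seq-expectation {k} p X n = seq-sum (λ ω → probability p ω * fromℕ (X ω)) (subsets k) n

expectationAt-suc : ∀ {k} p n (X : Subset (suc k) → ℕ) →
  expectationAt p n X ≡ avg (seq p n) (expectationAt p n (X ∘ (inside ∷_))) (expectationAt p n (X ∘ (outside ∷_)))
expectationAt-suc {k} p n X = trans (sumℚ-++ f (map (inside ∷_) (subsets k)) (map (outside ∷_) (subsets k)))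
  (cong₂ ℚ._+_
    (sumℚ-scale (seq p n) (inside ∷_) f _ (λ ω → ℚ.*-assoc (seq p n) (seq (probability p ω) n) _) (subsets k))
    (sumℚ-scale (1ℚ ℚ.- seq p n) (outside ∷_) f _ (λ ω → ℚ.*-assoc (1ℚ ℚ.- seq p n) (seq (probability p ω) n) _) (subsets k)))
  where
  f : Subset (suc k) → ℚ
  f ω = seq (probability p ω) n ℚ.* ι (X ω)

-- Both sides branch on the state of the first vertex. As the vertices are distinct, this state
-- survives the averaging over the others and can be moved into the subset.
E-subset : ∀ p n xs → Unique xs → ∀ (X : Subset (length xs) → ℕ) σ →
           Pt.E (seq p n) xs (λ σ → ι (X (subset xs σ))) σ ≡ expectationAt p n X
E-subset p n []       u       X σ = solve 1 (λ x → x := con 1ℚ :* x :+ con 0ℚ) refl (ι (X []))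
E-subset p n (x ∷ xs) (x∉ ∷ u) X σ = trans (cong₂ (avg (seq p n)) (go true) (go false)) (sym (expectationAt-suc p n X))
  where
  go : ∀ b → Pt.E (seq p n) xs (λ σ → ι (X (σ x ∷ subset xs σ))) (Pt._[_↦_] σ x b) ≡ expectationAt p n (X ∘ (b ∷_))
  go b = trans (Pt.E-fix (seq p n) xs x (λ c σ → ι (X (c ∷ subset xs σ))) _ (λ i → All.lookup x∉ i refl))
    (trans (cong (λ c → Pt.E (seq p n) xs (λ σ → ι (X (c ∷ subset xs σ))) (Pt._[_↦_] σ x b)) (Pt.update-at σ x b))
      (E-subset p n xs u (X ∘ (b ∷_)) _))

opaque

  count : ∀ m → Subset (length (vertexList m)) → ℕ
  count m = components (hexagonalLattice m)

  count-rank : ∀ m σ → count m (subset (vertexList m) σ) ℕ.+ Pt.rank (Pt.open′ σ (edgeList m)) ≡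
               length (filter (λ x → σ x Bool.≟ true) (vertexList m))
  count-rank = Components.components-rank

  seq-count : ∀ m p n → seq (𝔼[C] (hexagonalLattice m) p) n ≡ expectationAt p n (count m)
  seq-count m p n = seq-expectation p (components (hexagonalLattice m)) n

subset-local : ∀ {I : Set} (xs : List I) {σ τ : I → Bool} → (∀ {y} → y ∈ xs → σ y ≡ τ y) → subset xs σ ≡ subset xs τ
subset-local xs eq = Vec.tabulate-cong (λ i → eq (∈-lookup {xs = xs} i))

componentCount : ℕ → Pt.Observable
componentCount m = record
  { value   = λ σ → count m (subset (vertexList m) σ)
  ; support = vertexList m
  ; local   = λ eq → cong (count m) (subset-local (vertexList m) eq)
  }

edgeRank : ℕ → Pt.Observable
edgeRank m = Pt.openRank (edgeList m)

openCount : List Point → Pt.Observable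
openCount xs = Pt.⨁ xs (λ x → Pt.cyl ((x , true) ∷ []))

openCount-value : ∀ xs σ → Pt.value (openCount xs) σ ≡ length (filter (λ x → σ x Bool.≟ true) xs)
openCount-value []       σ = refl
openCount-value (x ∷ xs) σ with σ x
... | true  = cong suc (openCount-value xs σ)
... | false = openCount-value xs σ

meanComponents meanRank : ℕ → ℚ → ℚ
meanComponents m p = Pt.𝔼 p (componentCount m)
meanRank       m p = Pt.𝔼 p (edgeRank m)

seq-𝔼[C] : ∀ m p n → seq (𝔼[C] (hexagonalLattice m) p) n ≡ meanComponents m (seq p n)
seq-𝔼[C] m p n = begin
  seq (𝔼[C] (hexagonalLattice m) p) n
    ≡⟨ seq-count m p n ⟩
  expectationAt p n (count m)
    ≡⟨ E-subset p n (vertexList m) (vertexList-unique m) (count m) (λ _ → false) ⟨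
  Pt.E (seq p n) (vertexList m) (ι ∘ Pt.value (componentCount m)) (λ _ → false)
    ≡⟨ Pt.𝔼-over (seq p n) (componentCount m) (λ _ → false) (λ i → i) ⟨
  meanComponents m (seq p n) ∎
  where open ≡-Reasoning

meanComponents-rank : ∀ m p → meanComponents m p ℚ.+ meanRank m p ≡ ι (N m) ℚ.* p
meanComponents-rank m p = begin
  meanComponents m p ℚ.+ meanRank m p
    ≡⟨ Pt.𝔼-⊕ p (componentCount m) (edgeRank m) ⟨
  Pt.𝔼 p (componentCount m Pt.⊕ edgeRank m)
    ≡⟨ Pt.𝔼-cong p (componentCount m Pt.⊕ edgeRank m) (openCount (vertexList m))
         (λ σ → trans (count-rank m σ) (sym (openCount-value (vertexList m) σ))) ⟩
  Pt.𝔼 p (openCount (vertexList m))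
    ≡⟨ Pt.𝔼-⨁ p (vertexList m) (λ x → Pt.cyl ((x , true) ∷ [])) (λ _ → Pt.𝔼-cyl p _ ([] ∷ [])) ⟩
  ι (N m) ℚ.* (p ℚ.* 1ℚ)
    ≡⟨ cong (ι (N m) ℚ.*_) (ℚ.*-identityʳ p) ⟩
  ι (N m) ℚ.* p ∎
  where open ≡-Reasoning

meanComponents-lipschitz : ∀ m {p q} → Unit p → Unit q →
  ℚ.∣ meanComponents m p ℚ.- meanComponents m q ∣ ℚ.≤ ι (N m) ℚ.* (ι (N m) ℚ.* ℚ.∣ p ℚ.- q ∣)
meanComponents-lipschitz m {p} {q} u v = subst₂ (λ a b → ℚ.∣ a ℚ.- b ∣ ℚ.≤ ι (N m) ℚ.* (ι (N m) ℚ.* ℚ.∣ p ℚ.- q ∣))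
  (sym (Pt.𝔼-over p (componentCount m) (λ _ → false) (λ i → i)))
  (sym (Pt.𝔼-over q (componentCount m) (λ _ → false) (λ i → i)))
  (Pt.E-lipschitz u v (vertexList m) (λ σ → 0≤ι (Pt.value (componentCount m) σ) , ι-mono (bound σ)) (λ _ → false))
  where
  bound : ∀ σ → Pt.value (componentCount m) σ ℕ.≤ N m
  bound σ = ℕ.≤-trans (ℕ.m≤m+n _ _) (ℕ.≤-trans (ℕ.≤-reflexive (count-rank m σ))
    (List.length-filter (λ x → σ x Bool.≟ true) (vertexList m)))

-- Cells of the honeycomb lattice

Site : Set
Site = Fin 4 × ℕ × ℕ

-- The sites A J i, B J i, C J i, D J i stand for the points
-- (6J , 2i + 1), (6J + 1 , 2i), (6J + 3 , 2i + 2), (6J + 4 , 2i + 1).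
pattern A J i = zero , J , i
pattern B J i = suc zero , J , i
pattern C J i = suc (suc zero) , J , i
pattern D J i = suc (suc (suc zero)) , J , i

_≟ₛ_ : DecidableEquality Site
_≟ₛ_ = ≡-dec Fin._≟_ (≡-dec ℕ._≟_ ℕ._≟_)

open Percolation _≟ₛ_ public

Cell : Set
Cell = ℕ × ℕ

-- The order matters: `rank` builds a list from its end, so D-A is the first edge of the cell to be
-- added and A-B⁺ the last. With the later cells already present, only the third and the fourth
-- entry can then close a cycle.
edges : Cell → List Edge
edges (J , i) =
  (A J i , B J (suc i)) ∷ (A J i , B J i) ∷ (C J i , B J (suc i)) ∷
  (C J i , D J (suc i)) ∷ (C J i , D J i) ∷ (D J i , A (suc J) i) ∷ []

cellEdges : List Cell → List Edge
cellEdges = concatMap edges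

Later : Cell → Cell → Set
Later (J , i) (J′ , i′) = J ℕ.< J′ ⊎ (J ≡ J′ × i ℕ.< i′)

∈-cellEdges : ∀ {cs e} → e ∈ cellEdges cs → ∃[ c ] c ∈ cs × e ∈ edges c
∈-cellEdges {cs} i = find (∈-concatMap⁻ edges {xs = cs} i)

allOpen : List Site → Cylinder
allOpen = map (_, true)

-- Necessary conditions for the edge to close a cycle. One of its ends has a single way on, which is
-- followed for two steps; the other has two, and the state of the first of these separates the
-- events into disjoint ones, of probabilities `p⁵` and `(1 - p) p⁵`.
CD⁺-slack₁ CD⁺-slack₂ CB⁺-slack₁ CB⁺-slack₂ : Cell → Cylinder
CD⁺-slack₁ (J , i) = (A (suc J) (suc i) , true) ∷ allOpen (C J i ∷ D J i ∷ A (suc J) i ∷ D J (suc i) ∷ [])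
CD⁺-slack₂ (J , i) = (A (suc J) (suc i) , false) ∷ (C J (suc i) , true) ∷
                     allOpen (C J i ∷ D J i ∷ A (suc J) i ∷ D J (suc i) ∷ [])
CB⁺-slack₁ (J , i) = (D J i , true) ∷ allOpen (C J i ∷ B J (suc i) ∷ A J (suc i) ∷ B J (suc (suc i)) ∷ [])
CB⁺-slack₂ (J , i) = (D J i , false) ∷ (D J (suc i) , true) ∷
                     allOpen (C J i ∷ B J (suc i) ∷ A J (suc i) ∷ B J (suc (suc i)) ∷ [])

hexagon-CD⁺ hexagon-CB⁺ dodecagon-CD⁺ dodecagon-CB⁺ : Cell → Cylinder
hexagon-CD⁺ (J , i) = (A (suc J) (suc i) , true) ∷
  allOpen (C J i ∷ D J i ∷ A (suc J) i ∷ B (suc J) (suc i) ∷ D J (suc i) ∷ [])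
hexagon-CB⁺ (J , i) = (D J (suc i) , true) ∷
  allOpen (C J i ∷ C J (suc i) ∷ B J (suc (suc i)) ∷ A J (suc i) ∷ B J (suc i) ∷ [])
-- The boundary of the three hexagons around a closed site; the last of them
-- to be completed is the one of hexagon-CD⁺, respectively of hexagon-CB⁺.
dodecagon-CD⁺ (J , i) = (A (suc J) (suc i) , false) ∷ allOpen
  (C J i ∷ D J i ∷ A (suc J) i ∷ B (suc J) (suc i) ∷ C (suc J) i ∷ D (suc J) (suc i) ∷
   C (suc J) (suc i) ∷ B (suc J) (suc (suc i)) ∷ A (suc J) (suc (suc i)) ∷ D J (suc (suc i)) ∷
   C J (suc i) ∷ D J (suc i) ∷ [])
dodecagon-CB⁺ (J , i) = (D J (suc i) , false) ∷ allOpen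
  (C J i ∷ D J i ∷ A (suc J) i ∷ B (suc J) (suc i) ∷ A (suc J) (suc i) ∷ B (suc J) (suc (suc i)) ∷
   A (suc J) (suc (suc i)) ∷ D J (suc (suc i)) ∷ C J (suc i) ∷ B J (suc (suc i)) ∷ A J (suc i) ∷
   B J (suc i) ∷ [])

-- The summands follow the order of C-B⁺ and C-D⁺ in `edges`, with a final `constant 0`, so that the
-- sum of the six one-edge inequalities has these values by computation.
CD⁺-slack CB⁺-slack closings CD⁺-faces CB⁺-faces faces openEdges : Cell → Observable
CD⁺-slack c = cyl (CD⁺-slack₁ c) ⊕ cyl (CD⁺-slack₂ c)
CB⁺-slack c = cyl (CB⁺-slack₁ c) ⊕ cyl (CB⁺-slack₂ c)
closings  c = CB⁺-slack c ⊕ (CD⁺-slack c ⊕ constant 0)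
CD⁺-faces c = cyl (hexagon-CD⁺ c) ⊕ cyl (dodecagon-CD⁺ c)
CB⁺-faces c = cyl (hexagon-CB⁺ c) ⊕ cyl (dodecagon-CB⁺ c)
faces     c = CB⁺-faces c ⊕ (CD⁺-faces c ⊕ constant 0)
openEdges c = ⨁ (edges c) bothOpen

+-left-comm : ∀ a b c → a ℕ.+ (b ℕ.+ c) ≡ b ℕ.+ (a ℕ.+ c)
+-left-comm a b c = trans (sym (ℕ.+-assoc a b c)) (trans (cong (ℕ._+ c) (ℕ.+-comm a b)) (ℕ.+-assoc b a c))

-- Telescoping: the ranks are `r` before a stretch of edges, `r₁` after it and `r₂` after one step
-- more, with `e` and `S` the open edges and `n` and `M` the allowances of the step and of the
-- stretch.
chain-lower : ∀ {e r r₁ r₂ n S M} → e ℕ.+ r₁ ℕ.≤ n ℕ.+ r₂ → S ℕ.+ r ℕ.≤ M ℕ.+ r₁ →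
              e ℕ.+ S ℕ.+ r ℕ.≤ n ℕ.+ M ℕ.+ r₂
chain-lower {e} {r} {r₁} {r₂} {n} {S} {M} p q = begin
  e ℕ.+ S ℕ.+ r     ≡⟨ ℕ.+-assoc e S r ⟩
  e ℕ.+ (S ℕ.+ r)   ≤⟨ ℕ.+-monoʳ-≤ e q ⟩
  e ℕ.+ (M ℕ.+ r₁)  ≡⟨ +-left-comm e M r₁ ⟩
  M ℕ.+ (e ℕ.+ r₁)  ≤⟨ ℕ.+-monoʳ-≤ M p ⟩
  M ℕ.+ (n ℕ.+ r₂)  ≡⟨ +-left-comm M n r₂ ⟩
  n ℕ.+ (M ℕ.+ r₂)  ≡⟨ ℕ.+-assoc n M r₂ ⟨
  n ℕ.+ M ℕ.+ r₂    ∎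
  where open ℕ.≤-Reasoning

chain-upper : ∀ {e r r₁ r₂ n S M} → n ℕ.+ r₂ ℕ.≤ e ℕ.+ r₁ → M ℕ.+ r₁ ℕ.≤ S ℕ.+ r →
              n ℕ.+ M ℕ.+ r₂ ℕ.≤ e ℕ.+ S ℕ.+ r
chain-upper {e} {r} {r₁} {r₂} {n} {S} {M} p q = begin
  n ℕ.+ M ℕ.+ r₂    ≡⟨ ℕ.+-assoc n M r₂ ⟩
  n ℕ.+ (M ℕ.+ r₂)  ≡⟨ +-left-comm n M r₂ ⟩
  M ℕ.+ (n ℕ.+ r₂)  ≤⟨ ℕ.+-monoʳ-≤ M p ⟩
  M ℕ.+ (e ℕ.+ r₁)  ≡⟨ +-left-comm M e r₁ ⟩
  e ℕ.+ (M ℕ.+ r₁)  ≤⟨ ℕ.+-monoʳ-≤ e q ⟩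
  e ℕ.+ (S ℕ.+ r)   ≡⟨ ℕ.+-assoc e S r ⟨
  e ℕ.+ S ℕ.+ r     ∎
  where open ℕ.≤-Reasoning

-- The change of rank caused by one cell

module CellBound (σ : Config) (J i : ℕ) (rest : List Cell) (later : All (Later (J , i)) rest) where

  private
    ¬refl : ¬ Later (J , i) (J , i)
    ¬refl (inj₁ l)       = ℕ.<-irrefl refl l
    ¬refl (inj₂ (_ , l)) = ℕ.<-irrefl refl l

    ¬below : ∀ {i′} → suc i′ ≡ i → ¬ Later (J , i) (J , i′)
    ¬below refl (inj₁ l)       = ℕ.<-irrefl refl l
    ¬below refl (inj₂ (_ , l)) = ℕ.1+n≰n (ℕ.<⇒≤ l)

    ¬left : ∀ {J′ i′} → suc J′ ≡ J → ¬ Later (J , i) (J′ , i′)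
    ¬left refl (inj₁ l)          = ℕ.1+n≰n (ℕ.<⇒≤ l)
    ¬left refl (inj₂ (e , _))    = ℕ.1+n≢n e

    LaterEdge : Site → Site → Set
    LaterEdge u v = ∃[ c ] Later (J , i) c × (u , v) ∈ edges c

    isLater : ∀ {u v} → (u , v) ∈ cellEdges rest → LaterEdge u v
    isLater j = let c , c∈ , k = ∈-cellEdges j in c , All.lookup later c∈ , k

    -- The k-th edge of the cell is added to the k-th of these lists.
    E₁ E₂ E₃ E₄ E₅ E₆ : List Edge
    E₆ = cellEdges rest
    E₅ = (D J i , A (suc J) i) ∷ E₆
    E₄ = (C J i , D J i) ∷ E₅
    E₃ = (C J i , D J (suc i)) ∷ E₄
    E₂ = (C J i , B J (suc i)) ∷ E₃
    E₁ = (A J i , B J i) ∷ E₂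

    -- Every edge at one of the four sites of the cell belongs to the cell itself, to the cell below
    -- it or to the previous column, hence never to a later cell. The same reason serves B, C and D.
    fresh-A : ∀ {u v} → LaterEdge u v → u ≢ A J i × v ≢ A J i
    fresh-A (_ , l , first)                                 = (λ { refl → ¬refl l }) , λ ()
    fresh-A (_ , l , second)                         = (λ { refl → ¬refl l }) , λ ()
    fresh-A (_ , l , third)                 = (λ ()) , λ ()
    fresh-A (_ , l , fourth)         = (λ ()) , λ ()
    fresh-A (_ , l , fifth) = (λ ()) , λ ()
    fresh-A (_ , l , sixth) = (λ ()) , λ { refl → ¬left refl l }

    fresh-B : ∀ {u v} → LaterEdge u v → u ≢ B J i × v ≢ B J i
    fresh-B (_ , l , first)                                 = (λ ()) , λ { refl → ¬below refl l }
    fresh-B (_ , l , second)                         = (λ ()) , λ { refl → ¬refl l }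
    fresh-B (_ , l , third)                 = (λ ()) , λ { refl → ¬below refl l }
    fresh-B (_ , l , fourth)         = (λ ()) , λ ()
    fresh-B (_ , l , fifth) = (λ ()) , λ ()
    fresh-B (_ , l , sixth) = (λ ()) , λ ()

    fresh-C : ∀ {u v} → LaterEdge u v → u ≢ C J i × v ≢ C J i
    fresh-C (_ , l , first)                                 = (λ ()) , λ ()
    fresh-C (_ , l , second)                         = (λ ()) , λ ()
    fresh-C (_ , l , third)                 = (λ { refl → ¬refl l }) , λ ()
    fresh-C (_ , l , fourth)         = (λ { refl → ¬refl l }) , λ ()
    fresh-C (_ , l , fifth) = (λ { refl → ¬refl l }) , λ ()
    fresh-C (_ , l , sixth) = (λ ()) , λ ()

    fresh-D : ∀ {u v} → LaterEdge u v → u ≢ D J i × v ≢ D J i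
    fresh-D (_ , l , first)                                 = (λ ()) , λ ()
    fresh-D (_ , l , second)                         = (λ ()) , λ ()
    fresh-D (_ , l , third)                 = (λ ()) , λ ()
    fresh-D (_ , l , fourth)         = (λ ()) , λ { refl → ¬below refl l }
    fresh-D (_ , l , fifth) = (λ ()) , λ { refl → ¬refl l }
    fresh-D (_ , l , sixth) = (λ { refl → ¬refl l }) , λ ()

    clash : ∀ {b : Bool} → b ≡ true → b ≡ false → ⊥
    clash refl ()

    opened : ∀ {b : Bool} → (b ≡ false → ⊥) → b ≡ true
    opened {true}  _ = refl
    opened {false} h = ⊥-elim (h refl)

    at-D⁺ : ∀ {u v} → LaterEdge u v → σ u ≡ true → σ v ≡ true →
            σ (C J (suc i)) ≡ false → σ (A (suc J) (suc i)) ≡ false → u ≢ D J (suc i) × v ≢ D J (suc i)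
    at-D⁺ (_ , l , first)                                 eu ev nc na = (λ ()) , λ ()
    at-D⁺ (_ , l , second)                         eu ev nc na = (λ ()) , λ ()
    at-D⁺ (_ , l , third)                 eu ev nc na = (λ ()) , λ ()
    at-D⁺ (_ , l , fourth)         eu ev nc na = (λ ()) , λ { refl → ¬refl l }
    at-D⁺ (_ , l , fifth) eu ev nc na = (λ ()) , λ { refl → clash eu nc }
    at-D⁺ (_ , l , sixth) eu ev nc na = (λ { refl → clash ev na }) , λ ()

    at-B⁺ : ∀ {u v} → LaterEdge u v → u ≢ B J (suc i) × (v ≡ B J (suc i) → u ≡ A J (suc i))
    at-B⁺ (_ , l , first)                                 = (λ ()) , λ { refl → ⊥-elim (¬refl l) }
    at-B⁺ (_ , l , second)                         = (λ ()) , λ { refl → refl }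
    at-B⁺ (_ , l , third)                 = (λ ()) , λ { refl → ⊥-elim (¬refl l) }
    at-B⁺ (_ , l , fourth)         = (λ ()) , λ ()
    at-B⁺ (_ , l , fifth) = (λ ()) , λ ()
    at-B⁺ (_ , l , sixth) = (λ ()) , λ ()

    at-A⁺ : ∀ {u v} → LaterEdge u v →
            (u ≡ A J (suc i) → v ≡ B J (suc i) ⊎ v ≡ B J (suc (suc i))) × v ≢ A J (suc i)
    at-A⁺ (_ , l , first)                                 = (λ { refl → inj₂ refl }) , λ ()
    at-A⁺ (_ , l , second)                         = (λ { refl → inj₁ refl }) , λ ()
    at-A⁺ (_ , l , third)                 = (λ ()) , λ ()
    at-A⁺ (_ , l , fourth)         = (λ ()) , λ ()
    at-A⁺ (_ , l , fifth) = (λ ()) , λ ()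
    at-A⁺ (_ , l , sixth) = (λ ()) , λ { refl → ⊥-elim (¬left refl l) }

    -- If one of the conditions failed, an end of the edge would be trapped among the edges added so
    -- far: C within {C} or {C, D}, or else D⁺ within {D⁺}.
    CD⁺-closing : Conn (open′ σ E₄) (C J i) (D J (suc i)) →
      σ (D J i) ≡ true × σ (A (suc J) i) ≡ true ×
      (σ (A (suc J) (suc i)) ≡ false → σ (C J (suc i)) ≡ true)
    CD⁺-closing c = opened D-open , opened A-open , λ na → opened (λ nc → other-end na nc)
      where
      D-open : σ (D J i) ≡ false → ⊥
      D-open nd = contradiction (untouched σ (C J i) E₄ (λ { first eu ev → ⊥-elim (clash ev nd)
                                               ; second _ _ → (λ ()) , λ ()
                                               ; (there (there k)) _ _ → fresh-C (isLater k) }) c) (λ ())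
      A-open : σ (A (suc J) i) ≡ false → ⊥
      A-open na = contradiction (open-cut σ (λ s → s ≡ C J i ⊎ s ≡ D J i) E₄
                       (λ { first _ _ → (λ _ → inj₂ refl) , λ _ → inj₁ refl
                          ; second eu ev → ⊥-elim (clash ev na)
                          ; (there (there k)) _ _ →
                              let nu , nv = fresh-C (isLater k) ; nu′ , nv′ = fresh-D (isLater k) in
                              (λ { (inj₁ e) → ⊥-elim (nu e) ; (inj₂ e) → ⊥-elim (nu′ e) }) ,
                              (λ { (inj₁ e) → ⊥-elim (nv e) ; (inj₂ e) → ⊥-elim (nv′ e) }) }) c (inj₁ refl)) (λ { (inj₁ ()) ; (inj₂ ()) })
      other-end : σ (A (suc J) (suc i)) ≡ false → σ (C J (suc i)) ≡ false → ⊥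
      other-end na nc = contradiction (untouched σ (D J (suc i)) E₄ (λ { first _ _ → (λ ()) , λ ()
                                                       ; second _ _ → (λ ()) , λ ()
                                                       ; (there (there k)) eu ev → at-D⁺ (isLater k) eu ev nc na }) (conn-sym c)) (λ ())

    -- Here the traps are {B⁺} and {B⁺, A⁺} at one end and {C} at the other. A⁺ has no third way
    -- out, because its edge to D lies in the previous column.
    CB⁺-closing : Conn (open′ σ E₃) (C J i) (B J (suc i)) →
      σ (A J (suc i)) ≡ true × σ (B J (suc (suc i))) ≡ true ×
      (σ (D J i) ≡ false → σ (D J (suc i)) ≡ true)
    CB⁺-closing c = opened A-open , opened B-open , λ nd → opened (λ nd⁺ → other-end nd nd⁺)
      where
      A-open : σ (A J (suc i)) ≡ false → ⊥
      A-open na = contradiction (untouched σ (B J (suc i)) E₃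
                       (λ { first _ _ → (λ ()) , λ ()
                          ; second _ _ → (λ ()) , λ ()
                          ; third _ _ → (λ ()) , λ ()
                          ; (there (there (there k))) eu ev → let nu , f = at-B⁺ (isLater k) in
                              nu , λ e → clash (subst (λ s → σ s ≡ true) (f e) eu) na }) (conn-sym c)) (λ ())
      B-open : σ (B J (suc (suc i))) ≡ false → ⊥
      B-open nb = contradiction (open-cut σ (λ s → s ≡ B J (suc i) ⊎ s ≡ A J (suc i)) E₃
                       (λ { first _ _ → (λ { (inj₁ ()) ; (inj₂ ()) }) , λ { (inj₁ ()) ; (inj₂ ()) }
                          ; second _ _ → (λ { (inj₁ ()) ; (inj₂ ()) }) , λ { (inj₁ ()) ; (inj₂ ()) }
                          ; third _ _ → (λ { (inj₁ ()) ; (inj₂ ()) }) , λ { (inj₁ ()) ; (inj₂ ()) }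
                          ; (there (there (there k))) eu ev →
                              let nu , f = at-B⁺ (isLater k) ; g , nv = at-A⁺ (isLater k) in
                              (λ { (inj₁ e) → ⊥-elim (nu e)
                                 ; (inj₂ e) → onA ev (g e) }) ,
                              (λ { (inj₁ e) → inj₂ (f e) ; (inj₂ e) → ⊥-elim (nv e) }) }) (conn-sym c) (inj₁ refl)) (λ { (inj₁ ()) ; (inj₂ ()) })
        where
        onA : ∀ {v} → σ v ≡ true → v ≡ B J (suc i) ⊎ v ≡ B J (suc (suc i)) → v ≡ B J (suc i) ⊎ v ≡ A J (suc i)
        onA ev (inj₁ e) = inj₁ e
        onA ev (inj₂ e) = ⊥-elim (clash (subst (λ s → σ s ≡ true) e ev) nb)

      other-end : σ (D J i) ≡ false → σ (D J (suc i)) ≡ false → ⊥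
      other-end nd nd⁺ = contradiction (untouched σ (C J i) E₃ (λ { first eu ev → ⊥-elim (clash ev nd⁺)
                                                  ; second eu ev → ⊥-elim (clash ev nd)
                                                  ; third _ _ → (λ ()) , λ ()
                                                  ; (there (there (there k))) _ _ → fresh-C (isLater k) }) c) (λ ())

  private
    dichotomy : ∀ b → b ≡ true ⊎ b ≡ false
    dichotomy true  = inj₁ refl
    dichotomy false = inj₂ refl

    Holds : Cylinder → Set
    Holds = All (λ (x , b) → σ x ≡ b)

    either : ∀ ks ls → Holds ks ⊎ Holds ls → 1 ℕ.≤ value (cyl ks ⊕ cyl ls) σ
    either ks ls (inj₁ h) = ℕ.≤-trans (ℕ.≤-reflexive (sym (cyl-true ks σ h))) (ℕ.m≤m+n _ _)
    either ks ls (inj₂ h) = ℕ.≤-trans (ℕ.≤-reflexive (sym (cyl-true ls σ h))) (ℕ.m≤n+m _ (value (cyl ks) σ))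

    CD⁺-closed : σ (C J i) ≡ true → σ (D J (suc i)) ≡ true → Conn (open′ σ E₄) (C J i) (D J (suc i)) →
                 1 ℕ.≤ value (CD⁺-slack (J , i)) σ
    CD⁺-closed c d⁺ k = either (CD⁺-slack₁ (J , i)) (CD⁺-slack₂ (J , i))
      (let d , a , f = CD⁺-closing k in [ (λ a⁺ → inj₁ (a⁺ ∷ c ∷ d ∷ a ∷ d⁺ ∷ [])) , (λ a⁺ → inj₂ (a⁺ ∷ f a⁺ ∷ c ∷ d ∷ a ∷ d⁺ ∷ [])) ]′
        (dichotomy (σ (A (suc J) (suc i)))))

    CB⁺-closed : σ (C J i) ≡ true → σ (B J (suc i)) ≡ true → Conn (open′ σ E₃) (C J i) (B J (suc i)) →
                 1 ℕ.≤ value (CB⁺-slack (J , i)) σ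
    CB⁺-closed c b⁺ k = either (CB⁺-slack₁ (J , i)) (CB⁺-slack₂ (J , i))
      (let a⁺ , b⁺⁺ , f = CB⁺-closing k in [ (λ d → inj₁ (d ∷ c ∷ b⁺ ∷ a⁺ ∷ b⁺⁺ ∷ [])) , (λ d → inj₂ (d ∷ f d ∷ c ∷ b⁺ ∷ a⁺ ∷ b⁺⁺ ∷ [])) ]′
        (dichotomy (σ (D J i))))

  -- Only the edges C–D⁺ and C–B⁺ can close a cycle with later edges.
  cell-lower : value (openEdges (J , i)) σ ℕ.+ rank (open′ σ (cellEdges rest)) ℕ.≤
               value (closings (J , i)) σ ℕ.+ rank (open′ σ (cellEdges ((J , i) ∷ rest)))
  cell-lower =
    chain-lower {value (bothOpen (A J i , B J (suc i))) σ} {n = 0}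
      -- In `E₁` no edge other than A-B touches A or B, so no edge leaves {A, B}, and B⁺ is outside.
      (rank-lower σ (A J i) (B J (suc i)) E₁ 0 (λ _ _ c → contradiction (open-cut σ (λ s → s ≡ A J i ⊎ s ≡ B J i) E₁
        (λ { first _ _ → (λ _ → inj₂ refl) , λ _ → inj₁ refl
           ; second _ _ → (λ { (inj₁ ()) ; (inj₂ ()) }) , λ { (inj₁ ()) ; (inj₂ ()) }
           ; third _ _ → (λ { (inj₁ ()) ; (inj₂ ()) }) , λ { (inj₁ ()) ; (inj₂ ()) }
           ; fourth _ _ → (λ { (inj₁ ()) ; (inj₂ ()) }) , λ { (inj₁ ()) ; (inj₂ ()) }
           ; fifth _ _ → (λ { (inj₁ ()) ; (inj₂ ()) }) , λ { (inj₁ ()) ; (inj₂ ()) }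
           ; (there (there (there (there (there k))))) _ _ →
               let nu , nv = fresh-A (isLater k) ; nu′ , nv′ = fresh-B (isLater k) in
               (λ { (inj₁ e) → ⊥-elim (nu e) ; (inj₂ e) → ⊥-elim (nu′ e) }) ,
               (λ { (inj₁ e) → ⊥-elim (nv e) ; (inj₂ e) → ⊥-elim (nv′ e) }) }) c (inj₁ refl))
        (λ { (inj₁ ()) ; (inj₂ ()) })))
    (chain-lower {value (bothOpen (A J i , B J i)) σ} {n = 0}
      (rank-lower σ (A J i) (B J i) E₂ 0 (λ _ _ c → contradiction (untouched σ (A J i) E₂
        (λ { first _ _ → (λ ()) , λ ()
           ; second _ _ → (λ ()) , λ ()
           ; third _ _ → (λ ()) , λ ()
           ; fourth _ _ → (λ ()) , λ ()
           ; (there (there (there (there k)))) _ _ → fresh-A (isLater k) }) c) (λ ())))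
    (chain-lower {value (bothOpen (C J i , B J (suc i))) σ} {n = value (CB⁺-slack (J , i)) σ}
      (rank-lower σ (C J i) (B J (suc i)) E₃ (value (CB⁺-slack (J , i)) σ) CB⁺-closed)
    (chain-lower {value (bothOpen (C J i , D J (suc i))) σ} {n = value (CD⁺-slack (J , i)) σ}
      (rank-lower σ (C J i) (D J (suc i)) E₄ (value (CD⁺-slack (J , i)) σ) CD⁺-closed)
    (chain-lower {value (bothOpen (C J i , D J i)) σ} {n = 0}
      (rank-lower σ (C J i) (D J i) E₅ 0 (λ _ _ c → contradiction (untouched σ (C J i) E₅
        (λ { first _ _ → (λ ()) , λ ()
           ; (there k) _ _ → fresh-C (isLater k) }) c) (λ ())))
    (chain-lower {value (bothOpen (D J i , A (suc J) i)) σ} {n = 0}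
      (rank-lower σ (D J i) (A (suc J) i) E₆ 0 (λ _ _ c → contradiction (untouched σ (D J i) E₆
        (λ k _ _ → fresh-D (isLater k)) c) (λ ())))
      (ℕ.≤-refl {rank (open′ σ E₆)}))))))

  -- Apart from edges of the cell itself, the two hexagons and the two 12-cycles run through these
  -- five later cells only. They must be present, so cells near the border have to be treated
  -- separately.
  module _ (near : ∀ {c} → c ∈ (J , suc i) ∷ (J , suc (suc i)) ∷ (suc J , i) ∷ (suc J , suc i) ∷
                               (suc J , suc (suc i)) ∷ [] → c ∈ rest) where

    private
      cell : ∀ {c e} → c ∈ rest → e ∈ edges c → e ∈ cellEdges rest
      cell c∈ k = ∈-concatMap⁺ edges (lose c∈ k)

      AB⁺ : ∀ {J i} → (J , i) ∈ rest → (A J i , B J (suc i)) ∈ E₆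
      AB⁺ c∈ = cell c∈ first
      AB : ∀ {J i} → (J , i) ∈ rest → (A J i , B J i) ∈ E₆
      AB c∈ = cell c∈ second
      CB⁺ : ∀ {J i} → (J , i) ∈ rest → (C J i , B J (suc i)) ∈ E₆
      CB⁺ c∈ = cell c∈ third
      CD⁺ : ∀ {J i} → (J , i) ∈ rest → (C J i , D J (suc i)) ∈ E₆
      CD⁺ c∈ = cell c∈ fourth
      CD : ∀ {J i} → (J , i) ∈ rest → (C J i , D J i) ∈ E₆
      CD c∈ = cell c∈ fifth
      DA : ∀ {J i} → (J , i) ∈ rest → (D J i , A (suc J) i) ∈ E₆
      DA c∈ = cell c∈ sixth

      c₀₁ = near first
      c₀₂ = near second
      c₁₀ = near third
      c₁₁ = near fourth
      c₁₂ = near fifth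

      infixr 5 _∙_
      _∙_ : ∀ {E x y z} → Conn E x y → Conn E y z → Conn E x z
      _∙_ = conn-trans

      -- The site `x` is open in one event and closed in the other, so the sum is at most 1. This is
      -- essential: an edge that closes two cycles at once still fails to raise the rank only once.
      faces-cases : ∀ x ks ls {P : Set} → (Holds ((x , true) ∷ ks) → P) → (Holds ((x , false) ∷ ls) → P) →
        value (cyl ((x , true) ∷ ks) ⊕ cyl ((x , false) ∷ ls)) σ ≡ 0 ⊎
        (value (cyl ((x , true) ∷ ks) ⊕ cyl ((x , false) ∷ ls)) σ ≡ 1 × P)
      faces-cases x ks ls f g with cyl-cases ((x , true) ∷ ks) σ | cyl-cases ((x , false) ∷ ls) σ
      ... | inj₁ m       | inj₁ n       = inj₁ (cong₂ ℕ._+_ m n)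
      ... | inj₁ m       | inj₂ (n , h) = inj₂ (cong₂ ℕ._+_ m n , g h)
      ... | inj₂ (m , h) | inj₁ n       = inj₂ (cong₂ ℕ._+_ m n , f h)
      ... | inj₂ (_ , e ∷ _) | inj₂ (_ , e′ ∷ _) = ⊥-elim (clash e e′)

      link₄ : ∀ {u v} → (u , v) ∈ E₄ → σ u ≡ true → σ v ≡ true → Conn (open′ σ E₄) u v
      link₄ = open-conn σ E₄
      late₄ : ∀ {u v} → (u , v) ∈ E₆ → σ u ≡ true → σ v ≡ true → Conn (open′ σ E₄) u v
      late₄ k = open-conn σ E₄ (there (there k))
      link₃ : ∀ {u v} → (u , v) ∈ E₃ → σ u ≡ true → σ v ≡ true → Conn (open′ σ E₃) u v
      link₃ = open-conn σ E₃
      late₃ : ∀ {u v} → (u , v) ∈ E₆ → σ u ≡ true → σ v ≡ true → Conn (open′ σ E₃) u v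
      late₃ k = open-conn σ E₃ (there (there (there k)))

      CD⁺-Closed CB⁺-Closed : Set
      CD⁺-Closed = σ (C J i) ≡ true × σ (D J (suc i)) ≡ true × Conn (open′ σ E₄) (C J i) (D J (suc i))
      CB⁺-Closed = σ (C J i) ≡ true × σ (B J (suc i)) ≡ true × Conn (open′ σ E₃) (C J i) (B J (suc i))

      -- The rest of the hexagon or 12-cycle, walked from C to D⁺, consists of edges added before,
      -- so the ends are already connected.
      CD⁺-face : value (CD⁺-faces (J , i)) σ ≡ 0 ⊎ (value (CD⁺-faces (J , i)) σ ≡ 1 × CD⁺-Closed)
      CD⁺-face = faces-cases (A (suc J) (suc i)) _ _ six twelve
        where
        six : Holds (hexagon-CD⁺ (J , i)) → CD⁺-Closed
        six (a⁺ ∷ c ∷ d ∷ a ∷ b ∷ d⁺ ∷ []) = c , d⁺ ,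
          (link₄ first c d ∙ link₄ second d a ∙ late₄ (AB⁺ c₁₀) a b ∙
           conn-sym (late₄ (AB c₁₁) a⁺ b) ∙ conn-sym (late₄ (DA c₀₁) d⁺ a⁺))
        twelve : Holds (dodecagon-CD⁺ (J , i)) → CD⁺-Closed
        twelve (_ ∷ c ∷ d ∷ a ∷ b ∷ c₁ ∷ d₁ ∷ c₁⁺ ∷ b₁ ∷ a₁ ∷ d⁺⁺ ∷ c⁺ ∷ d⁺ ∷ []) = c , d⁺ ,
          (link₄ first c d ∙ link₄ second d a ∙ late₄ (AB⁺ c₁₀) a b ∙
           conn-sym (late₄ (CB⁺ c₁₀) c₁ b) ∙ late₄ (CD⁺ c₁₀) c₁ d₁ ∙ conn-sym (late₄ (CD c₁₁) c₁⁺ d₁) ∙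
           late₄ (CB⁺ c₁₁) c₁⁺ b₁ ∙ conn-sym (late₄ (AB c₁₂) a₁ b₁) ∙ conn-sym (late₄ (DA c₀₂) d⁺⁺ a₁) ∙
           conn-sym (late₄ (CD⁺ c₀₁) c⁺ d⁺⁺) ∙ late₄ (CD c₀₁) c⁺ d⁺)

      CB⁺-face : value (CB⁺-faces (J , i)) σ ≡ 0 ⊎ (value (CB⁺-faces (J , i)) σ ≡ 1 × CB⁺-Closed)
      CB⁺-face = faces-cases (D J (suc i)) _ _ six twelve
        where
        six : Holds (hexagon-CB⁺ (J , i)) → CB⁺-Closed
        six (d⁺ ∷ c ∷ c⁺ ∷ b⁺⁺ ∷ a⁺ ∷ b⁺ ∷ []) = c , b⁺ ,
          (link₃ first c d⁺ ∙ conn-sym (late₃ (CD c₀₁) c⁺ d⁺) ∙ late₃ (CB⁺ c₀₁) c⁺ b⁺⁺ ∙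
           conn-sym (late₃ (AB⁺ c₀₁) a⁺ b⁺⁺) ∙ late₃ (AB c₀₁) a⁺ b⁺)
        twelve : Holds (dodecagon-CB⁺ (J , i)) → CB⁺-Closed
        twelve (_ ∷ c ∷ d ∷ a ∷ b ∷ a₁ ∷ b₁ ∷ a₁⁺ ∷ d⁺⁺ ∷ c⁺ ∷ b⁺⁺ ∷ a⁺ ∷ b⁺ ∷ []) = c , b⁺ ,
          (link₃ second c d ∙ link₃ third d a ∙ late₃ (AB⁺ c₁₀) a b ∙
           conn-sym (late₃ (AB c₁₁) a₁ b) ∙ late₃ (AB⁺ c₁₁) a₁ b₁ ∙ conn-sym (late₃ (AB c₁₂) a₁⁺ b₁) ∙
           conn-sym (late₃ (DA c₀₂) d⁺⁺ a₁⁺) ∙ conn-sym (late₃ (CD⁺ c₀₁) c⁺ d⁺⁺) ∙ late₃ (CB⁺ c₀₁) c⁺ b⁺⁺ ∙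
           conn-sym (late₃ (AB⁺ c₀₁) a⁺ b⁺⁺) ∙ late₃ (AB c₀₁) a⁺ b⁺)

    cell-upper : value (faces (J , i)) σ ℕ.+ rank (open′ σ (cellEdges ((J , i) ∷ rest))) ℕ.≤
                 value (openEdges (J , i)) σ ℕ.+ rank (open′ σ (cellEdges rest))
    cell-upper =
      chain-upper {value (bothOpen (A J i , B J (suc i))) σ} {n = 0} (rank-upper σ (A J i) (B J (suc i)) E₁ 0 (inj₁ refl))
      (chain-upper {value (bothOpen (A J i , B J i)) σ} {n = 0} (rank-upper σ (A J i) (B J i) E₂ 0 (inj₁ refl))
      (chain-upper {value (bothOpen (C J i , B J (suc i))) σ} {n = value (CB⁺-faces (J , i)) σ}
        (rank-upper σ (C J i) (B J (suc i)) E₃ (value (CB⁺-faces (J , i)) σ) CB⁺-face)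
      (chain-upper {value (bothOpen (C J i , D J (suc i))) σ} {n = value (CD⁺-faces (J , i)) σ}
        (rank-upper σ (C J i) (D J (suc i)) E₄ (value (CD⁺-faces (J , i)) σ) CD⁺-face)
      (chain-upper {value (bothOpen (C J i , D J i)) σ} {n = 0} (rank-upper σ (C J i) (D J i) E₅ 0 (inj₁ refl))
      (chain-upper {value (bothOpen (D J i , A (suc J) i)) σ} {n = 0} (rank-upper σ (D J i) (A (suc J) i) E₆ 0 (inj₁ refl))
        (ℕ.≤-refl {rank (open′ σ E₆)}))))))

-- Rectangles of cells

column : ℕ → ℕ → ℕ → List Cell
column J i zero    = []
column J i (suc l) = (J , i) ∷ column J (suc i) l

rectangle : ℕ → ℕ → ℕ → ℕ → List Cell
rectangle J i zero    l = []
rectangle J i (suc k) l = column J i l ++ rectangle (suc J) i k l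

∈-column⁻ : ∀ {J i l J′ i′} → (J′ , i′) ∈ column J i l → J′ ≡ J × i ℕ.≤ i′ × i′ ℕ.< i ℕ.+ l
∈-column⁻ {J} {i} {suc l} first = refl , ℕ.≤-refl , ℕ.m<m+n i (s≤s z≤n)
∈-column⁻ {J} {i} {suc l} (there k) =
  let e , i≤ , <l = ∈-column⁻ {J} {suc i} {l} k
  in e , ℕ.<⇒≤ i≤ , ℕ.<-≤-trans <l (ℕ.≤-reflexive (sym (ℕ.+-suc i l)))

∈-column⁺ : ∀ {J i l i′} → i ℕ.≤ i′ → i′ ℕ.< i ℕ.+ l → (J , i′) ∈ column J i l
∈-column⁺ {J} {i} {zero}  i≤ <l = contradiction (ℕ.<-≤-trans <l (ℕ.≤-reflexive (ℕ.+-identityʳ i))) (ℕ.≤⇒≯ i≤)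
∈-column⁺ {J} {i} {suc l} i≤ <l with ℕ.m≤n⇒m<n∨m≡n i≤
... | inj₁ i<   = there (∈-column⁺ i< (ℕ.<-≤-trans <l (ℕ.≤-reflexive (ℕ.+-suc i l))))
... | inj₂ refl = first

∈-rectangle⁻ : ∀ {J i k l J′ i′} → (J′ , i′) ∈ rectangle J i k l →
               (J ℕ.≤ J′ × J′ ℕ.< J ℕ.+ k) × (i ℕ.≤ i′ × i′ ℕ.< i ℕ.+ l)
∈-rectangle⁻ {J} {i} {suc k} {l} m with ∈-++⁻ (column J i l) m
... | inj₁ n = let e , b = ∈-column⁻ n in
  (ℕ.≤-reflexive (sym e) , subst (ℕ._< J ℕ.+ suc k) (sym e) (ℕ.m<m+n J (s≤s z≤n))) , b
... | inj₂ n = let (J≤ , <k) , b = ∈-rectangle⁻ {suc J} {i} {k} {l} n in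
  (ℕ.<⇒≤ J≤ , ℕ.<-≤-trans <k (ℕ.≤-reflexive (sym (ℕ.+-suc J k)))) , b

∈-rectangle⁺ : ∀ {J i k l J′ i′} → J ℕ.≤ J′ → J′ ℕ.< J ℕ.+ k → i ℕ.≤ i′ → i′ ℕ.< i ℕ.+ l →
               (J′ , i′) ∈ rectangle J i k l
∈-rectangle⁺ {J} {i} {zero} J≤ <k i≤ <l =
  contradiction (ℕ.<-≤-trans <k (ℕ.≤-reflexive (ℕ.+-identityʳ J))) (ℕ.≤⇒≯ J≤)
∈-rectangle⁺ {J} {i} {suc k} {l} J≤ <k i≤ <l with ℕ.m≤n⇒m<n∨m≡n J≤
... | inj₁ J<   = ∈-++⁺ʳ (column J i l) (∈-rectangle⁺ J< (ℕ.<-≤-trans <k (ℕ.≤-reflexive (ℕ.+-suc J k))) i≤ <l)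
... | inj₂ refl = ∈-++⁺ˡ (∈-column⁺ i≤ <l)

length-column : ∀ J i l → length (column J i l) ≡ l
length-column J i zero    = refl
length-column J i (suc l) = cong suc (length-column J (suc i) l)

length-rectangle : ∀ J i k l → length (rectangle J i k l) ≡ k ℕ.* l
length-rectangle J i zero    l = refl
length-rectangle J i (suc k) l = trans (List.length-++ (column J i l))
  (cong₂ ℕ._+_ (length-column J i l) (length-rectangle (suc J) i k l))

column-+ : ∀ J i l l′ → column J i (l ℕ.+ l′) ≡ column J i l ++ column J (l ℕ.+ i) l′
column-+ J i zero    l′ = refl
column-+ J i (suc l) l′ = cong ((J , i) ∷_) (trans (column-+ J (suc i) l l′)
  (cong (λ n → column J (suc i) l ++ column J n l′) (ℕ.+-suc l i)))

rectangle-+ : ∀ J i k k′ l → rectangle J i (k ℕ.+ k′) l ≡ rectangle J i k l ++ rectangle (k ℕ.+ J) i k′ l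
rectangle-+ J i zero    k′ l = refl
rectangle-+ J i (suc k) k′ l = begin
  column J i l ++ rectangle (suc J) i (k ℕ.+ k′) l
    ≡⟨ cong (column J i l ++_) (rectangle-+ (suc J) i k k′ l) ⟩
  column J i l ++ (rectangle (suc J) i k l ++ rectangle (k ℕ.+ suc J) i k′ l)
    ≡⟨ List.++-assoc (column J i l) _ _ ⟨
  rectangle J i (suc k) l ++ rectangle (k ℕ.+ suc J) i k′ l
    ≡⟨ cong (λ n → rectangle J i (suc k) l ++ rectangle n i k′ l) (ℕ.+-suc k J) ⟩
  rectangle J i (suc k) l ++ rectangle (suc k ℕ.+ J) i k′ l ∎
  where open ≡-Reasoning

-- Rectangles are listed by columns, so a cut between rows interleaves the two parts; only a
-- permutation is available, which suffices since the rank ignores the order.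
rectangle-+↭ : ∀ J i k l l′ → rectangle J i k (l ℕ.+ l′) ↭ rectangle J i k l ++ rectangle J (l ℕ.+ i) k l′
rectangle-+↭ J i zero    l l′ = ↭-refl
rectangle-+↭ J i (suc k) l l′ = begin
  column J i (l ℕ.+ l′) ++ rectangle (suc J) i k (l ℕ.+ l′)
    ↭⟨ ++⁺ (↭-reflexive (column-+ J i l l′)) (rectangle-+↭ (suc J) i k l l′) ⟩
  (c ++ c′) ++ (r ++ r′)  ≡⟨ List.++-assoc c c′ (r ++ r′) ⟩
  c ++ (c′ ++ (r ++ r′))  ↭⟨ ++⁺ˡ c (shifts c′ r) ⟩
  c ++ (r ++ (c′ ++ r′))  ≡⟨ List.++-assoc c r (c′ ++ r′) ⟨
  (c ++ r) ++ (c′ ++ r′)  ∎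
  where
  open PermutationReasoning
  c  = column J i l
  c′ = column J (l ℕ.+ i) l′
  r  = rectangle (suc J) i k l
  r′ = rectangle (suc J) (l ℕ.+ i) k l′

cellEdges-++ : ∀ cs ds → cellEdges (cs ++ ds) ≡ cellEdges cs ++ cellEdges ds
cellEdges-++ cs ds = List.concatMap-++ edges cs ds

cellEdges-↭ : ∀ {cs ds} → cs ↭ ds → cellEdges cs ↭ cellEdges ds
cellEdges-↭ ↭-refl        = ↭-refl
cellEdges-↭ (prep c p)    = ++⁺ˡ (edges c) (cellEdges-↭ p)
cellEdges-↭ (swap c d p)  = ↭-trans (shifts (edges c) (edges d)) (++⁺ˡ (edges d) (++⁺ˡ (edges c) (cellEdges-↭ p)))
cellEdges-↭ (↭-trans p q) = ↭-trans (cellEdges-↭ p) (cellEdges-↭ q)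

length-cellEdges : ∀ cs → length (cellEdges cs) ≡ length cs ℕ.* 6
length-cellEdges []       = refl
length-cellEdges (c ∷ cs) = cong (6 ℕ.+_) (length-cellEdges cs)

-- Translations of cells and additivity of the mean rank

shift : ℕ → ℕ → Site → Site
shift x y (t , J , i) = t , J ℕ.+ x , i ℕ.+ y

shift-injective : ∀ {x y s s′} → shift x y s ≡ shift x y s′ → s ≡ s′
shift-injective {x} {y} {t , J , i} {t′ , J′ , i′} e =
  cong₂ _,_ (cong proj₁ e) (cong₂ _,_ (ℕ.+-cancelʳ-≡ x J J′ (cong (proj₁ ∘ proj₂) e))
                                      (ℕ.+-cancelʳ-≡ y i i′ (cong (proj₂ ∘ proj₂) e)))

module Shift (x y : ℕ) where

  open PercolationMap _≟ₛ_ _≟ₛ_ (shift x y) shift-injective public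

  column-shift : ∀ J i l → cellEdges (column (J ℕ.+ x) (i ℕ.+ y) l) ≡ map τ² (cellEdges (column J i l))
  column-shift J i zero    = refl
  column-shift J i (suc l) = cong (edges (J ℕ.+ x , i ℕ.+ y) ++_) (column-shift J (suc i) l)

  rectangle-shift : ∀ J i k l →
    cellEdges (rectangle (J ℕ.+ x) (i ℕ.+ y) k l) ≡ map τ² (cellEdges (rectangle J i k l))
  rectangle-shift J i zero    l = refl
  rectangle-shift J i (suc k) l = begin
    cellEdges (column (J ℕ.+ x) (i ℕ.+ y) l ++ rectangle (suc J ℕ.+ x) (i ℕ.+ y) k l)
      ≡⟨ cellEdges-++ (column (J ℕ.+ x) (i ℕ.+ y) l) _ ⟩
    cellEdges (column (J ℕ.+ x) (i ℕ.+ y) l) ++ cellEdges (rectangle (suc J ℕ.+ x) (i ℕ.+ y) k l)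
      ≡⟨ cong₂ _++_ (column-shift J i l) (rectangle-shift (suc J) i k l) ⟩
    map τ² (cellEdges (column J i l)) ++ map τ² (cellEdges (rectangle (suc J) i k l))
      ≡⟨ List.map-++ τ² (cellEdges (column J i l)) _ ⟨
    map τ² (cellEdges (column J i l) ++ cellEdges (rectangle (suc J) i k l))
      ≡⟨ cong (map τ²) (cellEdges-++ (column J i l) _) ⟨
    map τ² (cellEdges (rectangle J i (suc k) l)) ∎
    where open ≡-Reasoning

cellRank : List Cell → Observable
cellRank cs = openRank (cellEdges cs)

Φ : ℚ → ℕ → ℕ → ℚ
Φ p k l = 𝔼 p (cellRank (rectangle 0 0 k l))

Φ-shift : ∀ p x y k l → 𝔼 p (cellRank (rectangle x y k l)) ≡ Φ p k l
Φ-shift p x y k l = trans (cong (𝔼 p ∘ openRank) (rectangle-shift 0 0 k l))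
  (𝔼-openRank-map p (cellEdges (rectangle 0 0 k l)))
  where open Shift x y

cellRank-≤ : ∀ {cs} as bs → cs ↭ as ++ bs → ∀ σ → value (cellRank cs) σ ℕ.≤ value (cellRank as ⊕ cellRank bs) σ
cellRank-≤ as bs p = openRank-≤ (cellEdges as) (cellEdges bs)
  (↭-trans (cellEdges-↭ p) (↭-reflexive (cellEdges-++ as bs)))

Near : Cell → Site → Set
Near (J , i) (_ , J′ , i′) = (J ℕ.≤ J′ × J′ ℕ.≤ suc J) × (i ℕ.≤ i′ × i′ ℕ.≤ suc i)

edge-in-cell : ∀ {J i u v} → (u , v) ∈ edges (J , i) → Near (J , i) u × Near (J , i) v
edge-in-cell {J} {i} = go
  where
  j₀ : J ℕ.≤ J × J ℕ.≤ suc J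
  j₀ = ℕ.≤-refl , ℕ.n≤1+n J
  j₁ : J ℕ.≤ suc J × suc J ℕ.≤ suc J
  j₁ = ℕ.n≤1+n J , ℕ.≤-refl
  i₀ : i ℕ.≤ i × i ℕ.≤ suc i
  i₀ = ℕ.≤-refl , ℕ.n≤1+n i
  i₁ : i ℕ.≤ suc i × suc i ℕ.≤ suc i
  i₁ = ℕ.n≤1+n i , ℕ.≤-refl
  go : ∀ {u v} → (u , v) ∈ edges (J , i) → Near (J , i) u × Near (J , i) v
  go first                                         = (j₀ , i₀) , (j₀ , i₁)
  go second                                 = (j₀ , i₀) , (j₀ , i₀)
  go third                         = (j₀ , i₀) , (j₀ , i₁)
  go fourth                 = (j₀ , i₀) , (j₀ , i₁)
  go fifth         = (j₀ , i₀) , (j₀ , i₀)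
  go sixth = (j₀ , i₀) , (j₁ , i₀)

-- A row or column of cells between two regions makes their edges disjoint.
cellRank-gap : (f : ℕ × ℕ → ℕ) → (∀ {J i u v} → (u , v) ∈ edges (J , i) →
                  (f (J , i) ℕ.≤ f (proj₂ u) × f (proj₂ u) ℕ.≤ suc (f (J , i))) ×
                  (f (J , i) ℕ.≤ f (proj₂ v) × f (proj₂ v) ℕ.≤ suc (f (J , i)))) →
               ∀ n {cs} gs as bs → cs ↭ gs ++ (as ++ bs) →
               (∀ {c} → c ∈ as → f c ℕ.< n) → (∀ {c} → c ∈ bs → n ℕ.< f c) →
               ∀ σ → value (cellRank as ⊕ cellRank bs) σ ℕ.≤ value (cellRank cs) σ
cellRank-gap f near n gs as bs p as< <bs = openRank-gap (λ s → f (proj₂ s) ℕ.≤ n) (λ s → f (proj₂ s) ℕ.≤? n)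
  (cellEdges gs) (cellEdges as) (cellEdges bs)
  (↭-trans (cellEdges-↭ p) (↭-reflexive (trans (cellEdges-++ gs (as ++ bs)) (cong (cellEdges gs ++_) (cellEdges-++ as bs)))))
  (λ e → let c , c∈ , k = ∈-cellEdges e ; (_ , u≤) , (_ , v≤) = near k in
    ℕ.≤-trans u≤ (as< c∈) , ℕ.≤-trans v≤ (as< c∈))
  (λ e → let c , c∈ , k = ∈-cellEdges e ; (≤u , _) , (≤v , _) = near k in
    ℕ.<⇒≱ (ℕ.<-≤-trans (<bs c∈) ≤u) , ℕ.<⇒≱ (ℕ.<-≤-trans (<bs c∈) ≤v))

module _ {p : ℚ} (u : Unit p) where

  Φ-+-≤ : ∀ k k′ l → Φ p (k ℕ.+ k′) l ℚ.≤ Φ p k l ℚ.+ Φ p k′ l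
  Φ-+-≤ k k′ l = ℚ.≤-trans
    (𝔼-≤-⊕ u (cellRank (rectangle 0 0 (k ℕ.+ k′) l)) (cellRank (rectangle 0 0 k l)) (cellRank (rectangle (k ℕ.+ 0) 0 k′ l))
      (cellRank-≤ (rectangle 0 0 k l) (rectangle (k ℕ.+ 0) 0 k′ l) (↭-reflexive (rectangle-+ 0 0 k k′ l))))
    (ℚ.≤-reflexive (cong (Φ p k l ℚ.+_) (Φ-shift p (k ℕ.+ 0) 0 k′ l)))

  -- The extra column is the gap: without its edges the rectangles on its two sides share no site.
  Φ-≤-+ : ∀ k k′ l → Φ p k l ℚ.+ Φ p k′ l ℚ.≤ Φ p (k ℕ.+ suc k′) l
  Φ-≤-+ k k′ l = begin
    Φ p k l ℚ.+ Φ p k′ l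
      ≡⟨ cong (Φ p k l ℚ.+_) (Φ-shift p (suc (k ℕ.+ 0)) 0 k′ l) ⟨
    𝔼 p (cellRank as) ℚ.+ 𝔼 p (cellRank bs)
      ≡⟨ 𝔼-⊕ p (cellRank as) (cellRank bs) ⟨
    𝔼 p (cellRank as ⊕ cellRank bs)
      ≤⟨ 𝔼-mono u (cellRank as ⊕ cellRank bs) (cellRank (rectangle 0 0 (k ℕ.+ suc k′) l))
           (cellRank-gap proj₁ (λ e → let (a , _) , (b , _) = edge-in-cell e in a , b) k gs as bs
             (↭-trans (↭-reflexive (rectangle-+ 0 0 k (suc k′) l)) (shifts as gs))
             (λ c∈ → proj₂ (proj₁ (∈-rectangle⁻ {0} {0} {k} {l} c∈)))
             (λ c∈ → ℕ.≤-trans (ℕ.≤-reflexive (cong suc (sym (ℕ.+-identityʳ k)))) (proj₁ (proj₁ (∈-rectangle⁻ {suc (k ℕ.+ 0)} {0} {k′} {l} c∈))))) ⟩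
    Φ p (k ℕ.+ suc k′) l ∎
    where
    open ℚ.≤-Reasoning
    as = rectangle 0 0 k l
    gs = column (k ℕ.+ 0) 0 l
    bs = rectangle (suc (k ℕ.+ 0)) 0 k′ l

  Φ-+-≤′ : ∀ k l l′ → Φ p k (l ℕ.+ l′) ℚ.≤ Φ p k l ℚ.+ Φ p k l′
  Φ-+-≤′ k l l′ = ℚ.≤-trans
    (𝔼-≤-⊕ u (cellRank (rectangle 0 0 k (l ℕ.+ l′))) (cellRank (rectangle 0 0 k l)) (cellRank (rectangle 0 (l ℕ.+ 0) k l′))
      (cellRank-≤ (rectangle 0 0 k l) (rectangle 0 (l ℕ.+ 0) k l′) (rectangle-+↭ 0 0 k l l′)))
    (ℚ.≤-reflexive (cong (Φ p k l ℚ.+_) (Φ-shift p 0 (l ℕ.+ 0) k l′)))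

  Φ-≤-+′ : ∀ k l l′ → Φ p k l ℚ.+ Φ p k l′ ℚ.≤ Φ p k (l ℕ.+ suc l′)
  Φ-≤-+′ k l l′ = begin
    Φ p k l ℚ.+ Φ p k l′
      ≡⟨ cong (Φ p k l ℚ.+_) (Φ-shift p 0 (suc (l ℕ.+ 0)) k l′) ⟨
    𝔼 p (cellRank as) ℚ.+ 𝔼 p (cellRank bs)
      ≡⟨ 𝔼-⊕ p (cellRank as) (cellRank bs) ⟨
    𝔼 p (cellRank as ⊕ cellRank bs)
      ≤⟨ 𝔼-mono u (cellRank as ⊕ cellRank bs) (cellRank (rectangle 0 0 k (l ℕ.+ suc l′)))
           (cellRank-gap proj₂ (λ e → let (_ , a) , (_ , b) = edge-in-cell e in a , b) l gs as bs
             (↭-trans (rectangle-+↭ 0 0 k l (suc l′)) (↭-trans (++⁺ˡ as (rectangle-+↭ 0 (l ℕ.+ 0) k 1 l′)) (shifts as gs)))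
             (λ c∈ → proj₂ (proj₂ (∈-rectangle⁻ {0} {0} {k} {l} c∈)))
             (λ c∈ → ℕ.≤-trans (ℕ.≤-reflexive (cong suc (sym (ℕ.+-identityʳ l)))) (proj₁ (proj₂ (∈-rectangle⁻ {0} {suc (l ℕ.+ 0)} {k} {l′} c∈))))) ⟩
    Φ p k (l ℕ.+ suc l′) ∎
    where
    open ℚ.≤-Reasoning
    as = rectangle 0 0 k l
    gs = rectangle 0 (l ℕ.+ 0) k 1
    bs = rectangle 0 (suc (l ℕ.+ 0)) k l′

  0≤Φ : ∀ k l → 0ℚ ℚ.≤ Φ p k l
  0≤Φ k l = ℚ.≤-trans (ℚ.≤-reflexive (sym (𝔼-constant p 0))) (𝔼-mono u (constant 0) (cellRank (rectangle 0 0 k l)) (λ _ → z≤n))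

  Φ-bound : ∀ k l → Φ p k l ℚ.≤ ι (k ℕ.* l ℕ.* 6)
  Φ-bound k l = ℚ.≤-trans (𝔼-mono u (cellRank (rectangle 0 0 k l)) (constant (k ℕ.* l ℕ.* 6))
    (λ σ → ℕ.≤-trans (openRank-≤-length (cellEdges (rectangle 0 0 k l)) σ)
      (ℕ.≤-reflexive (trans (length-cellEdges (rectangle 0 0 k l)) (cong (ℕ._* 6) (length-rectangle 0 0 k l))))))
    (ℚ.≤-reflexive (𝔼-constant p (k ℕ.* l ℕ.* 6)))

-- Local bounds for the mean rank of a rectangle

unique-shift : ∀ J i ks {ks₀} → Unique (sites ks₀) → sites ks ≡ map (shift J i) (sites ks₀) → Unique (sites ks)
unique-shift J i ks u e = subst Unique (sym e) (Unique.map⁺ shift-injective u)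

-- Distinctness of the sites can be decided by evaluation at the cell (0 , 0) and carries over to
-- the other cells by translation.
𝔼-cyl-cell : ∀ p (ks : Cell → Cylinder) → Unique (sites (ks (0 , 0))) →
             (∀ J i → sites (ks (J , i)) ≡ map (shift J i) (sites (ks (0 , 0)))) →
             ∀ c → 𝔼 p (cyl (ks c)) ≡ prob p (ks c)
𝔼-cyl-cell p ks u e (J , i) = 𝔼-cyl p (ks (J , i)) (unique-shift J i (ks (J , i)) u (e J i))

open DecUnique _≟ₛ_ using (unique?)

-- Means per cell, thus per four sites: `6p²`, `4p⁵ - 2p⁶` and `2p⁶ + 2p¹²(1 - p)`.
openDensity closingDensity faceDensity : ℚ → ℚ
openDensity p = ι 6 ℚ.* prob p (allOpen (A 0 0 ∷ B 0 0 ∷ []))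
closingDensity p = (prob p (CB⁺-slack₁ (0 , 0)) ℚ.+ prob p (CB⁺-slack₂ (0 , 0))) ℚ.+
                   ((prob p (CD⁺-slack₁ (0 , 0)) ℚ.+ prob p (CD⁺-slack₂ (0 , 0))) ℚ.+ 0ℚ)
faceDensity p = (prob p (hexagon-CB⁺ (0 , 0)) ℚ.+ prob p (dodecagon-CB⁺ (0 , 0))) ℚ.+
                ((prob p (hexagon-CD⁺ (0 , 0)) ℚ.+ prob p (dodecagon-CD⁺ (0 , 0))) ℚ.+ 0ℚ)

edge-distinct : ∀ {c u v} → (u , v) ∈ edges c → u ≢ v
edge-distinct first                                         = λ ()
edge-distinct second                                 = λ ()
edge-distinct third                         = λ ()
edge-distinct fourth                 = λ ()
edge-distinct fifth         = λ ()
edge-distinct sixth = λ ()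

module _ (p : ℚ) where

  𝔼-openEdges : ∀ c → 𝔼 p (openEdges c) ≡ openDensity p
  𝔼-openEdges c = 𝔼-⨁ p (edges c) bothOpen
    (λ {(u , v)} i → 𝔼-cyl p ((u , true) ∷ (v , true) ∷ []) ((edge-distinct i ∷ []) ∷ [] ∷ []))

  𝔼-pair : ∀ (ks ls : Cell → Cylinder) → (∀ c → 𝔼 p (cyl (ks c)) ≡ prob p (ks c)) → (∀ c → 𝔼 p (cyl (ls c)) ≡ prob p (ls c)) →
           ∀ c → 𝔼 p (cyl (ks c) ⊕ cyl (ls c)) ≡ prob p (ks c) ℚ.+ prob p (ls c)
  𝔼-pair ks ls h h′ c = trans (𝔼-⊕ p (cyl (ks c)) (cyl (ls c))) (cong₂ ℚ._+_ (h c) (h′ c))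

  𝔼-closings : ∀ c → 𝔼 p (closings c) ≡ closingDensity p
  𝔼-closings c = trans (𝔼-⊕ p (CB⁺-slack c) (CD⁺-slack c ⊕ constant 0)) (cong₂ ℚ._+_
    (𝔼-pair CB⁺-slack₁ CB⁺-slack₂
      (𝔼-cyl-cell p CB⁺-slack₁ (toWitness {a? = unique? (sites (CB⁺-slack₁ (0 , 0)))} tt) (λ _ _ → refl))
      (𝔼-cyl-cell p CB⁺-slack₂ (toWitness {a? = unique? (sites (CB⁺-slack₂ (0 , 0)))} tt) (λ _ _ → refl)) c)
    (trans (𝔼-⊕ p (CD⁺-slack c) (constant 0)) (cong₂ ℚ._+_
      (𝔼-pair CD⁺-slack₁ CD⁺-slack₂
        (𝔼-cyl-cell p CD⁺-slack₁ (toWitness {a? = unique? (sites (CD⁺-slack₁ (0 , 0)))} tt) (λ _ _ → refl))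
        (𝔼-cyl-cell p CD⁺-slack₂ (toWitness {a? = unique? (sites (CD⁺-slack₂ (0 , 0)))} tt) (λ _ _ → refl)) c) (𝔼-constant p 0))))

  𝔼-faces : ∀ c → 𝔼 p (faces c) ≡ faceDensity p
  𝔼-faces c = trans (𝔼-⊕ p (CB⁺-faces c) (CD⁺-faces c ⊕ constant 0)) (cong₂ ℚ._+_
    (𝔼-pair hexagon-CB⁺ dodecagon-CB⁺
      (𝔼-cyl-cell p hexagon-CB⁺ (toWitness {a? = unique? (sites (hexagon-CB⁺ (0 , 0)))} tt) (λ _ _ → refl))
      (𝔼-cyl-cell p dodecagon-CB⁺ (toWitness {a? = unique? (sites (dodecagon-CB⁺ (0 , 0)))} tt) (λ _ _ → refl)) c)
    (trans (𝔼-⊕ p (CD⁺-faces c) (constant 0)) (cong₂ ℚ._+_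
      (𝔼-pair hexagon-CD⁺ dodecagon-CD⁺
        (𝔼-cyl-cell p hexagon-CD⁺ (toWitness {a? = unique? (sites (hexagon-CD⁺ (0 , 0)))} tt) (λ _ _ → refl))
        (𝔼-cyl-cell p dodecagon-CD⁺ (toWitness {a? = unique? (sites (dodecagon-CD⁺ (0 , 0)))} tt) (λ _ _ → refl)) c) (𝔼-constant p 0))))

rectangle-later : ∀ J i k l → AllPairs Later (rectangle J i k l)
rectangle-later J i zero    l = []
rectangle-later J i (suc k) l = AllPairs.++⁺ (column-later i l) (rectangle-later (suc J) i k l)
  (All.tabulate λ c∈ → All.tabulate λ d∈ → inj₁ (ℕ.≤-<-trans
    (ℕ.≤-reflexive (proj₁ (∈-column⁻ c∈))) (proj₁ (proj₁ (∈-rectangle⁻ {suc J} {i} {k} {l} d∈)))))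
  where
  column-later : ∀ i l → AllPairs Later (column J i l)
  column-later i zero    = []
  column-later i (suc l) = All.tabulate (λ d∈ → let e , i< , _ = ∈-column⁻ d∈ in inj₂ (sym e , i<)) ∷ column-later (suc i) l

-- The lower bound needs no neighbouring cells and so has no boundary term; the summand 0 is the
-- rank of the empty list from which the construction starts.
open-≤-closings : ∀ σ cs → AllPairs Later cs →
  value (⨁ cs openEdges) σ ℕ.+ 0 ℕ.≤ value (⨁ cs closings) σ ℕ.+ value (cellRank cs) σ
open-≤-closings σ []             []      = z≤n
open-≤-closings σ ((J , i) ∷ cs) (l ∷ ls) =
  chain-lower {value (openEdges (J , i)) σ} {n = value (closings (J , i)) σ}
    (CellBound.cell-lower σ J i cs l) (open-≤-closings σ cs ls)

-- The edges of the cells left out of the local account: the two last cells of each of `k` columns,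
-- with 12 edges, and a whole column of `2 + l` cells with six edges each.
boundary : ℕ → ℕ → ℕ
boundary k l = k ℕ.* 12 ℕ.+ (2 ℕ.+ l) ℕ.* 6

-- The 12-cycles of a cell reach two rows up and one column on. Hence the column continues for two
-- cells beyond those whose faces are counted, and `T` must contain the next column to the same
-- height.
faces-≤-open-column : ∀ σ J i l T → (∀ {c} → c ∈ T → J ℕ.< proj₁ c) →
  (∀ {i′} → i ℕ.≤ i′ → i′ ℕ.< i ℕ.+ (2 ℕ.+ l) → (suc J , i′) ∈ T) →
  value (⨁ (column J i l) faces) σ ℕ.+ value (cellRank (column J i (2 ℕ.+ l) ++ T)) σ ℕ.≤
  value (⨁ (column J i l) openEdges) σ ℕ.+ (12 ℕ.+ value (cellRank T) σ)
faces-≤-open-column σ J i zero T J< col = ℕ.≤-trans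
  (openRank-≤ (cellEdges c₂) (cellEdges T) (↭-reflexive (cellEdges-++ c₂ T)) σ)
  (ℕ.+-monoˡ-≤ (value (cellRank T) σ) (openRank-≤-length (cellEdges c₂) σ))
  where
  c₂ = (J , i) ∷ (J , suc i) ∷ []
faces-≤-open-column σ J i (suc l) T J< col =
  chain-upper {value (openEdges (J , i)) σ} {n = value (faces (J , i)) σ}
    (CellBound.cell-upper σ J i rest later near)
    (faces-≤-open-column σ J (suc i) l T J<
      (λ i≤ <l → col (ℕ.<⇒≤ i≤) (ℕ.<-≤-trans <l (ℕ.≤-reflexive (sym (ℕ.+-suc i (2 ℕ.+ l)))))))
  where
  rest = column J (suc i) (2 ℕ.+ l) ++ T
  later : All (Later (J , i)) rest
  later = All.++⁺ (All.tabulate (λ c∈ → let e , i< , _ = ∈-column⁻ {J} {suc i} {2 ℕ.+ l} c∈ in inj₂ (sym e , i<)))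
                  (All.tabulate (λ c∈ → inj₁ (J< c∈)))
  bound : ∀ {n} → n ℕ.< 3 ℕ.+ l → n ℕ.+ i ℕ.< i ℕ.+ (3 ℕ.+ l)
  bound {n} n< = ℕ.<-≤-trans (ℕ.+-monoˡ-< i n<) (ℕ.≤-reflexive (ℕ.+-comm (3 ℕ.+ l) i))
  near : ∀ {c} → c ∈ (J , suc i) ∷ (J , suc (suc i)) ∷ (suc J , i) ∷ (suc J , suc i) ∷ (suc J , suc (suc i)) ∷ [] → c ∈ rest
  near first                                 = first
  near second                         = second
  near third                 = ∈-++⁺ʳ (column J (suc i) (2 ℕ.+ l)) (col ℕ.≤-refl (bound {0} (s≤s z≤n)))
  near fourth         = ∈-++⁺ʳ (column J (suc i) (2 ℕ.+ l)) (col (ℕ.n≤1+n i) (bound {1} (s≤s (s≤s z≤n))))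
  near fifth = ∈-++⁺ʳ (column J (suc i) (2 ℕ.+ l)) (col (ℕ.m≤n+m i 2) (bound {2} (s≤s (s≤s (s≤s z≤n)))))

faces-≤-open : ∀ σ J i k l →
  value (⨁ (rectangle J i k l) faces) σ ℕ.+ value (cellRank (rectangle J i (suc k) (2 ℕ.+ l))) σ ℕ.≤
  value (⨁ (rectangle J i k l) openEdges) σ ℕ.+ boundary k l
faces-≤-open σ J i zero l = ℕ.≤-trans
  (openRank-≤-length (cellEdges (rectangle J i 1 (2 ℕ.+ l))) σ)
  (ℕ.≤-reflexive (trans (length-cellEdges (rectangle J i 1 (2 ℕ.+ l)))
    (cong (ℕ._* 6) (trans (length-rectangle J i 1 (2 ℕ.+ l)) (ℕ.+-identityʳ (2 ℕ.+ l))))))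
faces-≤-open σ J i (suc k) l = begin
  value (⨁ (col ++ rest) faces) σ ℕ.+ value (cellRank (col⁺ ++ rest⁺)) σ
    ≡⟨ cong (ℕ._+ value (cellRank (col⁺ ++ rest⁺)) σ) (⨁-++ col rest faces σ) ⟩
  value (⨁ col faces) σ ℕ.+ value (⨁ rest faces) σ ℕ.+ value (cellRank (col⁺ ++ rest⁺)) σ
    ≤⟨ chain-upper {value (⨁ col openEdges) σ ℕ.+ 12} {boundary k l} {value (cellRank rest⁺) σ}
         {n = value (⨁ col faces) σ} {S = value (⨁ rest openEdges) σ}
         (ℕ.≤-trans (faces-≤-open-column σ J i l rest⁺
            (λ c∈ → proj₁ (proj₁ (∈-rectangle⁻ {suc J} {i} {suc k} {2 ℕ.+ l} c∈)))
            (λ i≤ <l → ∈-++⁺ˡ (∈-column⁺ i≤ <l)))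
           (ℕ.≤-reflexive (sym (ℕ.+-assoc (value (⨁ col openEdges) σ) 12 _))))
         (faces-≤-open σ (suc J) i k l) ⟩
  value (⨁ col openEdges) σ ℕ.+ 12 ℕ.+ value (⨁ rest openEdges) σ ℕ.+ boundary k l
    ≡⟨ rearrange (value (⨁ col openEdges) σ) 12 (value (⨁ rest openEdges) σ) (k ℕ.* 12) ((2 ℕ.+ l) ℕ.* 6) ⟩
  value (⨁ col openEdges) σ ℕ.+ value (⨁ rest openEdges) σ ℕ.+ boundary (suc k) l
    ≡⟨ cong (ℕ._+ boundary (suc k) l) (⨁-++ col rest openEdges σ) ⟨
  value (⨁ (col ++ rest) openEdges) σ ℕ.+ boundary (suc k) l ∎
  where
  open ℕ.≤-Reasoning
  col   = column J i l
  rest  = rectangle (suc J) i k l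
  col⁺  = column J i (2 ℕ.+ l)
  rest⁺ = rectangle (suc J) i (suc k) (2 ℕ.+ l)
  rearrange : ∀ a t b x y → a ℕ.+ t ℕ.+ b ℕ.+ (x ℕ.+ y) ≡ a ℕ.+ b ℕ.+ (t ℕ.+ x ℕ.+ y)
  rearrange = N.solve 5 (λ a t b x y → a N.:+ t N.:+ b N.:+ (x N.:+ y) N.:= a N.:+ b N.:+ (t N.:+ x N.:+ y)) refl

𝔼-⨁-rectangle : ∀ p X {c} → (∀ d → 𝔼 p (X d) ≡ c) → ∀ k l → 𝔼 p (⨁ (rectangle 0 0 k l) X) ≡ ι (k ℕ.* l) ℚ.* c
𝔼-⨁-rectangle p X {c} h k l = trans (𝔼-⨁ p (rectangle 0 0 k l) X (λ {d} _ → h d))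
  (cong (λ n → ι n ℚ.* c) (length-rectangle 0 0 k l))

module _ {p : ℚ} (u : Unit p) where

  Φ-lower : ∀ k l → ι (k ℕ.* l) ℚ.* openDensity p ℚ.≤ ι (k ℕ.* l) ℚ.* closingDensity p ℚ.+ Φ p k l
  Φ-lower k l = begin
    ι (k ℕ.* l) ℚ.* openDensity p    ≡⟨ 𝔼-⨁-rectangle p openEdges (𝔼-openEdges p) k l ⟨
    𝔼 p (⨁ cs openEdges)             ≤⟨ 𝔼-≤-⊕ u (⨁ cs openEdges) (⨁ cs closings) (cellRank cs)
                                          (λ σ → ℕ.≤-trans (ℕ.m≤m+n _ 0) (open-≤-closings σ cs (rectangle-later 0 0 k l))) ⟩
    𝔼 p (⨁ cs closings) ℚ.+ Φ p k l  ≡⟨ cong (ℚ._+ Φ p k l) (𝔼-⨁-rectangle p closings (𝔼-closings p) k l) ⟩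
    ι (k ℕ.* l) ℚ.* closingDensity p ℚ.+ Φ p k l ∎
    where
    open ℚ.≤-Reasoning
    cs = rectangle 0 0 k l

  Φ-upper : ∀ k l → ι (k ℕ.* l) ℚ.* faceDensity p ℚ.+ Φ p (suc k) (2 ℕ.+ l) ℚ.≤
                    ι (k ℕ.* l) ℚ.* openDensity p ℚ.+ ι (boundary k l)
  Φ-upper k l = begin
    ι (k ℕ.* l) ℚ.* faceDensity p ℚ.+ Φ p (suc k) (2 ℕ.+ l)
      ≡⟨ cong (ℚ._+ Φ p (suc k) (2 ℕ.+ l)) (𝔼-⨁-rectangle p faces (𝔼-faces p) k l) ⟨
    𝔼 p (⨁ cs faces) ℚ.+ Φ p (suc k) (2 ℕ.+ l)
      ≡⟨ 𝔼-⊕ p (⨁ cs faces) (cellRank (rectangle 0 0 (suc k) (2 ℕ.+ l))) ⟨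
    𝔼 p (⨁ cs faces ⊕ cellRank (rectangle 0 0 (suc k) (2 ℕ.+ l)))
      ≤⟨ 𝔼-≤-⊕ u (⨁ cs faces ⊕ cellRank (rectangle 0 0 (suc k) (2 ℕ.+ l))) (⨁ cs openEdges) (constant (boundary k l))
           (λ σ → faces-≤-open σ 0 0 k l) ⟩
    𝔼 p (⨁ cs openEdges) ℚ.+ 𝔼 p (constant (boundary k l))
      ≡⟨ cong₂ ℚ._+_ (𝔼-⨁-rectangle p openEdges (𝔼-openEdges p) k l) (𝔼-constant p (boundary k l)) ⟩
    ι (k ℕ.* l) ℚ.* openDensity p ℚ.+ ι (boundary k l) ∎
    where
    open ℚ.≤-Reasoning
    cs = rectangle 0 0 k l

-- Convergence of the rank density

opaque

  inv : ℕ → ℚ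
  inv n = + 1 ℚ./ suc n

  0<inv : ∀ n → 0ℚ ℚ.< inv n
  0<inv n = ℚ.positive⁻¹ (inv n) {{ℚ.normalize-pos 1 (suc n)}}

  ι-inv : ∀ n → ι (suc n) ℚ.* inv n ≡ 1ℚ
  ι-inv n = ι-inverse (suc n)

0≤inv : ∀ n → 0ℚ ℚ.≤ inv n
0≤inv n = ℚ.<⇒≤ (0<inv n)

⅛ : ℚ
⅛ = + 1 ℚ./ 8

-- The shape matches the lattice whose parameter is about `2k`: `k` double columns of hexagons and
-- `2k` rows. Such a rectangle has `2k²` cells and `8k²` sites, the number by which `ρ` divides.
Ψ : ℚ → ℕ → ℚ
Ψ p k = Φ p k (2 ℕ.* k)

ρ : ℚ → ℕ → ℚ
ρ p j = Ψ p (suc j) ℚ.* (inv j ℚ.* inv j ℚ.* ⅛)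

module _ {p : ℚ} (u : Unit p) where

  open ℚ.≤-Reasoning

  -- The gap column is moved to the end of the rectangle, where removing it costs at most its `6l`
  -- edges.
  Φ-+-≥ : ∀ k k′ l → Φ p k l ℚ.+ Φ p k′ l ℚ.≤ Φ p (k ℕ.+ k′) l ℚ.+ ι (l ℕ.* 6)
  Φ-+-≥ k k′ l = begin
    Φ p k l ℚ.+ Φ p k′ l               ≤⟨ Φ-≤-+ u k k′ l ⟩
    Φ p (k ℕ.+ suc k′) l               ≡⟨ cong (λ n → Φ p n l) (trans (ℕ.+-suc k k′) (ℕ.+-comm 1 (k ℕ.+ k′))) ⟩
    Φ p (k ℕ.+ k′ ℕ.+ 1) l             ≤⟨ Φ-+-≤ u (k ℕ.+ k′) 1 l ⟩
    Φ p (k ℕ.+ k′) l ℚ.+ Φ p 1 l       ≤⟨ ℚ.+-monoʳ-≤ (Φ p (k ℕ.+ k′) l) (Φ-bound u 1 l) ⟩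
    Φ p (k ℕ.+ k′) l ℚ.+ ι (1 ℕ.* l ℕ.* 6) ≡⟨ cong (λ n → Φ p (k ℕ.+ k′) l ℚ.+ ι (n ℕ.* 6)) (ℕ.*-identityˡ l) ⟩
    Φ p (k ℕ.+ k′) l ℚ.+ ι (l ℕ.* 6)   ∎

  Φ-+-≥′ : ∀ k l l′ → Φ p k l ℚ.+ Φ p k l′ ℚ.≤ Φ p k (l ℕ.+ l′) ℚ.+ ι (k ℕ.* 6)
  Φ-+-≥′ k l l′ = begin
    Φ p k l ℚ.+ Φ p k l′               ≤⟨ Φ-≤-+′ u k l l′ ⟩
    Φ p k (l ℕ.+ suc l′)               ≡⟨ cong (Φ p k) (trans (ℕ.+-suc l l′) (ℕ.+-comm 1 (l ℕ.+ l′))) ⟩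
    Φ p k (l ℕ.+ l′ ℕ.+ 1)             ≤⟨ Φ-+-≤′ u k (l ℕ.+ l′) 1 ⟩
    Φ p k (l ℕ.+ l′) ℚ.+ Φ p k 1       ≤⟨ ℚ.+-monoʳ-≤ (Φ p k (l ℕ.+ l′)) (Φ-bound u k 1) ⟩
    Φ p k (l ℕ.+ l′) ℚ.+ ι (k ℕ.* 1 ℕ.* 6) ≡⟨ cong (λ n → Φ p k (l ℕ.+ l′) ℚ.+ ι (n ℕ.* 6)) (ℕ.*-identityʳ k) ⟩
    Φ p k (l ℕ.+ l′) ℚ.+ ι (k ℕ.* 6)   ∎

  private
    module Iterate (f : ℕ → ℚ) (f0 : f 0 ℚ.≤ 0ℚ) (0≤f : ∀ n → 0ℚ ℚ.≤ f n) (e : ℕ)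
                   (f-≤ : ∀ m n → f (m ℕ.+ n) ℚ.≤ f m ℚ.+ f n)
                   (f-≥ : ∀ m n → f m ℚ.+ f n ℚ.≤ f (m ℕ.+ n) ℚ.+ ι e) where

      scale-suc : ∀ n x → ι (suc n) ℚ.* x ≡ x ℚ.+ ι n ℚ.* x
      scale-suc n x = trans (cong (ℚ._* x) (ι-+ 1 n)) (solve 2 (λ n x → (con 1ℚ :+ n) :* x := x :+ n :* x) refl (ι n) x)

      upper : ∀ n k → f (n ℕ.* k) ℚ.≤ ι n ℚ.* f k
      upper zero    k = ℚ.≤-trans f0 (ℚ.≤-reflexive (sym (ℚ.*-zeroˡ (f k))))
      upper (suc n) k = begin
        f (k ℕ.+ n ℕ.* k)       ≤⟨ f-≤ k (n ℕ.* k) ⟩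
        f k ℚ.+ f (n ℕ.* k)     ≤⟨ ℚ.+-monoʳ-≤ (f k) (upper n k) ⟩
        f k ℚ.+ ι n ℚ.* f k     ≡⟨ scale-suc n (f k) ⟨
        ι (suc n) ℚ.* f k       ∎

      lower : ∀ n k → ι n ℚ.* f k ℚ.≤ f (n ℕ.* k) ℚ.+ ι (n ℕ.* e)
      lower zero    k = ℚ.≤-trans (ℚ.≤-reflexive (ℚ.*-zeroˡ (f k))) (0≤+ (0≤f 0) (0≤ι 0))
      lower (suc n) k = begin
        ι (suc n) ℚ.* f k                               ≡⟨ scale-suc n (f k) ⟩
        f k ℚ.+ ι n ℚ.* f k                             ≤⟨ ℚ.+-monoʳ-≤ (f k) (lower n k) ⟩
        f k ℚ.+ (f (n ℕ.* k) ℚ.+ ι (n ℕ.* e))           ≡⟨ ℚ.+-assoc (f k) (f (n ℕ.* k)) (ι (n ℕ.* e)) ⟨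
        f k ℚ.+ f (n ℕ.* k) ℚ.+ ι (n ℕ.* e)             ≤⟨ ℚ.+-monoˡ-≤ (ι (n ℕ.* e)) (f-≥ k (n ℕ.* k)) ⟩
        f (suc n ℕ.* k) ℚ.+ ι e ℚ.+ ι (n ℕ.* e)         ≡⟨ ℚ.+-assoc (f (suc n ℕ.* k)) (ι e) (ι (n ℕ.* e)) ⟩
        f (suc n ℕ.* k) ℚ.+ (ι e ℚ.+ ι (n ℕ.* e))       ≡⟨ cong (f (suc n ℕ.* k) ℚ.+_) (ι-+ e (n ℕ.* e)) ⟨
        f (suc n ℕ.* k) ℚ.+ ι (suc n ℕ.* e)             ∎

    module Wide (l : ℕ) = Iterate (λ k → Φ p k l) (Φ-bound u 0 l) (λ k → 0≤Φ u k l) (l ℕ.* 6)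
                                  (λ k k′ → Φ-+-≤ u k k′ l) (λ k k′ → Φ-+-≥ k k′ l)
    module Tall (k : ℕ) = Iterate (Φ p k)
                                  (ℚ.≤-trans (Φ-bound u k 0) (ℚ.≤-reflexive (cong (λ n → ι (n ℕ.* 6)) (ℕ.*-zeroʳ k))))
                                  (0≤Φ u k) (k ℕ.* 6) (Φ-+-≤′ u k) (Φ-+-≥′ k)

  -- The error counts the seams in the tiling by copies of the `k × 2k` rectangle: `k′²` seams of
  -- `6k` edges and `k′` seams of `6 · 2kk′` edges make `18k′²k`. The tiling by the other rectangle
  -- is used for subadditivity, which is free of error.
  Ψ-compare : ∀ k k′ → ι k′ ℚ.* (ι k′ ℚ.* Ψ p k) ℚ.≤ ι k ℚ.* (ι k ℚ.* Ψ p k′) ℚ.+ ι (18 ℕ.* (k′ ℕ.* (k′ ℕ.* k)))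
  Ψ-compare k k′ = begin
    ι k′ ℚ.* (ι k′ ℚ.* Ψ p k)
      ≤⟨ *-monoˡ (0≤ι k′) (Tall.lower k k′ (2 ℕ.* k)) ⟩
    ι k′ ℚ.* (Φ p k Λ ℚ.+ ι (k′ ℕ.* (k ℕ.* 6)))
      ≡⟨ ℚ.*-distribˡ-+ (ι k′) (Φ p k Λ) _ ⟩
    ι k′ ℚ.* Φ p k Λ ℚ.+ ι k′ ℚ.* ι (k′ ℕ.* (k ℕ.* 6))
      ≤⟨ ℚ.+-mono-≤ (Wide.lower Λ k′ k) (ℚ.≤-reflexive (sym (ι-* k′ (k′ ℕ.* (k ℕ.* 6))))) ⟩
    Φ p (k′ ℕ.* k) Λ ℚ.+ ι (k′ ℕ.* (Λ ℕ.* 6)) ℚ.+ ι (k′ ℕ.* (k′ ℕ.* (k ℕ.* 6)))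
      ≡⟨ trans (ℚ.+-assoc (Φ p (k′ ℕ.* k) Λ) _ _) (cong₂ ℚ._+_ same (trans (sym (ι-+ (k′ ℕ.* (Λ ℕ.* 6)) _)) (cong ι (total k k′)))) ⟩
    Φ p (k ℕ.* k′) (k ℕ.* (2 ℕ.* k′)) ℚ.+ ι (18 ℕ.* (k′ ℕ.* (k′ ℕ.* k)))
      ≤⟨ ℚ.+-monoˡ-≤ _ (ℚ.≤-trans (Wide.upper (k ℕ.* (2 ℕ.* k′)) k k′) (*-monoˡ (0≤ι k) (Tall.upper k′ k (2 ℕ.* k′)))) ⟩
    ι k ℚ.* (ι k ℚ.* Ψ p k′) ℚ.+ ι (18 ℕ.* (k′ ℕ.* (k′ ℕ.* k))) ∎
    where
    Λ = k′ ℕ.* (2 ℕ.* k)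
    same : Φ p (k′ ℕ.* k) Λ ≡ Φ p (k ℕ.* k′) (k ℕ.* (2 ℕ.* k′))
    same = cong₂ (Φ p) (ℕ.*-comm k′ k)
      (N.solve 2 (λ k k′ → k′ N.:* (N.con 2 N.:* k) N.:= k N.:* (N.con 2 N.:* k′)) refl k k′)
    total : ∀ k k′ → k′ ℕ.* (k′ ℕ.* (2 ℕ.* k) ℕ.* 6) ℕ.+ k′ ℕ.* (k′ ℕ.* (k ℕ.* 6)) ≡ 18 ℕ.* (k′ ℕ.* (k′ ℕ.* k))
    total = N.solve 2 (λ k k′ → k′ N.:* (k′ N.:* (N.con 2 N.:* k) N.:* N.con 6) N.:+ k′ N.:* (k′ N.:* (k N.:* N.con 6)) N.:=
      N.con 18 N.:* (k′ N.:* (k′ N.:* k))) refl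

  0≤ρ : ∀ j → 0ℚ ℚ.≤ ρ p j
  0≤ρ j = 0≤* (0≤Φ u (suc j) (2 ℕ.* suc j)) (0≤* (0≤* (0≤inv j) (0≤inv j)) (0≤1/ 8))

  ρ-compare : ∀ j j′ → ρ p j ℚ.≤ ρ p j′ ℚ.+ ι 3 ℚ.* inv j
  ρ-compare j j′ = begin
    ρ p j
      ≡⟨ cancel κ′ i′ (Ψ p k) (i ℚ.* i ℚ.* ⅛) (ι-inv j′) ⟨
    κ′ ℚ.* (κ′ ℚ.* Ψ p k) ℚ.* w
      ≤⟨ *-monoʳ (0≤* (0≤* (0≤inv j′) (0≤inv j′)) (0≤* (0≤* (0≤inv j) (0≤inv j)) (0≤1/ 8))) (Ψ-compare k k′) ⟩
    (κ ℚ.* (κ ℚ.* Ψ p k′) ℚ.+ ι (18 ℕ.* (k′ ℕ.* (k′ ℕ.* k)))) ℚ.* w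
      ≡⟨ trans (ℚ.*-distribʳ-+ w (κ ℚ.* (κ ℚ.* Ψ p k′)) _) (cong₂ ℚ._+_ main-term error-term) ⟩
    ρ p j′ ℚ.+ ι 18 ℚ.* ⅛ ℚ.* i
      -- 18/8 is rounded up to 3.
      ≤⟨ ℚ.+-monoʳ-≤ (ρ p j′) (*-monoʳ (0≤inv j) (ℚ.≤ᵇ⇒≤ {ι 18 ℚ.* ⅛} {ι 3} _)) ⟩
    ρ p j′ ℚ.+ ι 3 ℚ.* i ∎
    where
    k = suc j
    k′ = suc j′
    κ = ι k
    κ′ = ι k′
    i = inv j
    i′ = inv j′
    w = i′ ℚ.* i′ ℚ.* (i ℚ.* i ℚ.* ⅛)
    cancel : ∀ κ i x v → κ ℚ.* i ≡ 1ℚ → κ ℚ.* (κ ℚ.* x) ℚ.* (i ℚ.* i ℚ.* v) ≡ x ℚ.* v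
    cancel κ i x v e = trans
      (solve 4 (λ κ i x v → κ :* (κ :* x) :* (i :* i :* v) := (κ :* i) :* (κ :* i) :* (x :* v)) refl κ i x v)
      (trans (cong (λ t → t ℚ.* t ℚ.* (x ℚ.* v)) e) (ℚ.*-identityˡ (x ℚ.* v)))
    main-term : κ ℚ.* (κ ℚ.* Ψ p k′) ℚ.* w ≡ ρ p j′
    main-term = trans (cong (κ ℚ.* (κ ℚ.* Ψ p k′) ℚ.*_)
        (solve 3 (λ i i′ e → i′ :* i′ :* (i :* i :* e) := i :* i :* (i′ :* i′ :* e)) refl i i′ ⅛))
      (cancel κ i (Ψ p k′) (i′ ℚ.* i′ ℚ.* ⅛) (ι-inv j))
    error-term : ι (18 ℕ.* (k′ ℕ.* (k′ ℕ.* k))) ℚ.* w ≡ ι 18 ℚ.* ⅛ ℚ.* i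
    error-term = trans (cong (ℚ._* w) (trans (ι-* 18 (k′ ℕ.* (k′ ℕ.* k))) (cong (ι 18 ℚ.*_) (trans (ι-* k′ (k′ ℕ.* k)) (cong (κ′ ℚ.*_) (ι-* k′ k))))))
      (trans (solve 6 (λ c κ κ′ i i′ e → c :* (κ′ :* (κ′ :* κ)) :* (i′ :* i′ :* (i :* i :* e)) :=
               (κ′ :* i′) :* (κ′ :* i′) :* (κ :* i) :* (c :* e :* i)) refl (ι 18) κ κ′ i i′ ⅛)
      (trans (cong₂ (λ s t → s ℚ.* s ℚ.* t ℚ.* (ι 18 ℚ.* ⅛ ℚ.* i)) (ι-inv j′) (ι-inv j)) (ℚ.*-identityˡ _)))

  private
    -- The factor `ι 2 * ⅛` is the number of cells per site, `2k² / 8k²`.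
    κκw : ∀ j x → ι (suc j ℕ.* (2 ℕ.* suc j)) ℚ.* x ℚ.* (inv j ℚ.* inv j ℚ.* ⅛) ≡ ι 2 ℚ.* ⅛ ℚ.* x
    κκw j x = begin-equality
      ι (k ℕ.* (2 ℕ.* k)) ℚ.* x ℚ.* (i ℚ.* i ℚ.* ⅛)
        ≡⟨ cong (λ n → n ℚ.* x ℚ.* (i ℚ.* i ℚ.* ⅛)) (trans (ι-* k (2 ℕ.* k)) (cong (κ ℚ.*_) (ι-* 2 k))) ⟩
      κ ℚ.* (ι 2 ℚ.* κ) ℚ.* x ℚ.* (i ℚ.* i ℚ.* ⅛)
        ≡⟨ solve 5 (λ κ i t e x → κ :* (t :* κ) :* x :* (i :* i :* e) := (κ :* i) :* (κ :* i) :* (t :* e :* x)) refl κ i (ι 2) ⅛ x ⟩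
      (κ ℚ.* i) ℚ.* (κ ℚ.* i) ℚ.* (ι 2 ℚ.* ⅛ ℚ.* x)
        ≡⟨ cong (λ s → s ℚ.* s ℚ.* (ι 2 ℚ.* ⅛ ℚ.* x)) (ι-inv j) ⟩
      1ℚ ℚ.* 1ℚ ℚ.* (ι 2 ℚ.* ⅛ ℚ.* x)
        ≡⟨ ℚ.*-identityˡ (ι 2 ℚ.* ⅛ ℚ.* x) ⟩
      ι 2 ℚ.* ⅛ ℚ.* x ∎
      where
      k = suc j
      κ = ι (suc j)
      i = inv j

    0≤w : ∀ j → 0ℚ ℚ.≤ inv j ℚ.* inv j ℚ.* ⅛
    0≤w j = 0≤* (0≤* (0≤inv j) (0≤inv j)) (0≤1/ 8)

    κw : ∀ j c → ι (c ℕ.* suc j) ℚ.* (inv j ℚ.* inv j ℚ.* ⅛) ≡ ι c ℚ.* ⅛ ℚ.* inv j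
    κw j c = trans (cong (ℚ._* (i ℚ.* i ℚ.* ⅛)) (ι-* c (suc j)))
      (trans (solve 4 (λ c κ i e → c :* κ :* (i :* i :* e) := (κ :* i) :* (c :* e :* i)) refl (ι c) (ι (suc j)) i ⅛)
        (trans (cong (ℚ._* (ι c ℚ.* ⅛ ℚ.* i)) (ι-inv j)) (ℚ.*-identityˡ (ι c ℚ.* ⅛ ℚ.* i))))
      where i = inv j

  ρ-lower : ∀ j → ι 2 ℚ.* ⅛ ℚ.* openDensity p ℚ.≤ ι 2 ℚ.* ⅛ ℚ.* closingDensity p ℚ.+ ρ p j
  ρ-lower j = begin
    ι 2 ℚ.* ⅛ ℚ.* openDensity p          ≡⟨ κκw j (openDensity p) ⟨
    ι kl ℚ.* openDensity p ℚ.* w         ≤⟨ *-monoʳ (0≤w j) (Φ-lower u (suc j) (2 ℕ.* suc j)) ⟩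
    (ι kl ℚ.* closingDensity p ℚ.+ Ψ p (suc j)) ℚ.* w ≡⟨ ℚ.*-distribʳ-+ w (ι kl ℚ.* closingDensity p) (Ψ p (suc j)) ⟩
    ι kl ℚ.* closingDensity p ℚ.* w ℚ.+ ρ p j         ≡⟨ cong (ℚ._+ ρ p j) (κκw j (closingDensity p)) ⟩
    ι 2 ℚ.* ⅛ ℚ.* closingDensity p ℚ.+ ρ p j ∎
    where
    kl = suc j ℕ.* (2 ℕ.* suc j)
    w = inv j ℚ.* inv j ℚ.* ⅛

  ρ-upper : 0ℚ ℚ.≤ openDensity p ℚ.- faceDensity p → ∀ j →
            ρ p j ℚ.≤ ι 2 ℚ.* ⅛ ℚ.* (openDensity p ℚ.- faceDensity p) ℚ.+ ι 3 ℚ.* inv j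
  ρ-upper 0≤ j = begin
    Ψ p (suc j) ℚ.* w
      ≤⟨ *-monoʳ (0≤w j) Ψ≤ ⟩
    (ι kl ℚ.* gap ℚ.+ ι (24 ℕ.* suc j)) ℚ.* w
      ≡⟨ ℚ.*-distribʳ-+ w (ι kl ℚ.* gap) (ι (24 ℕ.* suc j)) ⟩
    ι kl ℚ.* gap ℚ.* w ℚ.+ ι (24 ℕ.* suc j) ℚ.* w
      ≡⟨ cong₂ ℚ._+_ (κκw j gap) (κw j 24) ⟩
    ι 2 ℚ.* ⅛ ℚ.* gap ℚ.+ ι 24 ℚ.* ⅛ ℚ.* inv j
      ≤⟨ ℚ.+-monoʳ-≤ (ι 2 ℚ.* ⅛ ℚ.* gap) (*-monoʳ (0≤inv j) (ℚ.≤ᵇ⇒≤ {ι 24 ℚ.* ⅛} {ι 3} _)) ⟩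
    ι 2 ℚ.* ⅛ ℚ.* gap ℚ.+ ι 3 ℚ.* inv j ∎
    where
    w = inv j ℚ.* inv j ℚ.* ⅛
    gap = openDensity p ℚ.- faceDensity p
    kl = suc j ℕ.* (2 ℕ.* suc j)
    jl = j ℕ.* (2 ℕ.* j)
    boundary≤ : boundary j (2 ℕ.* j) ℕ.≤ 24 ℕ.* suc j
    boundary≤ = ℕ.≤-trans (ℕ.m≤m+n _ 12) (ℕ.≤-reflexive (N.solve 1 (λ j →
      j N.:* N.con 12 N.:+ (N.con 2 N.:+ N.con 2 N.:* j) N.:* N.con 6 N.:+ N.con 12 N.:= N.con 24 N.:* (N.con 1 N.:+ j)) refl j))
    Ψ≤ : Ψ p (suc j) ℚ.≤ ι kl ℚ.* gap ℚ.+ ι (24 ℕ.* suc j)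
    Ψ≤ = begin
      Φ p (suc j) (2 ℕ.* suc j)
        -- The margin of one column and two rows enlarges `j × 2j` to precisely the next rectangle
        -- of the same shape.
        ≡⟨ cong (Φ p (suc j)) (ℕ.*-suc 2 j) ⟩
      Φ p (suc j) (2 ℕ.+ 2 ℕ.* j)
        ≡⟨ solve 2 (λ f x → x := (f :+ x) :- f) refl (ι jl ℚ.* faceDensity p) _ ⟩
      (ι jl ℚ.* faceDensity p ℚ.+ Φ p (suc j) (2 ℕ.+ 2 ℕ.* j)) ℚ.- ι jl ℚ.* faceDensity p
        ≤⟨ ℚ.+-monoˡ-≤ (ℚ.- (ι jl ℚ.* faceDensity p)) (Φ-upper u j (2 ℕ.* j)) ⟩
      (ι jl ℚ.* openDensity p ℚ.+ ι (boundary j (2 ℕ.* j))) ℚ.- ι jl ℚ.* faceDensity p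
        ≡⟨ solve 4 (λ n o f b → (n :* o :+ b) :- n :* f := n :* (o :- f) :+ b) refl (ι jl) (openDensity p) (faceDensity p) _ ⟩
      ι jl ℚ.* gap ℚ.+ ι (boundary j (2 ℕ.* j))
        -- Passing from the `j · 2j` counted cells to all cells of the larger rectangle increases
        -- the term because `gap` is nonnegative.
        ≤⟨ ℚ.+-mono-≤ (*-monoʳ 0≤ (ι-mono (ℕ.*-mono-≤ (ℕ.n≤1+n j) (ℕ.*-monoʳ-≤ 2 (ℕ.n≤1+n j))))) (ι-mono boundary≤) ⟩
      ι kl ℚ.* gap ℚ.+ ι (24 ℕ.* suc j) ∎

  -- Six edges for every four sites give at most 3/2.
  ρ≤2 : ∀ j → ρ p j ℚ.≤ ι 2
  ρ≤2 j = begin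
    Ψ p (suc j) ℚ.* w        ≤⟨ *-monoʳ (0≤w j) (Φ-bound u (suc j) (2 ℕ.* suc j)) ⟩
    ι (kl ℕ.* 6) ℚ.* w       ≡⟨ cong (ℚ._* w) (ι-* kl 6) ⟩
    ι kl ℚ.* ι 6 ℚ.* w       ≡⟨ κκw j (ι 6) ⟩
    ι 2 ℚ.* ⅛ ℚ.* ι 6        ≤⟨ ℚ.≤ᵇ⇒≤ {ι 2 ℚ.* ⅛ ℚ.* ι 6} {ι 2} _ ⟩
    ι 2                      ∎
    where
    w = inv j ℚ.* inv j ℚ.* ⅛
    kl = suc j ℕ.* (2 ℕ.* suc j)

  -- `R` and `n` will be the mean rank and the number of vertices of the lattice with parameter `2k`
  -- or `2k + 1`, where `k` is `suc j`.
  module _ (j n : ℕ) .{{_ : NonZero n}} (R : ℚ)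
           (R≤ : R ℚ.≤ Ψ p (suc j) ℚ.+ ι (28 ℕ.* suc j)) (≤R : Ψ p (suc j) ℚ.≤ R ℚ.+ ι (6 ℕ.* suc j))
           (≤n : 8 ℕ.* (suc j ℕ.* suc j) ℕ.≤ n) (n≤ : n ℕ.≤ 8 ℕ.* (suc j ℕ.* suc j) ℕ.+ 26 ℕ.* suc j) where

    private
      k = suc j
      κ = ι k
      i = inv j
      η = + 1 ℚ./ n
      w = i ℚ.* i ℚ.* ⅛
      M = 8 ℕ.* (k ℕ.* k)

      0≤η : 0ℚ ℚ.≤ η
      0≤η = 0≤1/ n

      M-expand : ι M ≡ ι 8 ℚ.* (κ ℚ.* κ)
      M-expand = trans (ι-* 8 (k ℕ.* k)) (cong (ι 8 ℚ.*_) (ι-* k k))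

      Ψ≡ : Ψ p k ≡ ρ p j ℚ.* ι M
      Ψ≡ = sym (begin-equality
        Ψ p k ℚ.* w ℚ.* ι M                    ≡⟨ cong (Ψ p k ℚ.* w ℚ.*_) M-expand ⟩
        Ψ p k ℚ.* w ℚ.* (ι 8 ℚ.* (κ ℚ.* κ))    ≡⟨ solve 5 (λ x κ i e t → x :* (i :* i :* e) :* (t :* (κ :* κ)) :=
                                                    (κ :* i) :* (κ :* i) :* (x :* (t :* e))) refl (Ψ p k) κ i ⅛ (ι 8) ⟩
        (κ ℚ.* i) ℚ.* (κ ℚ.* i) ℚ.* (Ψ p k ℚ.* (ι 8 ℚ.* ⅛)) ≡⟨ cong (λ s → s ℚ.* s ℚ.* (Ψ p k ℚ.* 1ℚ)) (ι-inv j) ⟩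
        1ℚ ℚ.* 1ℚ ℚ.* (Ψ p k ℚ.* 1ℚ)           ≡⟨ solve 1 (λ x → con 1ℚ :* con 1ℚ :* (x :* con 1ℚ) := x) refl (Ψ p k) ⟩
        Ψ p k                                  ∎)

      Mη≤1 : ι M ℚ.* η ℚ.≤ 1ℚ
      Mη≤1 = ℚ.≤-trans (*-monoʳ 0≤η (ι-mono ≤n)) (ℚ.≤-reflexive (ι-inverse n))

      κη≤i : κ ℚ.* η ℚ.≤ i
      κη≤i = begin
        κ ℚ.* η                    ≡⟨ trans (cong (ℚ._* (κ ℚ.* η)) (ι-inv j)) (ℚ.*-identityˡ (κ ℚ.* η)) ⟨
        (κ ℚ.* i) ℚ.* (κ ℚ.* η)    ≡⟨ solve 3 (λ κ i η → (κ :* i) :* (κ :* η) := i :* (κ :* κ :* η)) refl κ i η ⟩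
        i ℚ.* (κ ℚ.* κ ℚ.* η)      ≤⟨ *-monoˡ (0≤inv j) (*-monoʳ 0≤η κκ≤M) ⟩
        i ℚ.* (ι M ℚ.* η)          ≤⟨ *-monoˡ (0≤inv j) Mη≤1 ⟩
        i ℚ.* 1ℚ                   ≡⟨ ℚ.*-identityʳ i ⟩
        i                          ∎
        where
        κκ≤M : κ ℚ.* κ ℚ.≤ ι M
        κκ≤M = ℚ.≤-trans (ℚ.≤-reflexive (sym (ι-* k k))) (ι-mono (ℕ.m≤n*m (k ℕ.* k) 8))

      cκη : ∀ c → ι (c ℕ.* k) ℚ.* η ℚ.≤ ι c ℚ.* i
      cκη c = begin
        ι (c ℕ.* k) ℚ.* η    ≡⟨ trans (cong (ℚ._* η) (ι-* c k)) (ℚ.*-assoc (ι c) κ η) ⟩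
        ι c ℚ.* (κ ℚ.* η)    ≤⟨ *-monoˡ (0≤ι c) κη≤i ⟩
        ι c ℚ.* i            ∎

    density-≤ : R ℚ.* η ℚ.≤ ρ p j ℚ.+ ι 28 ℚ.* i
    density-≤ = begin
      R ℚ.* η                                            ≤⟨ *-monoʳ 0≤η R≤ ⟩
      (Ψ p k ℚ.+ ι (28 ℕ.* k)) ℚ.* η                     ≡⟨ ℚ.*-distribʳ-+ η (Ψ p k) (ι (28 ℕ.* k)) ⟩
      Ψ p k ℚ.* η ℚ.+ ι (28 ℕ.* k) ℚ.* η                 ≡⟨ cong (λ x → x ℚ.* η ℚ.+ ι (28 ℕ.* k) ℚ.* η) Ψ≡ ⟩
      ρ p j ℚ.* ι M ℚ.* η ℚ.+ ι (28 ℕ.* k) ℚ.* η         ≡⟨ cong (ℚ._+ ι (28 ℕ.* k) ℚ.* η) (ℚ.*-assoc (ρ p j) (ι M) η) ⟩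
      ρ p j ℚ.* (ι M ℚ.* η) ℚ.+ ι (28 ℕ.* k) ℚ.* η       ≤⟨ ℚ.+-mono-≤ (*-monoˡ (0≤ρ j) Mη≤1) (cκη 28) ⟩
      ρ p j ℚ.* 1ℚ ℚ.+ ι 28 ℚ.* i                        ≡⟨ cong (ℚ._+ ι 28 ℚ.* i) (ℚ.*-identityʳ (ρ p j)) ⟩
      ρ p j ℚ.+ ι 28 ℚ.* i                               ∎

    -- The constant 58 is 6, from the mean rank, plus 2 · 26, from the up to `26k` additional
    -- vertices at a density of at most 2.
    ≤-density : ρ p j ℚ.≤ R ℚ.* η ℚ.+ ι 58 ℚ.* i
    ≤-density = begin
      ρ p j                                              ≡⟨ ℚ.*-identityʳ (ρ p j) ⟨
      ρ p j ℚ.* 1ℚ                                       ≡⟨ cong (ρ p j ℚ.*_) (ι-inverse n) ⟨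
      ρ p j ℚ.* (ι n ℚ.* η)                              ≡⟨ ℚ.*-assoc (ρ p j) (ι n) η ⟨
      ρ p j ℚ.* ι n ℚ.* η                                ≤⟨ *-monoʳ 0≤η (*-monoˡ (0≤ρ j) (ι-mono n≤)) ⟩
      ρ p j ℚ.* ι (M ℕ.+ 26 ℕ.* k) ℚ.* η                 ≡⟨ cong (ℚ._* η) (trans (cong (ρ p j ℚ.*_) (ι-+ M (26 ℕ.* k)))
                                                              (ℚ.*-distribˡ-+ (ρ p j) (ι M) (ι (26 ℕ.* k)))) ⟩
      (ρ p j ℚ.* ι M ℚ.+ ρ p j ℚ.* ι (26 ℕ.* k)) ℚ.* η   ≤⟨ *-monoʳ 0≤η (ℚ.+-mono-≤ (ℚ.≤-trans (ℚ.≤-reflexive (sym Ψ≡)) ≤R)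
                                                              (*-monoʳ (0≤ι (26 ℕ.* k)) (ρ≤2 j))) ⟩
      (R ℚ.+ ι (6 ℕ.* k) ℚ.+ ι 2 ℚ.* ι (26 ℕ.* k)) ℚ.* η ≡⟨ cong (ℚ._* η) collect ⟩
      (R ℚ.+ ι (58 ℕ.* k)) ℚ.* η                         ≡⟨ ℚ.*-distribʳ-+ η R (ι (58 ℕ.* k)) ⟩
      R ℚ.* η ℚ.+ ι (58 ℕ.* k) ℚ.* η                     ≤⟨ ℚ.+-monoʳ-≤ (R ℚ.* η) (cκη 58) ⟩
      R ℚ.* η ℚ.+ ι 58 ℚ.* i                             ∎
      where
      collect : R ℚ.+ ι (6 ℕ.* k) ℚ.+ ι 2 ℚ.* ι (26 ℕ.* k) ≡ R ℚ.+ ι (58 ℕ.* k)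
      collect = trans (ℚ.+-assoc R (ι (6 ℕ.* k)) _) (cong (R ℚ.+_) (trans (cong (ι (6 ℕ.* k) ℚ.+_) (sym (ι-* 2 (26 ℕ.* k))))
        (trans (sym (ι-+ (6 ℕ.* k) (2 ℕ.* (26 ℕ.* k)))) (cong ι (N.solve 1 (λ k → N.con 6 N.:* k N.:+ N.con 2 N.:* (N.con 26 N.:* k) N.:= N.con 58 N.:* k) refl k)))))

-- The hexagonal lattice between two rectangles

abscissa ordinate : Fin 4 → ℕ
abscissa zero                   = 0
abscissa (suc zero)             = 1
abscissa (suc (suc zero))       = 3
abscissa (suc (suc (suc zero))) = 4
ordinate zero                   = 1
ordinate (suc zero)             = 0
ordinate (suc (suc zero))       = 2
ordinate (suc (suc (suc zero))) = 1

point : Site → Point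
point (t , J , i) = 3 ℕ.* (2 ℕ.* J) ℕ.+ abscissa t , 2 ℕ.* i ℕ.+ ordinate t

-- The abscissae of the four kinds are 0, 1, 3 and 4 modulo 6, so the kind of a site can be
-- recovered from its point.
point-injective : ∀ {s s′} → point s ≡ point s′ → s ≡ s′
point-injective {t , J , i} {t′ , J′ , i′} e = same t≡t′ e
  where
  kind : ℕ → Fin 4
  kind 0 = zero
  kind 1 = suc zero
  kind 3 = suc (suc zero)
  kind _ = suc (suc (suc zero))
  kind-abscissa : ∀ t → kind (abscissa t % 6) ≡ t
  kind-abscissa zero                   = refl
  kind-abscissa (suc zero)             = refl
  kind-abscissa (suc (suc zero))       = refl
  kind-abscissa (suc (suc (suc zero))) = refl
  residue : ∀ J t → (3 ℕ.* (2 ℕ.* J) ℕ.+ abscissa t) % 6 ≡ abscissa t % 6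
  residue J t = trans (cong (_% 6) (N.solve 2 (λ J x → N.con 3 N.:* (N.con 2 N.:* J) N.:+ x N.:= x N.:+ J N.:* N.con 6) refl J (abscissa t)))
                      (ℕ.[m+kn]%n≡m%n (abscissa t) J 6)
  t≡t′ : t ≡ t′
  t≡t′ = trans (sym (kind-abscissa t)) (trans (cong kind (trans (sym (residue J t))
    (trans (cong (λ x → proj₁ x % 6) e) (residue J′ t′)))) (kind-abscissa t′))
  same : t ≡ t′ → point (t , J , i) ≡ point (t′ , J′ , i′) → (t , J , i) ≡ (t′ , J′ , i′)
  same refl e = cong₂ (λ a b → t , a , b)
    (ℕ.*-cancelˡ-≡ J J′ 2 (ℕ.*-cancelˡ-≡ (2 ℕ.* J) (2 ℕ.* J′) 3 (ℕ.+-cancelʳ-≡ (abscissa t) _ _ (cong proj₁ e))))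
    (ℕ.*-cancelˡ-≡ i i′ 2 (ℕ.+-cancelʳ-≡ (ordinate t) _ _ (cong proj₂ e)))

module Embedding = PercolationMap _≟ₛ_ _≟ₚ_ point point-injective
open Embedding using () renaming (τ² to point²)

even%2 : ∀ J → (2 ℕ.* J) % 2 ≡ 0
even%2 J = trans (cong (_% 2) (ℕ.*-comm 2 J)) (ℕ.m*n%n≡0 J 2)

odd%2 : ∀ J → (1 ℕ.+ 2 ℕ.* J) % 2 ≡ 1
odd%2 J = trans (cong (λ n → (1 ℕ.+ n) % 2) (ℕ.*-comm 2 J)) (ℕ.[m+kn]%n≡m%n 1 J 2)

parity : ∀ j → ∃[ J ] (j ≡ 2 ℕ.* J ⊎ j ≡ 1 ℕ.+ 2 ℕ.* J)
parity zero = 0 , inj₁ refl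
parity (suc j) with parity j
... | J , inj₁ e = J , inj₂ (cong suc e)
... | J , inj₂ e = suc J , inj₁ (trans (cong suc e) (sym (ℕ.*-suc 2 J)))

bottomPoint : ℕ → Point
bottomPoint J = 3 ℕ.* (2 ℕ.* J) ℕ.+ 3 , 0

bottomEdges : ℕ → List Pt.Edge
bottomEdges J = (point (B J 0) , bottomPoint J) ∷ (bottomPoint J , point (D J 0)) ∷ []

module Even (i J : ℕ) where

  open Hexagon i (2 ℕ.* J) public

  b≡ : b ≡ 2 ℕ.* i
  b≡ = trans (cong (2 ℕ.* i ℕ.+_) (even%2 J)) (ℕ.+-identityʳ (2 ℕ.* i))

  c₀≡ : c₀ ≡ point (D J i)
  c₀≡ = cong (λ b → a ℕ.+ 4 , b ℕ.+ 1) b≡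
  c₁≡ : c₁ ≡ point (C J i)
  c₁≡ = cong (λ b → a ℕ.+ 3 , b ℕ.+ 2) b≡
  c₂≡ : c₂ ≡ point (B J (suc i))
  c₂≡ = trans (cong (λ b → a ℕ.+ 1 , b ℕ.+ 2) b≡)
    (cong (a ℕ.+ 1 ,_) (N.solve 1 (λ i → N.con 2 N.:* i N.:+ N.con 2 N.:= N.con 2 N.:* (N.con 1 N.:+ i) N.:+ N.con 0) refl i))
  c₃≡ : c₃ ≡ point (A J i)
  c₃≡ = cong₂ _,_ (sym (ℕ.+-identityʳ a)) (cong (ℕ._+ 1) b≡)
  c₄≡ : c₄ ≡ point (B J i)
  c₄≡ = cong (a ℕ.+ 1 ,_) (trans b≡ (sym (ℕ.+-identityʳ (2 ℕ.* i))))

c₅-below : ∀ J → Even.c₅ 0 J ≡ bottomPoint J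
c₅-below J = cong (3 ℕ.* (2 ℕ.* J) ℕ.+ 3 ,_) (Even.b≡ 0 J)

c₅-inner : ∀ i J → Even.c₅ (suc i) J ≡ point (C J i)
c₅-inner i J = cong (3 ℕ.* (2 ℕ.* J) ℕ.+ 3 ,_) (trans (Even.b≡ (suc i) J)
  (N.solve 1 (λ i → N.con 2 N.:* (N.con 1 N.:+ i) N.:= N.con 2 N.:* i N.:+ N.con 2) refl i))

module Odd (i J : ℕ) where

  open Hexagon i (1 ℕ.+ 2 ℕ.* J) public

  b≡ : b ≡ 2 ℕ.* i ℕ.+ 1
  b≡ = cong (2 ℕ.* i ℕ.+_) (odd%2 J)

  a-next : ∀ n → a ℕ.+ (3 ℕ.+ n) ≡ 3 ℕ.* (2 ℕ.* suc J) ℕ.+ n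
  a-next = N.solve 2 (λ J n → N.con 3 N.:* (N.con 1 N.:+ N.con 2 N.:* J) N.:+ (N.con 3 N.:+ n) N.:=
    N.con 3 N.:* (N.con 2 N.:* (N.con 1 N.:+ J)) N.:+ n) refl J

  a-same : ∀ n → a ℕ.+ n ≡ 3 ℕ.* (2 ℕ.* J) ℕ.+ (3 ℕ.+ n)
  a-same = N.solve 2 (λ J n → N.con 3 N.:* (N.con 1 N.:+ N.con 2 N.:* J) N.:+ n N.:=
    N.con 3 N.:* (N.con 2 N.:* J) N.:+ (N.con 3 N.:+ n)) refl J

  b-next : ∀ n → b ℕ.+ (1 ℕ.+ n) ≡ 2 ℕ.* suc i ℕ.+ n
  b-next n = trans (cong (ℕ._+ (1 ℕ.+ n)) b≡) (N.solve 2 (λ i n → N.con 2 N.:* i N.:+ N.con 1 N.:+ (N.con 1 N.:+ n) N.:=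
    N.con 2 N.:* (N.con 1 N.:+ i) N.:+ n) refl i n)

  b-same : b ℕ.+ 1 ≡ 2 ℕ.* i ℕ.+ 2
  b-same = trans (cong (ℕ._+ 1) b≡) (ℕ.+-assoc (2 ℕ.* i) 1 1)

  c₀≡ : c₀ ≡ point (B (suc J) (suc i))
  c₀≡ = cong₂ _,_ (a-next 1) (b-next 0)
  c₁≡ : c₁ ≡ point (A (suc J) (suc i))
  c₁≡ = cong₂ _,_ (a-next 0) (b-next 1)
  c₂≡ : c₂ ≡ point (D J (suc i))
  c₂≡ = cong₂ _,_ (a-same 1) (b-next 1)
  c₃≡ : c₃ ≡ point (C J i)
  c₃≡ = cong₂ _,_ (trans (sym (ℕ.+-identityʳ a)) (a-same 0)) b-same
  c₄≡ : c₄ ≡ point (D J i)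
  c₄≡ = cong₂ _,_ (a-same 1) b≡
  c₅≡ : c₅ ≡ point (A (suc J) i)
  c₅≡ = cong₂ _,_ (a-next 0) b≡

hexagon∈ : ∀ {m i j} → j ℕ.< m → i ℕ.< m ∸ j % 2 → (i , j) ∈ hexagons m
hexagon∈ {m} {i} {j} j< i< = ∈-concatMap⁺ (λ j → map (λ i → i , j) (upTo (m ∸ j % 2)))
  (lose (∈-upTo⁺ j<) (∈-map⁺ (λ i → i , j) (∈-upTo⁺ i<)))

∈hexagon : ∀ m {i j} → (i , j) ∈ hexagons m → j ℕ.< m × i ℕ.< m ∸ j % 2
∈hexagon m h∈ with find (∈-concatMap⁻ (λ j → map (λ i → i , j) (upTo (m ∸ j % 2))) {xs = upTo m} h∈)
... | j , j∈ , k with ∈-map⁻ (λ i → i , j) k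
... | i , i∈ , refl = ∈-upTo⁻ j∈ , ∈-upTo⁻ i∈

suc<⇐<∸1 : ∀ {i m} → i ℕ.< m ∸ 1 → suc i ℕ.< m
suc<⇐<∸1 {m = suc m} i< = s≤s i<

<∸1⇐suc< : ∀ {i m} → suc i ℕ.< m → i ℕ.< m ∸ 1
<∸1⇐suc< (s≤s i<) = i<

-- Columns of odd index have one hexagon less; `suc i < m` expresses this without truncated
-- subtraction.
data Position (m : ℕ) : ℕ × ℕ → Set where
  even : ∀ i J → 2 ℕ.* J ℕ.< m → i ℕ.< m → Position m (i , 2 ℕ.* J)
  odd  : ∀ i J → 1 ℕ.+ 2 ℕ.* J ℕ.< m → suc i ℕ.< m → Position m (i , 1 ℕ.+ 2 ℕ.* J)

position : ∀ m {h} → h ∈ hexagons m → Position m h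
position m {i , j} h∈ with ∈hexagon m h∈ | parity j
... | j< , i< | J , inj₁ refl = even i J j< (ℕ.<-≤-trans i< (ℕ.m∸n≤m m ((2 ℕ.* J) % 2)))
... | j< , i< | J , inj₂ refl = odd i J j< (suc<⇐<∸1 (subst (λ n → i ℕ.< m ∸ n) (odd%2 J) i<))

evenHexagon∈ : ∀ {m i J} → 2 ℕ.* J ℕ.< m → i ℕ.< m → (i , 2 ℕ.* J) ∈ hexagons m
evenHexagon∈ {m} {i} {J} j< i< = hexagon∈ j< (subst (λ n → i ℕ.< m ∸ n) (sym (even%2 J)) i<)

oddHexagon∈ : ∀ {m i J} → 1 ℕ.+ 2 ℕ.* J ℕ.< m → suc i ℕ.< m → (i , 1 ℕ.+ 2 ℕ.* J) ∈ hexagons m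
oddHexagon∈ {m} {i} {J} j< i< = hexagon∈ j< (subst (λ n → i ℕ.< m ∸ n) (sym (odd%2 J)) (<∸1⇐suc< i<))

latticeEdges : List Cell → List Pt.Edge
latticeEdges cs = map point² (cellEdges cs)

grid : ℕ → ℕ → List Site
grid k l = cartesianProduct (allFin 4) (cartesianProduct (upTo k) (upTo l))

grid∈ : ∀ {k l} t {J i} → J ℕ.< k → i ℕ.< l → (t , J , i) ∈ grid k l
grid∈ t J< i< = ∈-cartesianProduct⁺ (∈-allFin t) (∈-cartesianProduct⁺ (∈-upTo⁺ J<) (∈-upTo⁺ i<))

∈grid : ∀ k l {t J i} → (t , J , i) ∈ grid k l → J ℕ.< k × i ℕ.< l
∈grid k l s∈ with ∈-cartesianProduct⁻ (allFin 4) (cartesianProduct (upTo k) (upTo l)) s∈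
... | _ , c∈ with ∈-cartesianProduct⁻ (upTo k) (upTo l) c∈
... | J∈ , i∈ = ∈-upTo⁻ J∈ , ∈-upTo⁻ i∈

grid-unique : ∀ k l → Unique (grid k l)
grid-unique k l = Unique.cartesianProduct⁺ (Unique.allFin⁺ 4) (Unique.cartesianProduct⁺ (Unique.upTo⁺ k) (Unique.upTo⁺ l))

length-cartesianProduct : ∀ {I K : Set} (is : List I) (ks : List K) → length (cartesianProduct is ks) ≡ length is ℕ.* length ks
length-cartesianProduct []       ks = refl
length-cartesianProduct (i ∷ is) ks = trans (List.length-++ (map (i ,_) ks))
  (cong₂ ℕ._+_ (List.length-map (i ,_) ks) (length-cartesianProduct is ks))

length-grid : ∀ k l → length (grid k l) ≡ 4 ℕ.* (k ℕ.* l)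
length-grid k l = trans (length-cartesianProduct (allFin 4) (cartesianProduct (upTo k) (upTo l)))
  (cong (4 ℕ.*_) (trans (length-cartesianProduct (upTo k) (upTo l)) (cong₂ ℕ._*_ (List.length-upTo k) (List.length-upTo l))))

-- The sites (6J + 3 , 0) of the bottom row are the only vertices that are not of the form point s.
module Sandwich (m k : ℕ) (2k≤m : 2 ℕ.* k ℕ.≤ m) (m≤2k+1 : m ℕ.≤ 1 ℕ.+ 2 ℕ.* k) where

  private
    -- The edges C-D⁺ and D-A of a cell are found as sides of the odd hexagon of the same row, of
    -- which there are only `m ∸ 1`. Outside, one more column is needed because the even hexagons
    -- may reach `J = k`.
    inner outer : List Cell
    inner = rectangle 0 0 k (m ∸ 1)
    outer = rectangle 0 0 (suc k) m

    bottom : List Pt.Edge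
    bottom = concatMap bottomEdges (upTo (suc k))

    double< : ∀ {J} → J ℕ.< k → 1 ℕ.+ 2 ℕ.* J ℕ.< m
    double< {J} J< = ℕ.<-≤-trans (ℕ.≤-reflexive (sym (ℕ.*-suc 2 J))) (ℕ.≤-trans (ℕ.*-monoʳ-≤ 2 J<) 2k≤m)

    half< : ∀ {J} → 2 ℕ.* J ℕ.< m → J ℕ.< suc k
    half< {J} 2J< = s≤s (ℕ.*-cancelˡ-≤ 2 (ℕ.≤-pred (ℕ.<-≤-trans 2J< m≤2k+1)))

    half<′ : ∀ {J} → 1 ℕ.+ 2 ℕ.* J ℕ.< m → suc J ℕ.< suc k
    half<′ {J} 2J< = s≤s (ℕ.*-cancelˡ-< 2 J k (ℕ.≤-pred (ℕ.<-≤-trans 2J< m≤2k+1)))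

    Joined : List Pt.Edge → Point → Point → Set
    Joined E x y = (x , y) ∈ E ⊎ (y , x) ∈ E

    innerEdge : ∀ {J i u v} → J ℕ.< k → i ℕ.< m ∸ 1 → (u , v) ∈ edges (J , i) → Joined (edgeList m) (point u) (point v)
    innerEdge {J} {i} J< i< = go
      where
      module e = Even i J
      module o = Odd i J
      h-even = evenHexagon∈ {m} {i} {J} (ℕ.<⇒≤ (double< J<)) (ℕ.<⇒≤ (suc<⇐<∸1 i<))
      h-odd = oddHexagon∈ {m} {i} {J} (double< J<) (suc<⇐<∸1 i<)
      go : ∀ {u v} → (u , v) ∈ edges (J , i) → Joined (edgeList m) (point u) (point v)
      go first = subst₂ (Joined (edgeList m)) e.c₃≡ e.c₂≡
        (inj₂ (side⇒edge m h-even third))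
      go second = subst₂ (Joined (edgeList m)) e.c₃≡ e.c₄≡
        (inj₁ (side⇒edge m h-even fourth))
      go third = subst₂ (Joined (edgeList m)) e.c₁≡ e.c₂≡
        (inj₁ (side⇒edge m h-even second))
      go fourth = subst₂ (Joined (edgeList m)) o.c₃≡ o.c₂≡
        (inj₂ (side⇒edge m h-odd third))
      go fifth = subst₂ (Joined (edgeList m)) e.c₁≡ e.c₀≡
        (inj₂ (side⇒edge m h-even first))
      go sixth = subst₂ (Joined (edgeList m)) o.c₄≡ o.c₅≡
        (inj₁ (side⇒edge m h-odd fifth))

    inner⇒edge : ∀ {x y} → (x , y) ∈ latticeEdges inner → Joined (edgeList m) x y
    inner⇒edge i with ∈-map⁻ point² i
    ... | (u , v) , e∈ , refl with ∈-cellEdges e∈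
    ... | (J , i) , c∈ , s∈ with ∈-rectangle⁻ {0} {0} {k} {m ∸ 1} c∈
    ... | (_ , J<) , (_ , i<) = innerEdge J< i< s∈

    F : List Pt.Edge
    F = bottom ++ latticeEdges outer

    cell : ∀ {J i u v} → J ℕ.< suc k → i ℕ.< m → (u , v) ∈ edges (J , i) → (point u , point v) ∈ F
    cell {J} {i} J< i< e∈ = ∈-++⁺ʳ bottom (∈-map⁺ point²
      (∈-concatMap⁺ edges (lose (∈-rectangle⁺ {0} {0} {suc k} {m} z≤n J< z≤n i<) e∈)))

    bottom∈ : ∀ {J x y} → J ℕ.< suc k → (x , y) ∈ bottomEdges J → (x , y) ∈ F
    bottom∈ J< e∈ = ∈-++⁺ˡ (∈-concatMap⁺ bottomEdges (lose (∈-upTo⁺ J<) e∈))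

    J≤F : ∀ {x x′ y y′} → x ≡ x′ → y ≡ y′ → Joined F x′ y′ → Joined F x y
    J≤F refl refl j = j

    evenSide : ∀ i J → 2 ℕ.* J ℕ.< m → i ℕ.< m → ∀ {x y} → (x , y) ∈ sides (i , 2 ℕ.* J) → Joined F x y
    evenSide i J j< i< first = J≤F c₀≡ c₁≡ (inj₂ (cell {J} {i} (half< j<) i< fifth))
      where open Even i J
    evenSide i J j< i< second = J≤F c₁≡ c₂≡ (inj₁ (cell {J} {i} (half< j<) i< third))
      where open Even i J
    evenSide i J j< i< third = J≤F c₂≡ c₃≡ (inj₂ (cell {J} {i} (half< j<) i< first))
      where open Even i J
    evenSide i J j< i< fourth = J≤F c₃≡ c₄≡ (inj₁ (cell {J} {i} (half< j<) i< second))
      where open Even i J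
    evenSide zero J j< i< fifth =
      J≤F (Even.c₄≡ 0 J) (c₅-below J) (inj₁ (bottom∈ {J} (half< j<) first))
    evenSide (suc i) J j< i< fifth =
      J≤F (Even.c₄≡ (suc i) J) (c₅-inner i J) (inj₂ (cell {J} {i} (half< j<) (ℕ.<⇒≤ i<) third))
    evenSide zero J j< i< sixth =
      J≤F (c₅-below J) (Even.c₀≡ 0 J) (inj₁ (bottom∈ {J} (half< j<) second))
    evenSide (suc i) J j< i< sixth =
      J≤F (c₅-inner i J) (Even.c₀≡ (suc i) J) (inj₁ (cell {J} {i} (half< j<) (ℕ.<⇒≤ i<) fourth))

    oddSide : ∀ i J → 1 ℕ.+ 2 ℕ.* J ℕ.< m → suc i ℕ.< m → ∀ {x y} → (x , y) ∈ sides (i , 1 ℕ.+ 2 ℕ.* J) → Joined F x y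
    oddSide i J j< i< = go
      where
      open Odd i J
      J< = half< (ℕ.<⇒≤ j<)
      go : ∀ {x y} → (x , y) ∈ sides (i , 1 ℕ.+ 2 ℕ.* J) → Joined F x y
      go first                                         = J≤F c₀≡ c₁≡ (inj₂ (cell {suc J} {suc i} (half<′ j<) i< second))
      go second                                 = J≤F c₁≡ c₂≡ (inj₂ (cell {J} {suc i} J< i< sixth))
      go third                         = J≤F c₂≡ c₃≡ (inj₂ (cell {J} {i} J< (ℕ.<⇒≤ i<) fourth))
      go fourth                 = J≤F c₃≡ c₄≡ (inj₁ (cell {J} {i} J< (ℕ.<⇒≤ i<) fifth))
      go fifth         = J≤F c₄≡ c₅≡ (inj₁ (cell {J} {i} J< (ℕ.<⇒≤ i<) sixth))
      go sixth = J≤F c₅≡ c₀≡ (inj₁ (cell {suc J} {i} (half<′ j<) (ℕ.<⇒≤ i<) first))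

    edge⇒outer : ∀ {x y} → (x , y) ∈ edgeList m → Joined F x y
    edge⇒outer e∈ with edge⇒side m e∈
    ... | h , h∈ , s∈ with position m h∈
    ... | even i J j< i< = evenSide i J j< i< s∈
    ... | odd i J j< i<  = oddSide i J j< i< s∈

    length-bottom : length bottom ≡ suc k ℕ.* 2
    length-bottom = trans (go (upTo (suc k))) (cong (ℕ._* 2) (List.length-upTo (suc k)))
      where
      go : ∀ Js → length (concatMap bottomEdges Js) ≡ length Js ℕ.* 2
      go []       = refl
      go (J ∷ Js) = cong (2 ℕ.+_) (go Js)

  meanRank-≥ : ∀ {p} → Unit p → Φ p k (m ∸ 1) ℚ.≤ meanRank m p
  meanRank-≥ {p} u = begin
    Φ p k (m ∸ 1)                              ≡⟨ Embedding.𝔼-openRank-map p (cellEdges inner) ⟨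
    Pt.𝔼 p (Pt.openRank (latticeEdges inner))  ≤⟨ Pt.𝔼-mono u (Pt.openRank (latticeEdges inner)) (edgeRank m)
                                                    (Pt.openRank-mono (latticeEdges inner) (edgeList m) inner⇒edge) ⟩
    meanRank m p                               ∎
    where open ℚ.≤-Reasoning

  meanRank-≤ : ∀ {p} → Unit p → meanRank m p ℚ.≤ ι (suc k ℕ.* 2) ℚ.+ Φ p (suc k) m
  meanRank-≤ {p} u = begin
    meanRank m p
      ≤⟨ Pt.𝔼-≤-⊕ u (edgeRank m) (Pt.constant (suc k ℕ.* 2)) (Pt.openRank (latticeEdges outer)) bound ⟩
    Pt.𝔼 p (Pt.constant (suc k ℕ.* 2)) ℚ.+ Pt.𝔼 p (Pt.openRank (latticeEdges outer))
      ≡⟨ cong₂ ℚ._+_ (Pt.𝔼-constant p (suc k ℕ.* 2)) (Embedding.𝔼-openRank-map p (cellEdges outer)) ⟩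
    ι (suc k ℕ.* 2) ℚ.+ Φ p (suc k) m ∎
    where
    open ℚ.≤-Reasoning
    bound : ∀ σ → Pt.value (edgeRank m) σ ℕ.≤ suc k ℕ.* 2 ℕ.+ Pt.value (Pt.openRank (latticeEdges outer)) σ
    bound σ = ℕ.≤-trans (Pt.openRank-mono (edgeList m) F edge⇒outer σ)
      (ℕ.≤-trans (Pt.openRank-≤ bottom (latticeEdges outer) ↭-refl σ)
        (ℕ.+-monoˡ-≤ _ (ℕ.≤-trans (Pt.openRank-≤-length bottom σ) (ℕ.≤-reflexive length-bottom))))

  N-≥ : 4 ℕ.* (k ℕ.* m) ℕ.≤ N m
  N-≥ = ℕ.≤-trans (ℕ.≤-reflexive (sym (trans (List.length-map point (grid k m)) (length-grid k m))))
    (unique-⊆ (Unique.map⁺ point-injective (grid-unique k m)) vertex)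
    where
    vertex′ : ∀ t J i → J ℕ.< k → i ℕ.< m → point (t , J , i) ∈ vertexList m
    vertex′ t J i J< i< = go t
      where
      open Even i J
      h∈ = evenHexagon∈ {m} {i} {J} (ℕ.<⇒≤ (double< J<)) i<
      go : ∀ t → point (t , J , i) ∈ vertexList m
      go zero                   = subst (_∈ vertexList m) c₃≡ (corner⇒vertex m h∈ fourth)
      go (suc zero)             = subst (_∈ vertexList m) c₄≡ (corner⇒vertex m h∈ fifth)
      go (suc (suc zero))       = subst (_∈ vertexList m) c₁≡ (corner⇒vertex m h∈ second)
      go (suc (suc (suc zero))) = subst (_∈ vertexList m) c₀≡ (corner⇒vertex m h∈ first)
    vertex : ∀ {x} → x ∈ map point (grid k m) → x ∈ vertexList m
    vertex x∈ with ∈-map⁻ point x∈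
    ... | (t , J , i) , s∈ , refl = let J< , i< = ∈grid k m s∈ in vertex′ t J i J< i<

  -- The upper corners `B J (suc i)` reach row `m`, whence `suc m` rows; the last summand is the
  -- number of bottom points.
  N-≤ : N m ℕ.≤ 4 ℕ.* (suc k ℕ.* suc m) ℕ.+ suc k
  N-≤ = ℕ.≤-trans (unique-⊆ (vertexList-unique m) cover)
    (ℕ.≤-reflexive (trans (List.length-++ (map point (grid (suc k) (suc m))))
      (cong₂ ℕ._+_ (trans (List.length-map point (grid (suc k) (suc m))) (length-grid (suc k) (suc m)))
                   (trans (List.length-map bottomPoint (upTo (suc k))) (List.length-upTo (suc k))))))
    where
    ys : List Point
    ys = map point (grid (suc k) (suc m)) ++ map bottomPoint (upTo (suc k))
    site : ∀ {x} t J i → x ≡ point (t , J , i) → J ℕ.< suc k → i ℕ.≤ m → x ∈ ys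
    site t J i refl J< i≤ = ∈-++⁺ˡ (∈-map⁺ point (grid∈ t J< (s≤s i≤)))
    evenCorner : ∀ i J → 2 ℕ.* J ℕ.< m → i ℕ.< m → ∀ {x} → x ∈ corners (i , 2 ℕ.* J) → x ∈ ys
    evenCorner i J j< i< first = site (suc (suc (suc zero))) J i (Even.c₀≡ i J) (half< j<) (ℕ.<⇒≤ i<)
    evenCorner i J j< i< second = site (suc (suc zero)) J i (Even.c₁≡ i J) (half< j<) (ℕ.<⇒≤ i<)
    evenCorner i J j< i< third = site (suc zero) J (suc i) (Even.c₂≡ i J) (half< j<) i<
    evenCorner i J j< i< fourth = site zero J i (Even.c₃≡ i J) (half< j<) (ℕ.<⇒≤ i<)
    evenCorner i J j< i< fifth = site (suc zero) J i (Even.c₄≡ i J) (half< j<) (ℕ.<⇒≤ i<)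
    evenCorner zero J j< i< sixth =
      subst (_∈ ys) (sym (c₅-below J)) (∈-++⁺ʳ (map point (grid (suc k) (suc m))) (∈-map⁺ bottomPoint (∈-upTo⁺ (half< {J} j<))))
    evenCorner (suc i) J j< i< sixth =
      site (suc (suc zero)) J i (c₅-inner i J) (half< j<) (ℕ.<⇒≤ (ℕ.<⇒≤ i<))
    oddCorner : ∀ i J → 1 ℕ.+ 2 ℕ.* J ℕ.< m → suc i ℕ.< m → ∀ {x} → x ∈ corners (i , 1 ℕ.+ 2 ℕ.* J) → x ∈ ys
    oddCorner i J j< i< = go
      where
      open Odd i J
      J< = half< (ℕ.<⇒≤ j<)
      i≤ = ℕ.<⇒≤ (ℕ.<⇒≤ i<)
      go : ∀ {x} → x ∈ corners (i , 1 ℕ.+ 2 ℕ.* J) → x ∈ ys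
      go first                                         = site (suc zero) (suc J) (suc i) c₀≡ (half<′ j<) (ℕ.<⇒≤ i<)
      go second                                 = site zero (suc J) (suc i) c₁≡ (half<′ j<) (ℕ.<⇒≤ i<)
      go third                         = site (suc (suc (suc zero))) J (suc i) c₂≡ J< (ℕ.<⇒≤ i<)
      go fourth                 = site (suc (suc zero)) J i c₃≡ J< i≤
      go fifth         = site (suc (suc (suc zero))) J i c₄≡ J< i≤
      go sixth = site zero (suc J) i c₅≡ (half<′ j<) i≤
    cover : ∀ {x} → x ∈ vertexList m → x ∈ ys
    cover x∈ with vertex⇒corner m x∈
    ... | h , h∈ , c∈ with position m h∈
    ... | even i J j< i< = evenCorner i J j< i< c∈
    ... | odd i J j< i<  = oddCorner i J j< i< c∈

-- Numerical bounds

-- A simple fraction near the maximiser of the lower polynomial, which is about 0.3377.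
p₀ : ℚ
p₀ = + 27 ℚ./ 80

gap₀ : 0ℚ ℚ.≤ openDensity p₀ ℚ.- faceDensity p₀
gap₀ = ℚ.≤ᵇ⇒≤ {0ℚ} {openDensity p₀ ℚ.- faceDensity p₀} tt

-- One of the two margins is the gap required by the strict inequality of reals, the other absorbs
-- the vanishing errors.
value₀ : + 16738 ℚ./ 100000 ℚ.+ + 1 ℚ./ 10000000 ℚ.+ + 1 ℚ./ 10000000 ℚ.≤ p₀ ℚ.- ι 2 ℚ.* ⅛ ℚ.* (openDensity p₀ ℚ.- faceDensity p₀)
value₀ = ℚ.≤ᵇ⇒≤ {_} {p₀ ℚ.- ι 2 ℚ.* ⅛ ℚ.* (openDensity p₀ ℚ.- faceDensity p₀)} tt

-- The upper bound for the density of components is parabola q + quintic q;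
-- the first summand decreases beyond ⅓ and the second increases.
⅓ parabola₀ : ℚ
⅓ = + 1 ℚ./ 3
parabola₀ = + 1 ℚ./ 6

3/2 : ℚ
3/2 = + 3 ℚ./ 2

parabola quintic : ℚ → ℚ
parabola q = q ℚ.- 3/2 ℚ.* (q ℚ.* q)
quintic q = q ℚ.* q ℚ.* (q ℚ.* q) ℚ.* (q ℚ.- ½ ℚ.* (q ℚ.* q))

upper-density : ∀ q → q ℚ.- ι 2 ℚ.* ⅛ ℚ.* openDensity q ℚ.+ ι 2 ℚ.* ⅛ ℚ.* closingDensity q ≡ parabola q ℚ.+ quintic q
upper-density = solve 1 (λ q →
  let five = q :* (q :* (q :* (q :* (q :* con 1ℚ))))
      six  = (con 1ℚ :- q) :* five
  in q :- con (ι 2) :* con ⅛ :* (con (ι 6) :* (q :* (q :* con 1ℚ))) :+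
     con (ι 2) :* con ⅛ :* ((five :+ six) :+ ((five :+ six) :+ con 0ℚ)) :=
     (q :- con 3/2 :* (q :* q)) :+ q :* q :* (q :* q) :* (q :- con ½ :* (q :* q))) refl

parabola≤ : ∀ q → parabola q ℚ.≤ parabola₀
parabola≤ q = ≤-by (3/2 ℚ.* ((q ℚ.- ⅓) ℚ.* (q ℚ.- ⅓))) (0≤* (ℚ.≤ᵇ⇒≤ {0ℚ} {3/2} tt) (square (q ℚ.- ⅓)))
  (solve 1 (λ q → con parabola₀ := (q :- con 3/2 :* (q :* q)) :+ con 3/2 :* ((q :- con ⅓) :* (q :- con ⅓))) refl q)
  where
  square : ∀ x → 0ℚ ℚ.≤ x ℚ.* x
  square x with ℚ.≤-total 0ℚ x
  ... | inj₁ 0≤x = 0≤* 0≤x 0≤x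
  ... | inj₂ x≤0 = subst (0ℚ ℚ.≤_) (solve 1 (λ x → :- x :* :- x := x :* x) refl x) (0≤* 0≤-x 0≤-x)
    where
    0≤-x : 0ℚ ℚ.≤ ℚ.- x
    0≤-x = ℚ.neg-antimono-≤ x≤0

parabola-antitone : ∀ {a q} → ⅓ ℚ.≤ a → a ℚ.≤ q → parabola q ℚ.≤ parabola a
parabola-antitone {a} {q} ⅓≤a a≤q = ≤-by (3/2 ℚ.* ((q ℚ.- a) ℚ.* ((a ℚ.- ⅓) ℚ.+ (q ℚ.- ⅓))))
  (0≤* (ℚ.≤ᵇ⇒≤ {0ℚ} {3/2} tt) (0≤* (≤⇒0≤- a≤q) (0≤+ (≤⇒0≤- ⅓≤a) (≤⇒0≤- (ℚ.≤-trans ⅓≤a a≤q)))))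
  (solve 2 (λ a q → a :- con 3/2 :* (a :* a) := (q :- con 3/2 :* (q :* q)) :+
    con 3/2 :* ((q :- a) :* ((a :- con ⅓) :+ (q :- con ⅓)))) refl a q)

quintic-mono : ∀ {q b} → 0ℚ ℚ.≤ q → q ℚ.≤ b → b ℚ.≤ 1ℚ → quintic q ℚ.≤ quintic b
quintic-mono {q} {b} 0≤q q≤b b≤1 = begin
  q⁴ q ℚ.* g q ≤⟨ *-monoʳ 0≤g q⁴≤ ⟩
  q⁴ b ℚ.* g q ≤⟨ *-monoˡ (0≤* (0≤* 0≤b 0≤b) (0≤* 0≤b 0≤b)) g≤ ⟩
  q⁴ b ℚ.* g b ∎
  where
  open ℚ.≤-Reasoning
  q⁴ g : ℚ → ℚ
  q⁴ q = q ℚ.* q ℚ.* (q ℚ.* q)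
  g q = q ℚ.- ½ ℚ.* (q ℚ.* q)
  0≤b = ℚ.≤-trans 0≤q q≤b
  0≤½ : 0ℚ ℚ.≤ ½
  0≤½ = ℚ.≤ᵇ⇒≤ {0ℚ} {½} tt
  q²≤ : q ℚ.* q ℚ.≤ b ℚ.* b
  q²≤ = ℚ.≤-trans (*-monoˡ 0≤q q≤b) (*-monoʳ 0≤b q≤b)
  q⁴≤ : q⁴ q ℚ.≤ q⁴ b
  q⁴≤ = ℚ.≤-trans (*-monoˡ (0≤* 0≤q 0≤q) q²≤) (*-monoʳ (0≤* 0≤b 0≤b) q²≤)
  0≤g : 0ℚ ℚ.≤ g q
  0≤g = subst (0ℚ ℚ.≤_) (solve 1 (λ q → q :* ((con 1ℚ :- q) :+ con ½ :* q) := q :- con ½ :* (q :* q)) refl q)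
    (0≤* 0≤q (0≤+ (≤⇒0≤- (ℚ.≤-trans q≤b b≤1)) (0≤* 0≤½ 0≤q)))
  g≤ : g q ℚ.≤ g b
  g≤ = ≤-by (½ ℚ.* ((b ℚ.- q) ℚ.* ((1ℚ ℚ.- b) ℚ.+ (1ℚ ℚ.- q))))
    (0≤* 0≤½ (0≤* (≤⇒0≤- q≤b) (0≤+ (≤⇒0≤- b≤1) (≤⇒0≤- (ℚ.≤-trans q≤b b≤1)))))
    (solve 2 (λ q b → b :- con ½ :* (b :* b) := (q :- con ½ :* (q :* q)) :+
      con ½ :* ((b :- q) :* ((con 1ℚ :- b) :+ (con 1ℚ :- q)))) refl q b)

bound : ℚ
bound = + 1714 ℚ./ 10000

-- The pieces are shortest next to the maximum of the sum, about 0.1706 near 0.354, where little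
-- room is left below `bound`.
breakpoints : List ℚ
breakpoints = + 73 ℚ./ 200 ∷ + 3 ℚ./ 8 ∷ + 39 ℚ./ 100 ∷ + 41 ℚ./ 100 ∷ + 11 ℚ./ 25 ∷ + 49 ℚ./ 100 ∷ + 113 ℚ./ 200 ∷
              + 33 ℚ./ 50 ∷ + 153 ℚ./ 200 ∷ + 87 ℚ./ 100 ∷ + 193 ℚ./ 200 ∷ []

-- The interval from a to 1, cut at the given points, is fine when the bound
-- holds with the parabola taken at the left end and the quintic at the right
-- end of each piece.
Fine : ℚ → List ℚ → Set
Fine a []       = ⅓ ℚ.≤ a × parabola a ℚ.+ quintic 1ℚ ℚ.≤ bound
Fine a (b ∷ bs) = ⅓ ℚ.≤ a × b ℚ.≤ 1ℚ × parabola a ℚ.+ quintic b ℚ.≤ bound × Fine b bs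

fine⇒bound : ∀ a bs → Fine a bs → ∀ {q} → 0ℚ ℚ.≤ q → a ℚ.≤ q → q ℚ.≤ 1ℚ → parabola q ℚ.+ quintic q ℚ.≤ bound
fine⇒bound a [] (⅓≤a , piece) 0≤q a≤q q≤1 =
  ℚ.≤-trans (ℚ.+-mono-≤ (parabola-antitone ⅓≤a a≤q) (quintic-mono 0≤q q≤1 ℚ.≤-refl)) piece
fine⇒bound a (b ∷ bs) (⅓≤a , b≤1 , piece , rest) {q} 0≤q a≤q q≤1 = [ left , right ]′ (ℚ.≤-total q b)
  where
  left : q ℚ.≤ b → parabola q ℚ.+ quintic q ℚ.≤ bound
  left q≤b = ℚ.≤-trans (ℚ.+-mono-≤ (parabola-antitone ⅓≤a a≤q) (quintic-mono 0≤q q≤b b≤1)) piece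
  right : b ℚ.≤ q → parabola q ℚ.+ quintic q ℚ.≤ bound
  right b≤q = fine⇒bound b bs rest 0≤q b≤q q≤1

-- To the left of this point the peak 1/6 of the parabola plus the quintic at `a₀` is still below
-- `bound`, so the pieces need to cover only an interval on which the parabola decreases.
a₀ : ℚ
a₀ = + 71 ℚ./ 200

fine : Fine a₀ breakpoints
fine = go a₀ breakpoints _
  where
  check : ℚ → List ℚ → Bool
  check a []       = (⅓ ℚ.≤ᵇ a) ∧ ((parabola a ℚ.+ quintic 1ℚ) ℚ.≤ᵇ bound)
  check a (b ∷ bs) = (⅓ ℚ.≤ᵇ a) ∧ ((b ℚ.≤ᵇ 1ℚ) ∧ (((parabola a ℚ.+ quintic b) ℚ.≤ᵇ bound) ∧ check b bs))
  T-∧ : ∀ {x y} → T (x ∧ y) → T x × T y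
  T-∧ {true} t = tt , t
  go : ∀ a bs → T (check a bs) → Fine a bs
  go a []       t = let t₁ , t₂ = T-∧ {⅓ ℚ.≤ᵇ a} t in ℚ.≤ᵇ⇒≤ t₁ , ℚ.≤ᵇ⇒≤ t₂
  go a (b ∷ bs) t = let t₁ , r₁ = T-∧ {⅓ ℚ.≤ᵇ a} t ; t₂ , r₂ = T-∧ {b ℚ.≤ᵇ 1ℚ} r₁
                        t₃ , r₃ = T-∧ {(parabola a ℚ.+ quintic b) ℚ.≤ᵇ bound} r₂
                    in ℚ.≤ᵇ⇒≤ t₁ , ℚ.≤ᵇ⇒≤ t₂ , ℚ.≤ᵇ⇒≤ t₃ , go b bs r₃

parabola+quintic≤ : ∀ {q} → Unit q → parabola q ℚ.+ quintic q ℚ.≤ bound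
parabola+quintic≤ {q} (0≤q , q≤1) = [ left , right ]′ (ℚ.≤-total q a₀)
  where
  left : q ℚ.≤ a₀ → parabola q ℚ.+ quintic q ℚ.≤ bound
  left q≤a = ℚ.≤-trans (ℚ.+-mono-≤ (parabola≤ q) (quintic-mono 0≤q q≤a (ℚ.≤ᵇ⇒≤ {a₀} {1ℚ} tt)))
                       (ℚ.≤ᵇ⇒≤ {parabola₀ ℚ.+ quintic a₀} {bound} tt)
  right : a₀ ℚ.≤ q → parabola q ℚ.+ quintic q ℚ.≤ bound
  right a≤q = fine⇒bound a₀ breakpoints fine 0≤q a≤q q≤1

-- Components per vertex

double-half : ∀ n → 2 ℕ.* ⌊ n /2⌋ ℕ.≤ n × n ℕ.≤ 1 ℕ.+ 2 ℕ.* ⌊ n /2⌋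
double-half zero          = z≤n , z≤n
double-half (suc zero)    = z≤n , s≤s z≤n
double-half (suc (suc n)) = let l , u = double-half n in
  ℕ.≤-trans (ℕ.≤-reflexive (ℕ.*-suc 2 ⌊ n /2⌋)) (s≤s (s≤s l)) ,
  ℕ.≤-trans (s≤s (s≤s u)) (ℕ.≤-reflexive (cong suc (sym (ℕ.*-suc 2 ⌊ n /2⌋))))

-- meanDensity n is the mean number of components per vertex of the lattice
-- with parameter n + 2, and level n + 1 is half that parameter, rounded down.
perVertex : ℕ → ℚ
perVertex n = + 1 ℚ./ N (2 ℕ.+ n)

meanDensity : ℕ → ℚ → ℚ
meanDensity n p = meanComponents (2 ℕ.+ n) p ℚ.* perVertex n

level : ℕ → ℕ
level = ⌊_/2⌋

module _ (n : ℕ) where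

  private
    j k m : ℕ
    j = level n
    k = suc j
    m = 2 ℕ.+ n

    2k≤m : 2 ℕ.* k ℕ.≤ m
    2k≤m = proj₁ (double-half (2 ℕ.+ n))

    m≤2k+1 : m ℕ.≤ 1 ℕ.+ 2 ℕ.* k
    m≤2k+1 = proj₂ (double-half (2 ℕ.+ n))

    open Sandwich m k 2k≤m m≤2k+1

    8k²≤N : 8 ℕ.* (k ℕ.* k) ℕ.≤ N m
    8k²≤N = begin
      8 ℕ.* (k ℕ.* k)             ≡⟨ N.solve 1 (λ k → N.con 8 N.:* (k N.:* k) N.:= N.con 4 N.:* (k N.:* (N.con 2 N.:* k))) refl k ⟩
      4 ℕ.* (k ℕ.* (2 ℕ.* k))     ≤⟨ ℕ.*-monoʳ-≤ 4 (ℕ.*-monoʳ-≤ k 2k≤m) ⟩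
      4 ℕ.* (k ℕ.* m)             ≤⟨ N-≥ ⟩
      N m                         ∎
      where open ℕ.≤-Reasoning

    N≤8k²+26k : N m ℕ.≤ 8 ℕ.* (k ℕ.* k) ℕ.+ 26 ℕ.* k
    N≤8k²+26k = begin
      N m                                                 ≤⟨ N-≤ ⟩
      4 ℕ.* (suc k ℕ.* suc m) ℕ.+ suc k                   ≤⟨ ℕ.+-monoˡ-≤ (suc k) (ℕ.*-monoʳ-≤ 4 (ℕ.*-monoʳ-≤ (suc k) (s≤s m≤2k+1))) ⟩
      -- This is `8k² + 17k + 9`; the term `9j` raises the constant 9 to `9k`.
      4 ℕ.* (suc k ℕ.* (2 ℕ.+ 2 ℕ.* k)) ℕ.+ suc k         ≤⟨ ℕ.m≤m+n _ (9 ℕ.* j) ⟩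
      4 ℕ.* (suc k ℕ.* (2 ℕ.+ 2 ℕ.* k)) ℕ.+ suc k ℕ.+ 9 ℕ.* j ≡⟨ expand j ⟩
      8 ℕ.* (k ℕ.* k) ℕ.+ 26 ℕ.* k                        ∎
      where
      open ℕ.≤-Reasoning
      expand : ∀ j → 4 ℕ.* (suc (suc j) ℕ.* (2 ℕ.+ 2 ℕ.* suc j)) ℕ.+ suc (suc j) ℕ.+ 9 ℕ.* j ≡
                     8 ℕ.* (suc j ℕ.* suc j) ℕ.+ 26 ℕ.* suc j
      expand = N.solve 1 (λ j → N.con 4 N.:* ((N.con 2 N.:+ j) N.:* (N.con 2 N.:+ N.con 2 N.:* (N.con 1 N.:+ j))) N.:+ (N.con 2 N.:+ j) N.:+ N.con 9 N.:* j N.:=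
        N.con 8 N.:* ((N.con 1 N.:+ j) N.:* (N.con 1 N.:+ j)) N.:+ N.con 26 N.:* (N.con 1 N.:+ j)) refl

  module _ {p : ℚ} (u : Unit p) where

    private
      R = meanRank m p

      -- The surplus consists of `2(k + 1)` bottom edges, a column of `m` cells and at most one row
      -- of `k` cells: no more than `20k + 8` edges, hence at most `28k`.
      R≤ : R ℚ.≤ Ψ p k ℚ.+ ι (28 ℕ.* k)
      R≤ = begin
        R                                                        ≤⟨ meanRank-≤ u ⟩
        ι (suc k ℕ.* 2) ℚ.+ Φ p (suc k) m                        ≤⟨ ℚ.+-monoʳ-≤ (ι (suc k ℕ.* 2)) wide ⟩
        ι (suc k ℕ.* 2) ℚ.+ (ι (1 ℕ.* m ℕ.* 6) ℚ.+ (Ψ p k ℚ.+ ι (k ℕ.* 1 ℕ.* 6)))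
          ≡⟨ solve 4 (λ a b x c → a :+ (b :+ (x :+ c)) := x :+ (a :+ b :+ c)) refl (ι (suc k ℕ.* 2)) (ι (1 ℕ.* m ℕ.* 6)) (Ψ p k) (ι (k ℕ.* 1 ℕ.* 6)) ⟩
        Ψ p k ℚ.+ (ι (suc k ℕ.* 2) ℚ.+ ι (1 ℕ.* m ℕ.* 6) ℚ.+ ι (k ℕ.* 1 ℕ.* 6))
          ≡⟨ cong (Ψ p k ℚ.+_) (trans (cong (ℚ._+ ι (k ℕ.* 1 ℕ.* 6)) (sym (ι-+ (suc k ℕ.* 2) (1 ℕ.* m ℕ.* 6))))
               (sym (ι-+ (suc k ℕ.* 2 ℕ.+ 1 ℕ.* m ℕ.* 6) (k ℕ.* 1 ℕ.* 6)))) ⟩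
        Ψ p k ℚ.+ ι (suc k ℕ.* 2 ℕ.+ 1 ℕ.* m ℕ.* 6 ℕ.+ k ℕ.* 1 ℕ.* 6)
          ≤⟨ ℚ.+-monoʳ-≤ (Ψ p k) (ι-mono count≤) ⟩
        Ψ p k ℚ.+ ι (28 ℕ.* k) ∎
        where
        open ℚ.≤-Reasoning
        d = m ℕ.∸ 2 ℕ.* k
        d≤1 : d ℕ.≤ 1
        d≤1 = ℕ.≤-trans (ℕ.∸-monoˡ-≤ (2 ℕ.* k) m≤2k+1) (ℕ.≤-reflexive (ℕ.m+n∸n≡m 1 (2 ℕ.* k)))
        tall : Φ p k m ℚ.≤ Ψ p k ℚ.+ ι (k ℕ.* 1 ℕ.* 6)
        tall = begin
          Φ p k m                                ≡⟨ cong (Φ p k) (ℕ.m+[n∸m]≡n 2k≤m) ⟨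
          Φ p k (2 ℕ.* k ℕ.+ d)                  ≤⟨ Φ-+-≤′ u k (2 ℕ.* k) d ⟩
          Ψ p k ℚ.+ Φ p k d                      ≤⟨ ℚ.+-monoʳ-≤ (Ψ p k) (Φ-bound u k d) ⟩
          Ψ p k ℚ.+ ι (k ℕ.* d ℕ.* 6)            ≤⟨ ℚ.+-monoʳ-≤ (Ψ p k) (ι-mono (ℕ.*-monoˡ-≤ 6 (ℕ.*-monoʳ-≤ k d≤1))) ⟩
          Ψ p k ℚ.+ ι (k ℕ.* 1 ℕ.* 6)            ∎
        wide : Φ p (suc k) m ℚ.≤ ι (1 ℕ.* m ℕ.* 6) ℚ.+ (Ψ p k ℚ.+ ι (k ℕ.* 1 ℕ.* 6))
        wide = ℚ.≤-trans (Φ-+-≤ u 1 k m) (ℚ.+-mono-≤ (Φ-bound u 1 m) tall)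
        count≤ : suc k ℕ.* 2 ℕ.+ 1 ℕ.* m ℕ.* 6 ℕ.+ k ℕ.* 1 ℕ.* 6 ℕ.≤ 28 ℕ.* k
        count≤ = ℕ.≤-trans (ℕ.+-monoˡ-≤ (k ℕ.* 1 ℕ.* 6) (ℕ.+-monoʳ-≤ (suc k ℕ.* 2) (ℕ.*-monoˡ-≤ 6 (ℕ.*-monoʳ-≤ 1 m≤2k+1))))
          (ℕ.≤-trans (ℕ.m≤m+n _ (8 ℕ.* j)) (ℕ.≤-reflexive (expand j)))
          where
          expand : ∀ j → suc (suc j) ℕ.* 2 ℕ.+ 1 ℕ.* (1 ℕ.+ 2 ℕ.* suc j) ℕ.* 6 ℕ.+ suc j ℕ.* 1 ℕ.* 6 ℕ.+ 8 ℕ.* j ≡ 28 ℕ.* suc j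
          expand = N.solve 1 (λ j → (N.con 2 N.:+ j) N.:* N.con 2 N.:+ N.con 1 N.:* (N.con 1 N.:+ N.con 2 N.:* (N.con 1 N.:+ j)) N.:* N.con 6
            N.:+ (N.con 1 N.:+ j) N.:* N.con 1 N.:* N.con 6 N.:+ N.con 8 N.:* j N.:= N.con 28 N.:* (N.con 1 N.:+ j)) refl

      -- For `m = 2k + 1` the inner rectangle is exactly `k × 2k`; for `m = 2k` it lacks one row,
      -- that is `6k` edges.
      ≤R : Ψ p k ℚ.≤ R ℚ.+ ι (6 ℕ.* k)
      ≤R = cases (ℕ.m≤n⇒m<n∨m≡n 2k≤m)
        where
        open ℚ.≤-Reasoning
        cases : 2 ℕ.* k ℕ.< m ⊎ 2 ℕ.* k ≡ m → Ψ p k ℚ.≤ R ℚ.+ ι (6 ℕ.* k)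
        cases (inj₁ 2k<m) = begin
          Φ p k (2 ℕ.* k)                     ≡⟨ cong (Φ p k) (ℕ.≤-antisym (ℕ.≤-pred 2k<m) (ℕ.≤-pred m≤2k+1)) ⟩
          Φ p k (suc n)                       ≤⟨ meanRank-≥ u ⟩
          R                                   ≤⟨ ≤-by (ι (6 ℕ.* k)) (0≤ι (6 ℕ.* k)) refl ⟩
          R ℚ.+ ι (6 ℕ.* k)                   ∎
        cases (inj₂ 2k≡m) = begin
          Φ p k (2 ℕ.* k)                     ≡⟨ cong (Φ p k) (trans 2k≡m (ℕ.+-comm 1 (suc n))) ⟩
          Φ p k (suc n ℕ.+ 1)                 ≤⟨ Φ-+-≤′ u k (suc n) 1 ⟩
          Φ p k (suc n) ℚ.+ Φ p k 1           ≤⟨ ℚ.+-mono-≤ (meanRank-≥ u) (Φ-bound u k 1) ⟩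
          R ℚ.+ ι (k ℕ.* 1 ℕ.* 6)             ≡⟨ cong (λ x → R ℚ.+ ι x) (trans (cong (ℕ._* 6) (ℕ.*-identityʳ k)) (ℕ.*-comm k 6)) ⟩
          R ℚ.+ ι (6 ℕ.* k)                   ∎

      i = inv j
      η = perVertex n

      meanDensity≡ : meanDensity n p ≡ p ℚ.- R ℚ.* η
      meanDensity≡ = begin
        c ℚ.* η                               ≡⟨ solve 3 (λ c r e → c :* e := (c :+ r) :* e :- r :* e) refl c R η ⟩
        (c ℚ.+ R) ℚ.* η ℚ.- R ℚ.* η           ≡⟨ cong (λ x → x ℚ.* η ℚ.- R ℚ.* η) (meanComponents-rank m p) ⟩
        ι (N m) ℚ.* p ℚ.* η ℚ.- R ℚ.* η       ≡⟨ cong (ℚ._- R ℚ.* η) (solve 3 (λ n p e → n :* p :* e := (n :* e) :* p) refl (ι (N m)) p η) ⟩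
        (ι (N m) ℚ.* η) ℚ.* p ℚ.- R ℚ.* η     ≡⟨ cong (λ x → x ℚ.* p ℚ.- R ℚ.* η) (ι-inverse (N m)) ⟩
        1ℚ ℚ.* p ℚ.- R ℚ.* η                  ≡⟨ cong (ℚ._- R ℚ.* η) (ℚ.*-identityˡ p) ⟩
        p ℚ.- R ℚ.* η                         ∎
        where
        open ≡-Reasoning
        c = meanComponents m p

    meanDensity-≤ : meanDensity n p ℚ.≤ p ℚ.- ρ p (level n) ℚ.+ ι 58 ℚ.* inv (level n)
    meanDensity-≤ = begin
      meanDensity n p            ≡⟨ meanDensity≡ ⟩
      p ℚ.- R ℚ.* η              ≡⟨ solve 3 (λ p x e → p :- x := p :- (x :+ e) :+ e) refl p (R ℚ.* η) (ι 58 ℚ.* i) ⟩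
      p ℚ.- (R ℚ.* η ℚ.+ ι 58 ℚ.* i) ℚ.+ ι 58 ℚ.* i
        ≤⟨ ℚ.+-monoˡ-≤ (ι 58 ℚ.* i) (ℚ.+-monoʳ-≤ p (ℚ.neg-antimono-≤ (≤-density u j (N m) R R≤ ≤R 8k²≤N N≤8k²+26k))) ⟩
      p ℚ.- ρ p j ℚ.+ ι 58 ℚ.* i ∎
      where open ℚ.≤-Reasoning

    ≤-meanDensity : p ℚ.- ρ p (level n) ℚ.≤ meanDensity n p ℚ.+ ι 28 ℚ.* inv (level n)
    ≤-meanDensity = begin
      p ℚ.- ρ p j                ≡⟨ solve 3 (λ p x e → p :- x := p :- (x :+ e) :+ e) refl p (ρ p j) (ι 28 ℚ.* i) ⟩
      p ℚ.- (ρ p j ℚ.+ ι 28 ℚ.* i) ℚ.+ ι 28 ℚ.* i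
        ≤⟨ ℚ.+-monoˡ-≤ (ι 28 ℚ.* i) (ℚ.+-monoʳ-≤ p (ℚ.neg-antimono-≤ (density-≤ u j (N m) R R≤ ≤R 8k²≤N N≤8k²+26k))) ⟩
      p ℚ.- R ℚ.* η ℚ.+ ι 28 ℚ.* i ≡⟨ cong (ℚ._+ ι 28 ℚ.* i) meanDensity≡ ⟨
      meanDensity n p ℚ.+ ι 28 ℚ.* i ∎
      where open ℚ.≤-Reasoning

-- One coefficient large enough for both errors that occur below, 58 above the limit density and 28
-- + 3 beneath it.
deviation : ℕ → ℚ
deviation n = ι 61 ℚ.* inv (level n)

module _ {p : ℚ} (u : Unit p) where

  open ℚ.≤-Reasoning

  private
    ≤deviation : ∀ c n → c ℕ.≤ 61 → ι c ℚ.* inv (level n) ℚ.≤ deviation n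
    ≤deviation c n c≤ = *-monoʳ (0≤inv (level n)) (ι-mono c≤)

  meanDensity-close : ∀ n n′ → meanDensity n p ℚ.≤ meanDensity n′ p ℚ.+ (deviation n ℚ.+ deviation n′)
  meanDensity-close n n′ = begin
    meanDensity n p
      ≤⟨ meanDensity-≤ n u ⟩
    p ℚ.- ρ p j ℚ.+ ι 58 ℚ.* i
      ≡⟨ solve 4 (λ p x e f → p :- x :+ f := p :- (x :+ e) :+ e :+ f) refl p (ρ p j) (ι 3 ℚ.* i′) (ι 58 ℚ.* i) ⟩
    p ℚ.- (ρ p j ℚ.+ ι 3 ℚ.* i′) ℚ.+ ι 3 ℚ.* i′ ℚ.+ ι 58 ℚ.* i
      ≤⟨ ℚ.+-monoˡ-≤ (ι 58 ℚ.* i) (ℚ.+-monoˡ-≤ (ι 3 ℚ.* i′) (ℚ.+-monoʳ-≤ p (ℚ.neg-antimono-≤ (ρ-compare u j′ j)))) ⟩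
    p ℚ.- ρ p j′ ℚ.+ ι 3 ℚ.* i′ ℚ.+ ι 58 ℚ.* i
      ≤⟨ ℚ.+-mono-≤ (ℚ.+-monoˡ-≤ (ι 3 ℚ.* i′) (≤-meanDensity n′ u)) (≤deviation 58 n (ℕ.m≤m+n 58 3)) ⟩
    meanDensity n′ p ℚ.+ ι 28 ℚ.* i′ ℚ.+ ι 3 ℚ.* i′ ℚ.+ deviation n
      ≡⟨ cong (ℚ._+ deviation n) (trans (ℚ.+-assoc (meanDensity n′ p) _ _) (cong (meanDensity n′ p ℚ.+_) (sym (ℚ.*-distribʳ-+ i′ (ι 28) (ι 3))))) ⟩
    meanDensity n′ p ℚ.+ ι 31 ℚ.* i′ ℚ.+ deviation n
      ≤⟨ ℚ.+-monoˡ-≤ (deviation n) (ℚ.+-monoʳ-≤ (meanDensity n′ p) (≤deviation 31 n′ (ℕ.m≤m+n 31 30))) ⟩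
    meanDensity n′ p ℚ.+ deviation n′ ℚ.+ deviation n
      ≡⟨ trans (ℚ.+-assoc (meanDensity n′ p) (deviation n′) (deviation n)) (cong (meanDensity n′ p ℚ.+_) (ℚ.+-comm (deviation n′) (deviation n))) ⟩
    meanDensity n′ p ℚ.+ (deviation n ℚ.+ deviation n′) ∎
    where
    j = level n
    j′ = level n′
    i = inv j
    i′ = inv j′

  meanDensity-upper : ∀ n → meanDensity n p ℚ.≤ p ℚ.- ι 2 ℚ.* ⅛ ℚ.* openDensity p ℚ.+ ι 2 ℚ.* ⅛ ℚ.* closingDensity p ℚ.+ deviation n
  meanDensity-upper n = begin
    meanDensity n p                        ≤⟨ meanDensity-≤ n u ⟩
    p ℚ.- ρ p j ℚ.+ ι 58 ℚ.* inv j
      ≡⟨ solve 4 (λ p x c e → p :- x :+ e := p :- (c :+ x) :+ c :+ e) refl p (ρ p j) (ι 2 ℚ.* ⅛ ℚ.* closingDensity p) (ι 58 ℚ.* inv j) ⟩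
    p ℚ.- (ι 2 ℚ.* ⅛ ℚ.* closingDensity p ℚ.+ ρ p j) ℚ.+ ι 2 ℚ.* ⅛ ℚ.* closingDensity p ℚ.+ ι 58 ℚ.* inv j
      ≤⟨ ℚ.+-mono-≤ (ℚ.+-monoˡ-≤ (ι 2 ℚ.* ⅛ ℚ.* closingDensity p) (ℚ.+-monoʳ-≤ p (ℚ.neg-antimono-≤ (ρ-lower u j)))) (≤deviation 58 n (ℕ.m≤m+n 58 3)) ⟩
    p ℚ.- ι 2 ℚ.* ⅛ ℚ.* openDensity p ℚ.+ ι 2 ℚ.* ⅛ ℚ.* closingDensity p ℚ.+ deviation n ∎
    where j = level n

  meanDensity-lower : 0ℚ ℚ.≤ openDensity p ℚ.- faceDensity p → ∀ n →
    p ℚ.- ι 2 ℚ.* ⅛ ℚ.* (openDensity p ℚ.- faceDensity p) ℚ.≤ meanDensity n p ℚ.+ deviation n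
  meanDensity-lower 0≤ n = begin
    p ℚ.- g                                                ≡⟨ solve 3 (λ p g e → p :- g := p :- (g :+ e) :+ e) refl p g (ι 3 ℚ.* i) ⟩
    p ℚ.- (g ℚ.+ ι 3 ℚ.* i) ℚ.+ ι 3 ℚ.* i                  ≤⟨ ℚ.+-monoˡ-≤ (ι 3 ℚ.* i) (ℚ.+-monoʳ-≤ p (ℚ.neg-antimono-≤ (ρ-upper u 0≤ j))) ⟩
    p ℚ.- ρ p j ℚ.+ ι 3 ℚ.* i                              ≤⟨ ℚ.+-monoˡ-≤ (ι 3 ℚ.* i) (≤-meanDensity n u) ⟩
    meanDensity n p ℚ.+ ι 28 ℚ.* i ℚ.+ ι 3 ℚ.* i           ≡⟨ trans (ℚ.+-assoc (meanDensity n p) _ _) (cong (meanDensity n p ℚ.+_) (sym (ℚ.*-distribʳ-+ i (ι 28) (ι 3)))) ⟩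
    meanDensity n p ℚ.+ ι 31 ℚ.* i                         ≤⟨ ℚ.+-monoʳ-≤ (meanDensity n p) (≤deviation 31 n (ℕ.m≤m+n 31 30)) ⟩
    meanDensity n p ℚ.+ deviation n                                ∎
    where
    j = level n
    i = inv j
    g = ι 2 ℚ.* ⅛ ℚ.* (openDensity p ℚ.- faceDensity p)

-- Suprema over the unit interval

Vanishing : (ℕ → ℚ) → Set
Vanishing e = ∀ δ → 0ℚ ℚ.< δ → ∃[ T ] ∀ n → T ℕ.≤ n → e n ℚ.< δ

inv-vanishing : ∀ c → Vanishing (λ n → ι c ℚ.* inv n)
-- Since `1 ≤ d δ`, every `n` from `c d` on satisfies `c ≤ n δ`, which is less than `(n + 1) δ`.
inv-vanishing c δ 0<δ = c ℕ.* d , λ n T≤n → begin-strict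
  ι c ℚ.* inv n                                 ≡⟨ ℚ.+-identityʳ (ι c ℚ.* inv n) ⟨
  ι c ℚ.* inv n ℚ.+ 0ℚ                          <⟨ ℚ.+-monoʳ-< (ι c ℚ.* inv n) (0<δinv n) ⟩
  ι c ℚ.* inv n ℚ.+ δ ℚ.* inv n                 ≡⟨ ℚ.*-distribʳ-+ (inv n) (ι c) δ ⟨
  (ι c ℚ.+ δ) ℚ.* inv n                         ≤⟨ *-monoʳ (0≤inv n) (ℚ.+-monoˡ-≤ δ (c≤ n T≤n)) ⟩
  (ι n ℚ.* δ ℚ.+ δ) ℚ.* inv n                   ≡⟨ cong (ℚ._* inv n) (trans (solve 2 (λ n δ → n :* δ :+ δ := (con 1ℚ :+ n) :* δ) refl (ι n) δ) (cong (ℚ._* δ) (sym (ι-+ 1 n)))) ⟩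
  ι (suc n) ℚ.* δ ℚ.* inv n                     ≡⟨ solve 3 (λ n δ i → n :* δ :* i := (n :* i) :* δ) refl (ι (suc n)) δ (inv n) ⟩
  (ι (suc n) ℚ.* inv n) ℚ.* δ                   ≡⟨ cong (ℚ._* δ) (ι-inv n) ⟩
  1ℚ ℚ.* δ                                      ≡⟨ ℚ.*-identityˡ δ ⟩
  δ                                             ∎
  where
  open ℚ.≤-Reasoning
  d = proj₁ (archimedean δ 0<δ)
  0<δinv : ∀ n → 0ℚ ℚ.< δ ℚ.* inv n
  0<δinv n = ℚ.positive⁻¹ (δ ℚ.* inv n) {{ℚ.pos*pos⇒pos δ {{ℚ.positive 0<δ}} (inv n) {{ℚ.positive (0<inv n)}}}}
  c≤ : ∀ n → c ℕ.* d ℕ.≤ n → ι c ℚ.≤ ι n ℚ.* δ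
  c≤ n T≤n = begin
    ι c                       ≡⟨ ℚ.*-identityʳ (ι c) ⟨
    ι c ℚ.* 1ℚ                ≤⟨ *-monoˡ (0≤ι c) (proj₂ (archimedean δ 0<δ)) ⟩
    ι c ℚ.* (ι d ℚ.* δ)       ≡⟨ ℚ.*-assoc (ι c) (ι d) δ ⟨
    ι c ℚ.* ι d ℚ.* δ         ≡⟨ cong (ℚ._* δ) (ι-* c d) ⟨
    ι (c ℕ.* d) ℚ.* δ         ≤⟨ *-monoʳ (ℚ.<⇒≤ 0<δ) (ι-mono T≤n) ⟩
    ι n ℚ.* δ                 ∎

half+half : ∀ δ → ½ ℚ.* δ ℚ.+ ½ ℚ.* δ ≡ δ
half+half = solve 1 (λ δ → con ½ :* δ :+ con ½ :* δ := δ) refl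

0<half : ∀ {δ} → 0ℚ ℚ.< δ → 0ℚ ℚ.< ½ ℚ.* δ
0<half {δ} 0<δ = ℚ.positive⁻¹ (½ ℚ.* δ) {{ℚ.pos*pos⇒pos ½ δ {{ℚ.positive 0<δ}}}}

vanishing-+ : ∀ {e f} → Vanishing e → Vanishing f → Vanishing (λ n → e n ℚ.+ f n)
vanishing-+ {e} {f} ve vf δ 0<δ with ve (½ ℚ.* δ) (0<half 0<δ) | vf (½ ℚ.* δ) (0<half 0<δ)
... | T , h | T′ , h′ = T ⊔ T′ , λ n T≤n → subst (e n ℚ.+ f n ℚ.<_) (half+half δ)
  (ℚ.+-mono-< (h n (ℕ.m⊔n≤o⇒m≤o T T′ T≤n)) (h′ n (ℕ.m⊔n≤o⇒n≤o T T′ T≤n)))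

vanishing-∘ : ∀ {e} (g : ℕ → ℕ) → (∀ T → ∃[ T′ ] ∀ n → T′ ℕ.≤ n → T ℕ.≤ g n) → Vanishing e → Vanishing (λ n → e (g n))
vanishing-∘ g grow v δ 0<δ = let T , h = v δ 0<δ ; T′ , h′ = grow T in T′ , λ n T′≤n → h (g n) (h′ n T′≤n)

vanishing⇒cauchy : ∀ {e x} → Vanishing e → (∀ a b → x a ℚ.≤ x b ℚ.+ (e a ℚ.+ e b)) → IsCauchy x
vanishing⇒cauchy {e} {x} v close δ 0<δ with v (½ ℚ.* δ) (0<half 0<δ)
... | T , h = T , λ a b T≤a T≤b → strict (side a b T≤a T≤b)
    (subst (ℚ._< δ) (solve 2 (λ a b → b :- a := :- (a :- b)) refl (x a) (x b)) (side b a T≤b T≤a))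
  where
  side : ∀ a b → T ℕ.≤ a → T ℕ.≤ b → x a ℚ.- x b ℚ.< δ
  side a b T≤a T≤b = begin-strict
    x a ℚ.- x b                           ≤⟨ ℚ.+-monoˡ-≤ (ℚ.- x b) (close a b) ⟩
    x b ℚ.+ (e a ℚ.+ e b) ℚ.- x b         ≡⟨ solve 2 (λ x e → x :+ e :- x := e) refl (x b) (e a ℚ.+ e b) ⟩
    e a ℚ.+ e b                           <⟨ ℚ.+-mono-< (h a T≤a) (h b T≤b) ⟩
    ½ ℚ.* δ ℚ.+ ½ ℚ.* δ                   ≡⟨ half+half δ ⟩
    δ                                     ∎
    where open ℚ.≤-Reasoning
  strict : ∀ {y} → y ℚ.< δ → ℚ.- y ℚ.< δ → ℚ.∣ y ∣ ℚ.< δ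
  strict {y} y< -y< with ℚ.∣p∣≡p∨∣p∣≡-p y
  ... | inj₁ e = subst (ℚ._< δ) (sym e) y<
  ... | inj₂ e = subst (ℚ._< δ) (sym e) -y<

-- For `j ≤ t` these points keep a distance of at least `1 / (t + 2)` from both 0 and 1, as
-- witnesses for a supremum over the open interval must; the whole closed interval is still within
-- that distance of them.
gridPoint : ℕ → ℕ → ℚ
gridPoint t j = ι (suc j) ℚ.* inv (suc t)

gridPoint-suc : ∀ t j → gridPoint t (suc j) ≡ gridPoint t j ℚ.+ inv (suc t)
gridPoint-suc t j = trans (cong (ℚ._* inv (suc t)) (ι-+ 1 (suc j)))
  (solve 2 (λ x i → (con 1ℚ :+ x) :* i := x :* i :+ i) refl (ι (suc j)) (inv (suc t)))

gridPoint-upper : ∀ {t j} → j ℕ.≤ t → gridPoint t j ℚ.+ inv (suc t) ℚ.≤ 1ℚ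
gridPoint-upper {t} {j} j≤t = begin
  gridPoint t j ℚ.+ inv (suc t)         ≡⟨ gridPoint-suc t j ⟨
  ι (suc (suc j)) ℚ.* inv (suc t)       ≤⟨ *-monoʳ (0≤inv (suc t)) (ι-mono (s≤s (s≤s j≤t))) ⟩
  ι (suc (suc t)) ℚ.* inv (suc t)       ≡⟨ ι-inv (suc t) ⟩
  1ℚ                                    ∎
  where open ℚ.≤-Reasoning

gridPoint-lower : ∀ t j → inv (suc t) ℚ.≤ gridPoint t j
gridPoint-lower t j = ℚ.≤-trans (ℚ.≤-reflexive (sym (ℚ.*-identityˡ (inv (suc t)))))
  (*-monoʳ (0≤inv (suc t)) (ι-mono {1} {suc j} (s≤s z≤n)))

gridPoint-unit : ∀ {t j} → j ℕ.≤ t → Unit (gridPoint t j)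
gridPoint-unit {t} {j} j≤t = ℚ.≤-trans (0≤inv (suc t)) (gridPoint-lower t j) ,
  ℚ.≤-trans (≤-by (inv (suc t)) (0≤inv (suc t)) refl) (gridPoint-upper j≤t)

nearest : ∀ t {p} → Unit p → ∃[ j ] j ℕ.≤ t × ℚ.∣ p ℚ.- gridPoint t j ∣ ℚ.≤ inv (suc t)
nearest t {p} (0≤p , p≤1) = [ search t , last ]′ (ℚ.≤-total p (gridPoint t t))
  where
  i = inv (suc t)
  within : ∀ j → p ℚ.≤ gridPoint t j ℚ.+ i → gridPoint t j ℚ.≤ p ℚ.+ i → ℚ.∣ p ℚ.- gridPoint t j ∣ ℚ.≤ i
  within j p≤ ≤p = ∣∣≤
    (ℚ.≤-trans (ℚ.+-monoˡ-≤ (ℚ.- g) p≤) (ℚ.≤-reflexive (solve 2 (λ g i → g :+ i :- g := i) refl g i)))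
    (ℚ.≤-trans (ℚ.≤-reflexive (solve 2 (λ p g → :- (p :- g) := g :- p) refl p g))
      (ℚ.≤-trans (ℚ.+-monoˡ-≤ (ℚ.- p) ≤p) (ℚ.≤-reflexive (solve 2 (λ p i → p :+ i :- p := i) refl p i))))
    where g = gridPoint t j
  weaken : ∀ {a b} → a ℚ.≤ b → a ℚ.≤ b ℚ.+ i
  weaken {a} {b} a≤b = ℚ.≤-trans a≤b (≤-by i (0≤inv (suc t)) refl)
  search : ∀ n → p ℚ.≤ gridPoint t n → ∃[ j ] j ℕ.≤ n × ℚ.∣ p ℚ.- gridPoint t j ∣ ℚ.≤ i
  search zero    p≤ = 0 , z≤n , within 0 (weaken p≤)
    (ℚ.≤-trans (ℚ.≤-reflexive (ℚ.*-identityˡ i)) (ℚ.≤-trans (ℚ.≤-reflexive (sym (ℚ.+-identityˡ i))) (ℚ.+-monoˡ-≤ i 0≤p)))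
  search (suc n) p≤ = [ earlier , current ]′ (ℚ.≤-total p (gridPoint t n))
    where
    earlier : p ℚ.≤ gridPoint t n → ∃[ j ] j ℕ.≤ suc n × ℚ.∣ p ℚ.- gridPoint t j ∣ ℚ.≤ i
    earlier q = let j , j≤ , c = search n q in j , ℕ.≤-trans j≤ (ℕ.n≤1+n n) , c
    current : gridPoint t n ℚ.≤ p → ∃[ j ] j ℕ.≤ suc n × ℚ.∣ p ℚ.- gridPoint t j ∣ ℚ.≤ i
    current q = n , ℕ.n≤1+n n , within n (ℚ.≤-trans p≤ (ℚ.≤-reflexive (gridPoint-suc t n))) (weaken q)
  last : gridPoint t t ℚ.≤ p → ∃[ j ] j ℕ.≤ t × ℚ.∣ p ℚ.- gridPoint t j ∣ ℚ.≤ i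
  last q = t , ℕ.≤-refl , within t (ℚ.≤-trans p≤1 (ℚ.≤-trans (ℚ.≤-reflexive (sym (ι-inv (suc t)))) (ℚ.≤-reflexive (gridPoint-suc t t)))) (weaken q)

maximum : (ℕ → ℚ) → ℕ → ℚ
maximum g zero    = g 0
maximum g (suc n) = maximum g n ℚ.⊔ g (suc n)

≤-maximum : ∀ g n {j} → j ℕ.≤ n → g j ℚ.≤ maximum g n
≤-maximum g zero    z≤n = ℚ.≤-refl
≤-maximum g (suc n) {j} j≤ = [ (λ j< → ℚ.≤-trans (≤-maximum g n (ℕ.≤-pred j<)) (ℚ.p≤p⊔q _ _)) ,
                               (λ e → subst (λ i → g i ℚ.≤ maximum g (suc n)) (sym e) (ℚ.p≤q⊔p (maximum g n) _)) ]′ (ℕ.m≤n⇒m<n∨m≡n j≤)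

maximum-attained : ∀ g n → ∃[ j ] j ℕ.≤ n × maximum g n ≡ g j
maximum-attained g zero    = 0 , z≤n , refl
maximum-attained g (suc n) = [ (λ e → let j , j≤ , f = maximum-attained g n in j , ℕ.≤-trans j≤ (ℕ.n≤1+n n) , trans e f) ,
                               (λ e → suc n , ℕ.≤-refl , e) ]′ (ℚ.⊔-sel (maximum g n) (g (suc n)))

<-≤-absurd : ∀ {a b} {X : Set} → a ℚ.< b → b ℚ.≤ a → X
<-≤-absurd a<b b≤a = contradiction (ℚ.<-≤-trans a<b b≤a) (ℚ.<-irrefl refl)

module Supremum (f : ℚ → ℚ) (K : ℕ)
                (lipschitz : ∀ {p q} → Unit p → Unit q → ℚ.∣ f p ℚ.- f q ∣ ℚ.≤ ι K ℚ.* ℚ.∣ p ℚ.- q ∣) where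

  open ℚ.≤-Reasoning

  gridMax error : ℕ → ℚ
  gridMax t = maximum (λ j → f (gridPoint t j)) t
  error t = ι K ℚ.* inv (suc t)

  ≤-gridMax : ∀ t {p} → Unit p → f p ℚ.≤ gridMax t ℚ.+ error t
  ≤-gridMax t {p} u = let j , j≤t , near = nearest t u in begin
    f p                                      ≡⟨ solve 2 (λ a b → a := b :+ (a :- b)) refl (f p) (f (gridPoint t j)) ⟩
    f (gridPoint t j) ℚ.+ (f p ℚ.- f (gridPoint t j))
      ≤⟨ ℚ.+-mono-≤ (≤-maximum (λ j → f (gridPoint t j)) t j≤t)
           (ℚ.≤-trans (≤∣∣ (f p ℚ.- f (gridPoint t j))) (ℚ.≤-trans (lipschitz u (gridPoint-unit j≤t)) (*-monoˡ (0≤ι K) near))) ⟩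
    gridMax t ℚ.+ error t                    ∎

  gridMax-attained : ∀ t → ∃[ j ] j ℕ.≤ t × gridMax t ≡ f (gridPoint t j)
  gridMax-attained t = maximum-attained (λ j → f (gridPoint t j)) t

  0≤error : ∀ t → 0ℚ ℚ.≤ error t
  0≤error t = 0≤* (0≤ι K) (0≤inv (suc t))

  error-vanishing : Vanishing error
  error-vanishing = vanishing-∘ suc (λ T → T , λ n T≤n → ℕ.≤-trans T≤n (ℕ.n≤1+n n)) (inv-vanishing K)

  -- The grids are not nested and their maxima need not increase; but a maximiser on one grid is a
  -- point of the interval, and there the other grid controls `f`.
  gridMax-close : ∀ a b → gridMax a ℚ.≤ gridMax b ℚ.+ (error a ℚ.+ error b)
  gridMax-close a b = let j , j≤ , e = gridMax-attained a in begin
    gridMax a                                ≡⟨ e ⟩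
    f (gridPoint a j)                        ≤⟨ ≤-gridMax b (gridPoint-unit j≤) ⟩
    gridMax b ℚ.+ error b                    ≤⟨ ℚ.+-monoʳ-≤ (gridMax b) (≤-by (error a) (0≤error a) (ℚ.+-comm (error a) (error b))) ⟩
    gridMax b ℚ.+ (error a ℚ.+ error b)      ∎

  supremum : ℝ
  supremum = mkℝ gridMax (vanishing⇒cauchy error-vanishing gridMax-close)

  module _ (g : ℝ → ℝ) (seq-g : ∀ p n → seq (g p) n ≡ f (seq p n)) where

    private
      -- A supposed excess `δ` is refuted at a single index `n`, which serves both as the precision
      -- of `p` and as the fineness of the grid, and is so large that `error n < δ`.
      bounded : ∀ p → ⟨0,1⟩ p → g p ≤ supremum
      bounded p ((α , 0<α , Tα , hα) , (β , 0<β , Tβ , hβ)) (δ , 0<δ , T , h) =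
        let Tε , hε = error-vanishing δ 0<δ
        in below ((T ⊔ Tε) ⊔ (Tα ⊔ Tβ)) Tε hε
             (ℕ.≤-trans (ℕ.m≤m⊔n T Tε) (ℕ.m≤m⊔n (T ⊔ Tε) (Tα ⊔ Tβ))) (ℕ.≤-trans (ℕ.m≤n⊔m T Tε) (ℕ.m≤m⊔n (T ⊔ Tε) (Tα ⊔ Tβ)))
             (ℕ.≤-trans (ℕ.m≤m⊔n Tα Tβ) (ℕ.m≤n⊔m (T ⊔ Tε) (Tα ⊔ Tβ))) (ℕ.≤-trans (ℕ.m≤n⊔m Tα Tβ) (ℕ.m≤n⊔m (T ⊔ Tε) (Tα ⊔ Tβ)))
        where
        below : ∀ n Tε → (∀ n → Tε ℕ.≤ n → error n ℚ.< δ) →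
                T ℕ.≤ n → Tε ℕ.≤ n → Tα ℕ.≤ n → Tβ ℕ.≤ n → {X : Set} → X
        below n Tε hε n≥ n≥ε n≥α n≥β = <-≤-absurd (hε n n≥ε) (begin
          δ                                          ≡⟨ solve 2 (λ s d → d := s :+ d :- s) refl (gridMax n) δ ⟩
          gridMax n ℚ.+ δ ℚ.- gridMax n              ≤⟨ ℚ.+-monoˡ-≤ (ℚ.- gridMax n) above ⟩
          gridMax n ℚ.+ error n ℚ.- gridMax n        ≡⟨ solve 2 (λ s d → s :+ d :- s := d) refl (gridMax n) (error n) ⟩
          error n                                    ∎)
          where
          u : Unit (seq p n)
          u = ℚ.≤-trans (ℚ.<⇒≤ 0<α) (ℚ.≤-trans (ℚ.≤-reflexive (sym (ℚ.+-identityˡ α))) (hα n n≥α)) ,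
              ℚ.≤-trans (≤-by β (ℚ.<⇒≤ 0<β) refl) (hβ n n≥β)
          above : gridMax n ℚ.+ δ ℚ.≤ gridMax n ℚ.+ error n
          above = begin
            gridMax n ℚ.+ δ                          ≤⟨ h n n≥ ⟩
            seq (g p) n                              ≡⟨ seq-g p n ⟩
            f (seq p n)                              ≤⟨ ≤-gridMax n u ⟩
            gridMax n ℚ.+ error n                    ∎

      -- The errors of the two grids take a quarter of `δ₀` each; the remaining half is the gap of
      -- the strict inequality. The witness, a maximiser on the fixed grid `T`, is rational.
      near-top : ∀ (δ : ℝ) {δ₀} → 0ℚ ℚ.< δ₀ → ∀ Tδ → (∀ n → Tδ ℕ.≤ n → δ₀ ℚ.≤ seq δ n) →
                 ∀ T → (∀ n → T ℕ.≤ n → error n ℚ.< ½ ℚ.* (½ ℚ.* δ₀)) →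
                 ∀ j → gridMax T ≡ f (gridPoint T j) →
                 ∀ n → Tδ ⊔ T ℕ.≤ n → gridMax n ℚ.- seq δ n ℚ.+ ½ ℚ.* δ₀ ℚ.≤ seq (g (fromℚ (gridPoint T j))) n
      near-top δ {δ₀} 0<δ₀ Tδ hδ T hT j attained n T≤n = begin
        gridMax n ℚ.- seq δ n ℚ.+ ½ ℚ.* δ₀
          ≤⟨ ℚ.+-monoˡ-≤ (½ ℚ.* δ₀) (ℚ.+-mono-≤ (gridMax-close n T)
               (ℚ.neg-antimono-≤ (hδ n (ℕ.m⊔n≤o⇒m≤o Tδ T T≤n)))) ⟩
        gridMax T ℚ.+ (error n ℚ.+ error T) ℚ.- δ₀ ℚ.+ ½ ℚ.* δ₀
          ≤⟨ ℚ.+-monoˡ-≤ (½ ℚ.* δ₀) (ℚ.+-monoˡ-≤ (ℚ.- δ₀) (ℚ.+-monoʳ-≤ (gridMax T)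
               (ℚ.+-mono-≤ (ℚ.<⇒≤ (hT n (ℕ.m⊔n≤o⇒n≤o Tδ T T≤n))) (ℚ.<⇒≤ (hT T ℕ.≤-refl))))) ⟩
        gridMax T ℚ.+ (½ ℚ.* (½ ℚ.* δ₀) ℚ.+ ½ ℚ.* (½ ℚ.* δ₀)) ℚ.- δ₀ ℚ.+ ½ ℚ.* δ₀
          ≡⟨ solve 2 (λ s d → s :+ (con ½ :* (con ½ :* d) :+ con ½ :* (con ½ :* d)) :- d :+ con ½ :* d := s) refl (gridMax T) δ₀ ⟩
        gridMax T
          ≡⟨ attained ⟩
        f (gridPoint T j)
          ≡⟨ seq-g (fromℚ (gridPoint T j)) n ⟨
        seq (g (fromℚ (gridPoint T j))) n ∎

      gridPoint-⟨0,1⟩ : ∀ {T j} → j ℕ.≤ T → ⟨0,1⟩ (fromℚ (gridPoint T j))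
      gridPoint-⟨0,1⟩ {T} {j} j≤T =
        (inv (suc T) , 0<inv (suc T) , 0 , λ _ _ → ℚ.≤-trans (ℚ.≤-reflexive (ℚ.+-identityˡ (inv (suc T)))) (gridPoint-lower T j)) ,
        (inv (suc T) , 0<inv (suc T) , 0 , λ _ _ → gridPoint-upper j≤T)

      approached : ∀ δ → 0ℝ < δ → ∃[ p ] ⟨0,1⟩ p × supremum - δ < g p
      approached δ (δ₀ , 0<δ₀ , Tδ , hδ) =
        let T , hT = error-vanishing (½ ℚ.* (½ ℚ.* δ₀)) (0<half (0<half 0<δ₀))
            j , j≤ , attained = gridMax-attained T
        in fromℚ (gridPoint T j) , gridPoint-⟨0,1⟩ j≤ , ½ ℚ.* δ₀ , 0<half 0<δ₀ , Tδ ⊔ T ,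
           near-top δ 0<δ₀ Tδ (λ n T≤n → ℚ.≤-trans (ℚ.≤-reflexive (sym (ℚ.+-identityˡ δ₀))) (hδ n T≤n)) T hT j attained

    isSupremum : IsSupremum ⟨0,1⟩ g supremum
    isSupremum = bounded , approached

-- The limit of the suprema

⌊/2⌋-unbounded : ∀ T → ∃[ T′ ] ∀ n → T′ ℕ.≤ n → T ℕ.≤ ⌊ n /2⌋
⌊/2⌋-unbounded T = T ℕ.+ T , λ n T≤n → ℕ.≤-trans (ℕ.≤-reflexive (ℕ.n≡⌊n+n/2⌋ T)) (ℕ.⌊n/2⌋-mono T≤n)

deviation-vanishing : Vanishing deviation
deviation-vanishing = vanishing-∘ level ⌊/2⌋-unbounded (inv-vanishing 61)

module Limit (f : ℕ → ℚ → ℚ) (v : ℕ → ℚ) (K : ℕ → ℕ) (K*v≡1 : ∀ n → ι (K n) ℚ.* v n ≡ 1ℚ) (0≤v : ∀ n → 0ℚ ℚ.≤ v n)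
             (lipschitz : ∀ n {p q} → Unit p → Unit q → ℚ.∣ f n p ℚ.- f n q ∣ ℚ.≤ ι (K n ℕ.* K n) ℚ.* ℚ.∣ p ℚ.- q ∣)
             (err : ℕ → ℚ) (err-vanishing : Vanishing err)
             (close : ∀ {p} → Unit p → ∀ n n′ → f n p ℚ.* v n ℚ.≤ f n′ p ℚ.* v n′ ℚ.+ (err n ℚ.+ err n′)) where

  open ℚ.≤-Reasoning
  private
    module Sup (n : ℕ) = Supremum (f n) (K n ℕ.* K n) (lipschitz n)

  top : ℕ → ℕ → ℚ
  top n t = Sup.gridMax n t ℚ.* v n

  top-attained : ∀ n t → ∃[ q ] Unit q × top n t ≡ f n q ℚ.* v n
  top-attained n t = let j , j≤ , e = Sup.gridMax-attained n t in
    gridPoint t j , gridPoint-unit j≤ , cong (ℚ._* v n) e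

  -- Division by `K n` removes one of the two factors of the Lipschitz constant. The other one
  -- remains, so no single fineness serves all `n`.
  ≤-top : ∀ n t {p} → Unit p → f n p ℚ.* v n ℚ.≤ top n t ℚ.+ ι (K n) ℚ.* inv (suc t)
  ≤-top n t {p} u = begin
    f n p ℚ.* v n                                                     ≤⟨ *-monoʳ (0≤v n) (Sup.≤-gridMax n t u) ⟩
    (Sup.gridMax n t ℚ.+ ι (K n ℕ.* K n) ℚ.* inv (suc t)) ℚ.* v n     ≡⟨ cong (λ x → (Sup.gridMax n t ℚ.+ x ℚ.* inv (suc t)) ℚ.* v n) (ι-* (K n) (K n)) ⟩
    (Sup.gridMax n t ℚ.+ ι (K n) ℚ.* ι (K n) ℚ.* inv (suc t)) ℚ.* v n
      ≡⟨ solve 4 (λ g k i v → (g :+ k :* k :* i) :* v := g :* v :+ (k :* v) :* (k :* i)) refl (Sup.gridMax n t) (ι (K n)) (inv (suc t)) (v n) ⟩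
    top n t ℚ.+ (ι (K n) ℚ.* v n) ℚ.* (ι (K n) ℚ.* inv (suc t))       ≡⟨ cong (λ x → top n t ℚ.+ x ℚ.* (ι (K n) ℚ.* inv (suc t))) (K*v≡1 n) ⟩
    top n t ℚ.+ 1ℚ ℚ.* (ι (K n) ℚ.* inv (suc t))                      ≡⟨ cong (top n t ℚ.+_) (ℚ.*-identityˡ (ι (K n) ℚ.* inv (suc t))) ⟩
    top n t ℚ.+ ι (K n) ℚ.* inv (suc t)                               ∎

  -- A grid fine enough for the Lipschitz error to be at most 1 / (n + 1).
  fineness : ℕ → ℕ
  fineness n = K n ℕ.* suc n

  fine-error : ∀ n → ι (K n) ℚ.* inv (suc (fineness n)) ℚ.≤ inv n
  fine-error n = begin
    ι (K n) ℚ.* i                                        ≡⟨ ℚ.*-identityʳ (ι (K n) ℚ.* i) ⟨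
    ι (K n) ℚ.* i ℚ.* 1ℚ                                 ≡⟨ cong (ι (K n) ℚ.* i ℚ.*_) (ι-inv n) ⟨
    ι (K n) ℚ.* i ℚ.* (ι (suc n) ℚ.* inv n)              ≡⟨ solve 4 (λ k i s j → k :* i :* (s :* j) := (k :* s) :* i :* j) refl (ι (K n)) i (ι (suc n)) (inv n) ⟩
    ι (K n) ℚ.* ι (suc n) ℚ.* i ℚ.* inv n                ≡⟨ cong (λ x → x ℚ.* i ℚ.* inv n) (ι-* (K n) (suc n)) ⟨
    ι (fineness n) ℚ.* i ℚ.* inv n                       ≤⟨ *-monoʳ (0≤inv n) (*-monoʳ (0≤inv (suc (fineness n))) (ι-mono (ℕ.m≤n+m (fineness n) 2))) ⟩
    ι (suc (suc (fineness n))) ℚ.* i ℚ.* inv n           ≡⟨ cong (ℚ._* inv n) (ι-inv (suc (fineness n))) ⟩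
    1ℚ ℚ.* inv n                                         ≡⟨ ℚ.*-identityˡ (inv n) ⟩
    inv n                                                ∎
    where i = inv (suc (fineness n))

  -- A diagonal sequence: its n-th term is the n-th normalised supremum, taken to a precision that
  -- improves with `n`.
  limitSeq : ℕ → ℚ
  limitSeq n = top n (fineness n)

  ≤-limitSeq : ∀ n {p} → Unit p → f n p ℚ.* v n ℚ.≤ limitSeq n ℚ.+ inv n
  ≤-limitSeq n u = ℚ.≤-trans (≤-top n (fineness n) u) (ℚ.+-monoʳ-≤ (limitSeq n) (fine-error n))

  limitSeq-attained : ∀ n → ∃[ q ] Unit q × limitSeq n ≡ f n q ℚ.* v n
  limitSeq-attained n = top-attained n (fineness n)

  modulus : ℕ → ℚ
  modulus n = err n ℚ.+ inv n

  inv-vanishing₁ : Vanishing inv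
  inv-vanishing₁ δ 0<δ = let T , h = inv-vanishing 1 δ 0<δ in T , λ n T≤n → subst (ℚ._< δ) (ℚ.*-identityˡ (inv n)) (h n T≤n)

  modulus-vanishing : Vanishing modulus
  modulus-vanishing = vanishing-+ err-vanishing inv-vanishing₁

  limitSeq-≥ : ∀ n n′ t → top n t ℚ.≤ limitSeq n′ ℚ.+ (err n ℚ.+ modulus n′)
  limitSeq-≥ n n′ t = let q , u , e = top-attained n t in begin
    top n t                                               ≡⟨ e ⟩
    f n q ℚ.* v n                                         ≤⟨ close u n n′ ⟩
    f n′ q ℚ.* v n′ ℚ.+ (err n ℚ.+ err n′)                ≤⟨ ℚ.+-monoˡ-≤ (err n ℚ.+ err n′) (≤-limitSeq n′ u) ⟩
    limitSeq n′ ℚ.+ inv n′ ℚ.+ (err n ℚ.+ err n′)         ≡⟨ solve 4 (λ l i e e′ → l :+ i :+ (e :+ e′) := l :+ (e :+ (e′ :+ i))) refl (limitSeq n′) (inv n′) (err n) (err n′) ⟩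
    limitSeq n′ ℚ.+ (err n ℚ.+ modulus n′)                ∎

  limitSeq-≤ : ∀ n n′ t → limitSeq n′ ℚ.≤ top n t ℚ.+ (err n ℚ.+ err n′ ℚ.+ ι (K n) ℚ.* inv (suc t))
  limitSeq-≤ n n′ t = let q , u , e = limitSeq-attained n′ in begin
    limitSeq n′                                           ≡⟨ e ⟩
    f n′ q ℚ.* v n′                                       ≤⟨ close u n′ n ⟩
    f n q ℚ.* v n ℚ.+ (err n′ ℚ.+ err n)                  ≤⟨ ℚ.+-monoˡ-≤ (err n′ ℚ.+ err n) (≤-top n t u) ⟩
    top n t ℚ.+ ι (K n) ℚ.* inv (suc t) ℚ.+ (err n′ ℚ.+ err n)
      ≡⟨ solve 4 (λ l k e e′ → l :+ k :+ (e′ :+ e) := l :+ (e :+ e′ :+ k)) refl (top n t) (ι (K n) ℚ.* inv (suc t)) (err n) (err n′) ⟩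
    top n t ℚ.+ (err n ℚ.+ err n′ ℚ.+ ι (K n) ℚ.* inv (suc t)) ∎

  limitSeq-close : ∀ a b → limitSeq a ℚ.≤ limitSeq b ℚ.+ (modulus a ℚ.+ modulus b)
  limitSeq-close a b = ℚ.≤-trans (limitSeq-≥ a b (fineness a))
    (ℚ.+-monoʳ-≤ (limitSeq b) (ℚ.+-monoˡ-≤ (modulus b) (≤-by {err a} (inv a) (0≤inv a) refl)))

  limit : ℝ
  limit = mkℝ limitSeq (vanishing⇒cauchy modulus-vanishing limitSeq-close)

  private
    quarter : ℚ → ℚ
    quarter δ = ½ ℚ.* (½ ℚ.* δ)

    0<quarter : ∀ {δ} → 0ℚ ℚ.< δ → 0ℚ ℚ.< quarter δ
    0<quarter 0<δ = 0<half (0<half 0<δ)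

  converges : (a : ℕ → ℝ) → (∀ n t → seq (a (suc n)) t ≡ top n t) → a ⟶ limit
  converges a seq-a δ (δ₀ , 0<δ₀ , Tδ , hδ) =
    let T , h   = err-vanishing (quarter δ₀) (0<quarter 0<δ₀)
        T′ , h′ = modulus-vanishing (quarter δ₀) (0<quarter 0<δ₀)
    -- The terms of `a` are described by `top` from index 1 on only.
    in suc T , eventually T h T′ h′
    where
    δ₀≤ : ∀ t → Tδ ℕ.≤ t → δ₀ ℚ.≤ seq δ t
    δ₀≤ t T≤t = ℚ.≤-trans (ℚ.≤-reflexive (sym (ℚ.+-identityˡ δ₀))) (hδ t T≤t)
    -- In either inequality the errors use at most three quarters of `δ₀`, and one quarter is left
    -- as the gap of the strict inequality.
    δ₁ = quarter δ₀
    eventually : ∀ T → (∀ n → T ℕ.≤ n → err n ℚ.< δ₁) → ∀ T′ → (∀ n → T′ ℕ.≤ n → modulus n ℚ.< δ₁) →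
                 ∀ k → suc T ℕ.≤ k → limit - δ < a k × a k < limit + δ
    eventually T h T′ h′ (suc n) (s≤s T≤n) =
      let T″ , h″ = inv-vanishing (K n) δ₁ (0<quarter 0<δ₀)
      in (δ₁ , 0<quarter 0<δ₀ , (Tδ ⊔ T″) ⊔ (T ⊔ T′) ,
           λ t t≥ → below t T″ h″ (ℕ.≤-trans (ℕ.m≤m⊔n Tδ T″) (ℕ.≤-trans (ℕ.m≤m⊔n (Tδ ⊔ T″) (T ⊔ T′)) t≥))
                                  (ℕ.≤-trans (ℕ.m≤n⊔m Tδ T″) (ℕ.≤-trans (ℕ.m≤m⊔n (Tδ ⊔ T″) (T ⊔ T′)) t≥))
                                  (ℕ.≤-trans (ℕ.m≤m⊔n T T′) (ℕ.≤-trans (ℕ.m≤n⊔m (Tδ ⊔ T″) (T ⊔ T′)) t≥))) ,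
         (δ₁ , 0<quarter 0<δ₀ , Tδ ⊔ T′ ,
           λ t t≥ → above t (ℕ.≤-trans (ℕ.m≤m⊔n Tδ T′) t≥) (ℕ.≤-trans (ℕ.m≤n⊔m Tδ T′) t≥))
      where
      below : ∀ t T″ → (∀ t → T″ ℕ.≤ t → ι (K n) ℚ.* inv t ℚ.< δ₁) → Tδ ℕ.≤ t → T″ ℕ.≤ t → T ℕ.≤ t →
              limitSeq t ℚ.- seq δ t ℚ.+ δ₁ ℚ.≤ seq (a (suc n)) t
      below t T″ h″ tδ t″ tT = begin
        limitSeq t ℚ.- seq δ t ℚ.+ δ₁
          ≤⟨ ℚ.+-monoˡ-≤ δ₁ (ℚ.+-mono-≤ (limitSeq-≤ n t t) (ℚ.neg-antimono-≤ (δ₀≤ t tδ))) ⟩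
        top n t ℚ.+ (err n ℚ.+ err t ℚ.+ ι (K n) ℚ.* inv (suc t)) ℚ.- δ₀ ℚ.+ δ₁
          ≤⟨ ℚ.+-monoˡ-≤ δ₁ (ℚ.+-monoˡ-≤ (ℚ.- δ₀) (ℚ.+-monoʳ-≤ (top n t) (ℚ.+-mono-≤ (ℚ.+-mono-≤
               (ℚ.<⇒≤ (h n T≤n)) (ℚ.<⇒≤ (h t tT))) (ℚ.<⇒≤ (h″ (suc t) (ℕ.≤-trans t″ (ℕ.n≤1+n t))))))) ⟩
        top n t ℚ.+ (δ₁ ℚ.+ δ₁ ℚ.+ δ₁) ℚ.- δ₀ ℚ.+ δ₁
          ≡⟨ solve 2 (λ s d → let q = con ½ :* (con ½ :* d) in s :+ (q :+ q :+ q) :- d :+ q := s) refl (top n t) δ₀ ⟩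
        top n t
          ≡⟨ seq-a n t ⟨
        seq (a (suc n)) t ∎
      above : ∀ t → Tδ ℕ.≤ t → T′ ℕ.≤ t → seq (a (suc n)) t ℚ.+ δ₁ ℚ.≤ limitSeq t ℚ.+ seq δ t
      above t tδ t′ = begin
        seq (a (suc n)) t ℚ.+ δ₁
          ≡⟨ cong (ℚ._+ δ₁) (seq-a n t) ⟩
        top n t ℚ.+ δ₁
          ≤⟨ ℚ.+-monoˡ-≤ δ₁ (limitSeq-≥ n t t) ⟩
        limitSeq t ℚ.+ (err n ℚ.+ modulus t) ℚ.+ δ₁
          ≤⟨ ℚ.+-monoˡ-≤ δ₁ (ℚ.+-monoʳ-≤ (limitSeq t) (ℚ.+-mono-≤ (ℚ.<⇒≤ (h n T≤n)) (ℚ.<⇒≤ (h′ t t′)))) ⟩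
        limitSeq t ℚ.+ (δ₁ ℚ.+ δ₁) ℚ.+ δ₁
          ≤⟨ ≤-by δ₁ (ℚ.<⇒≤ (0<quarter 0<δ₀)) (solve 2 (λ l d → let q = con ½ :* (con ½ :* d) in l :+ d := l :+ (q :+ q) :+ q :+ q) refl (limitSeq t) δ₀) ⟩
        limitSeq t ℚ.+ δ₀
          ≤⟨ ℚ.+-monoʳ-≤ (limitSeq t) (δ₀≤ t tδ) ⟩
        limitSeq t ℚ.+ seq δ t ∎

-- Suprema, limit and numerical bounds for the hexagonal lattice

meanComponents-lipschitz² : ∀ m {p q} → Unit p → Unit q →
  ℚ.∣ meanComponents m p ℚ.- meanComponents m q ∣ ℚ.≤ ι (N m ℕ.* N m) ℚ.* ℚ.∣ p ℚ.- q ∣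
meanComponents-lipschitz² m {p} {q} u v = ℚ.≤-trans (meanComponents-lipschitz m u v) (ℚ.≤-reflexive
  (trans (sym (ℚ.*-assoc (ι (N m)) (ι (N m)) ℚ.∣ p ℚ.- q ∣)) (cong (ℚ._* ℚ.∣ p ℚ.- q ∣) (sym (ι-* (N m) (N m))))))

module MaxComponents (m : ℕ) = Supremum (meanComponents m) (N m ℕ.* N m) (meanComponents-lipschitz² m)

module Density = Limit (λ n → meanComponents (2 ℕ.+ n)) perVertex (λ n → N (2 ℕ.+ n))
  (λ n → ι-inverse (N (2 ℕ.+ n))) (λ n → 0≤1/ (N (2 ℕ.+ n))) (λ n → meanComponents-lipschitz² (2 ℕ.+ n))
  deviation deviation-vanishing meanDensity-close

lower-bound : fromℚ (+ 16738 / 100000) < Density.limit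
lower-bound = let T , h = Density.modulus-vanishing (+ 1 / 10000000) (ℚ.positive⁻¹ (+ 1 / 10000000)) in
  + 1 / 10000000 , ℚ.positive⁻¹ (+ 1 / 10000000) , T , λ n T≤n → above n (ℚ.<⇒≤ (h n T≤n))
  where
  open ℚ.≤-Reasoning
  μ = + 1 / 10000000
  q = + 16738 / 100000
  p₀-unit : Unit p₀
  p₀-unit = ℚ.≤ᵇ⇒≤ {0ℚ} {p₀} tt , ℚ.≤ᵇ⇒≤ {p₀} {1ℚ} tt
  above : ∀ n → Density.modulus n ℚ.≤ μ → q ℚ.+ μ ℚ.≤ Density.limitSeq n
  above n small = begin
    q ℚ.+ μ                                    ≡⟨ solve 2 (λ q m → q :+ m := q :+ m :+ m :- m) refl q μ ⟩
    q ℚ.+ μ ℚ.+ μ ℚ.- μ                        ≤⟨ ℚ.+-mono-≤ (ℚ.≤-trans value₀ (meanDensity-lower p₀-unit gap₀ n)) (ℚ.neg-antimono-≤ small) ⟩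
    meanDensity n p₀ ℚ.+ deviation n ℚ.- (deviation n ℚ.+ inv n) ≤⟨ ℚ.+-monoˡ-≤ (ℚ.- (deviation n ℚ.+ inv n)) (ℚ.+-monoˡ-≤ (deviation n) (Density.≤-limitSeq n p₀-unit)) ⟩
    Density.limitSeq n ℚ.+ inv n ℚ.+ deviation n ℚ.- (deviation n ℚ.+ inv n)
      ≡⟨ solve 3 (λ l i e → l :+ i :+ e :- (e :+ i) := l) refl (Density.limitSeq n) (inv n) (deviation n) ⟩
    Density.limitSeq n                         ∎

upper-bound : Density.limit < fromℚ (+ 17144 / 100000)
upper-bound = let T , h = deviation-vanishing (+ 1 / 100000) (ℚ.positive⁻¹ (+ 1 / 100000)) in
  + 1 / 100000 , ℚ.positive⁻¹ (+ 1 / 100000) , T , λ n T≤n → below n (ℚ.<⇒≤ (h n T≤n))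
  where
  open ℚ.≤-Reasoning
  -- Used twice, for the deviation and for the gap of the strict inequality: 0.1714 plus twice this
  -- amount is still below 0.17144.
  μ = + 1 / 100000
  below : ∀ n → deviation n ℚ.≤ μ → Density.limitSeq n ℚ.+ μ ℚ.≤ + 17144 / 100000
  below n small = let q , u , e = Density.limitSeq-attained n in go q u e
    where
    go : ∀ q → Unit q → Density.limitSeq n ≡ meanDensity n q → Density.limitSeq n ℚ.+ μ ℚ.≤ + 17144 / 100000
    go q u e = begin
      Density.limitSeq n ℚ.+ μ                   ≡⟨ cong (ℚ._+ μ) e ⟩
      meanDensity n q ℚ.+ μ                      ≤⟨ ℚ.+-monoˡ-≤ μ (meanDensity-upper u n) ⟩
      q ℚ.- ι 2 ℚ.* ⅛ ℚ.* openDensity q ℚ.+ ι 2 ℚ.* ⅛ ℚ.* closingDensity q ℚ.+ deviation n ℚ.+ μ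
                                                 ≤⟨ ℚ.+-monoˡ-≤ μ (ℚ.+-mono-≤ (ℚ.≤-trans (ℚ.≤-reflexive (upper-density q)) (parabola+quintic≤ u)) small) ⟩
      bound ℚ.+ μ ℚ.+ μ                          ≤⟨ ℚ.≤ᵇ⇒≤ {bound ℚ.+ μ ℚ.+ μ} {+ 17144 / 100000} tt ⟩
      + 17144 / 100000                           ∎

maxComponents : ℕ → ℝ
maxComponents m = MaxComponents.supremum m

maxDensity : ℕ → ℝ
maxDensity k = maxComponents (suc k) ÷ N (suc k)

-- Immediate because products of reals are formed term by term. Index `suc n` belongs to the
-- parameter `2 + n`, with which `Density` starts.
seq-maxDensity : ∀ n t → seq (maxDensity (suc n)) t ≡ Density.top n t
seq-maxDensity n t = refl

maxDensity-converges : maxDensity ⟶ Density.limit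
maxDensity-converges = Density.converges maxDensity seq-maxDensity

maxComponents-isSupremum : ∀ m → IsSupremum ⟨0,1⟩ (𝔼[C] (hexagonalLattice m)) (maxComponents m)
maxComponents-isSupremum m = MaxComponents.isSupremum m (𝔼[C] (hexagonalLattice m)) (seq-𝔼[C] m)

theorem4 :
    Σ[ s ∈ (ℕ → ℝ) ]
      (∀ m → .{{_ : NonZero m}} → IsSupremum ⟨0,1⟩ (𝔼[C] (hexagonalLattice m)) (s m)) ×
      (Σ[ L ∈ ℝ ]
        ((λ k → s (suc k) ÷ N (suc k)) ⟶ L) ×
        fromℚ (+ 16738 / 100000) < L ×
        L < fromℚ (+ 17144 / 100000))
theorem4 =
  maxComponents , (λ m → maxComponents-isSupremum m) , Density.limit , maxDensity-converges , lower-bound , upper-bound
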